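{- Let $(m,n)$ and $(m',n')$ be pairs of relatively prime natural numbers. Let $R_1=\mathbb{C}[x,y]/((y-1)(y-x))$, $R_2=\mathbb{C}[x,y,z]/((z-x)(z-y))$, $R_3(m,n)=\mathbb{C}[x,y,z]/((z-x)(z-y),\,y^m-x^n)$, $R_4(m',n')=\mathbb{C}[x,y,z]/((z-x)(z-y),\,x^{n'}y^{m'}-1)$. Then no two of the four rings $R_1$, $R_2$, $R_3(m,n)$, $R_4(m',n')$ are isomorphic as rings.
   Context: Natural numbers are positive integers. Isomorphism means isomorphism of rings, not necessarily $\mathbb{C}$-linear. -}

module Defs where

open import Algebra.Bundles using (CommutativeRing)
open import Algebra.Morphism.Structures using (IsRingIsomorphism)
import Algebra.Properties.CommutativeSemigroup as CommutativeSemigroupProperties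
import Algebra.Properties.Ring as RingProperties
import Algebra.Properties.Semiring.Exp as Exp
import Algebra.Properties.Semiring.Sum as Sum
open import Data.Fin.Base using (Fin; zero; suc)
open import Data.Fin.Patterns using (0F; 1F; 2F)
open import Data.List.Base using (List; []; _∷_; map)
open import Data.Nat.Base as ℕ using (ℕ; zero; suc)
import Data.Nat.Properties as ℕ
open import Data.Product.Base using (Σ; ∃; _×_; _,_; proj₁; proj₂)
open import Data.Rational.Base as ℚ using (ℚ; 0ℚ; 1ℚ; ½)
import Data.Rational.Properties as ℚ
open import Data.Rational.Solver using (module +-*-Solver)
open import Data.Sum.Base using (inj₁; inj₂)
open import Data.Vec.Functional as Vector using (Vector)
open import Level using (0ℓ; _⊔_)
open import Relation.Binary.PropositionalEquality as ≡ using (_≡_)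
import Relation.Binary.Reasoning.Setoid as SetoidReasoning

-- ℝ is the setoid of Cauchy sequences of rationals modulo null sequences.
-- The existential quantifier is a Σ-type, so a proof of Cauchy (or Null) is
-- also a modulus of convergence; classically this is the usual ℝ.

Null : (ℕ → ℚ) → Set
Null u = ∀ ε → 0ℚ ℚ.< ε → ∃ λ N → ∀ n → N ℕ.≤ n → ℚ.∣ u n ∣ ℚ.< ε

Cauchy : (ℕ → ℚ) → Set
Cauchy u = ∀ ε → 0ℚ ℚ.< ε →
  ∃ λ N → ∀ m n → N ℕ.≤ m → N ℕ.≤ n → ℚ.∣ u m ℚ.- u n ∣ ℚ.< ε

Bounded : (ℕ → ℚ) → Set
Bounded u = ∃ λ B → 0ℚ ℚ.< B × (∀ n → ℚ.∣ u n ∣ ℚ.≤ B)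

record ℝ : Set where
  constructor mkℝ
  field
    seq    : ℕ → ℚ
    cauchy : Cauchy seq

open ℝ public

infix 4 _≈ᴿ_

record _≈ᴿ_ (x y : ℝ) : Set where
  constructor mk≈
  field
    null : Null (λ n → seq x n ℚ.- seq y n)

open _≈ᴿ_ public

module RealArithmetic where

  open import Data.Rational.Base using (_+_; _*_; _-_; -_; ∣_∣; _<_; _≤_)
  open ≡ using (sym; cong; subst)
  open +-*-Solver using (solve; _:+_; _:*_; _:-_; :-_; _:=_)

  half>0 : ∀ {ε} → 0ℚ < ε → 0ℚ < ½ * ε
  half>0 {ε} ε>0 = subst (_< ½ * ε) (ℚ.*-zeroʳ ½) (ℚ.*-monoʳ-<-pos ½ ε>0)

  half+half : ∀ ε → ½ * ε + ½ * ε ≡ ε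
  half+half ε = ≡.trans (sym (ℚ.*-distribʳ-+ ε ½ ½)) (ℚ.*-identityˡ ε)

  split-< : ∀ {p q ε} → ∣ p ∣ < ½ * ε → ∣ q ∣ < ½ * ε → ∣ p + q ∣ < ε
  split-< {p} {q} {ε} p< q< = ℚ.≤-<-trans (ℚ.∣p+q∣≤∣p∣+∣q∣ p q)
    (subst (∣ p ∣ + ∣ q ∣ <_) (half+half ε) (ℚ.+-mono-< p< q<))

  shrink : ∀ B {ε} → 0ℚ < B → 0ℚ < ε → ∃ λ δ → 0ℚ < δ × B * δ ≡ ε
  shrink B {ε} B>0 ε>0 = B⁻¹ * ε
    , subst (_< B⁻¹ * ε) (ℚ.*-zeroʳ B⁻¹) (ℚ.*-monoʳ-<-pos B⁻¹ ε>0)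
    , (begin
        B * (B⁻¹ * ε)  ≡⟨ ℚ.*-assoc B B⁻¹ ε ⟨
        B * B⁻¹ * ε    ≡⟨ cong (_* ε) (ℚ.*-inverseʳ B) ⟩
        1ℚ * ε         ≡⟨ ℚ.*-identityˡ ε ⟩
        ε              ∎)
    where
    open ≡.≡-Reasoning
    instance
      B-positive = ℚ.positive B>0
      B-nonZero  = ℚ.pos⇒nonZero B
    B⁻¹ = ℚ.1/ B
    instance
      B⁻¹-positive = ℚ.1/pos⇒pos B

  scaled-< : ∀ {B δ ε p q} → 0ℚ < B → B * δ ≡ ε → ∣ p ∣ ≤ B → ∣ q ∣ < δ → ∣ p * q ∣ < ε
  scaled-< {B} {δ} {ε} {p} {q} B>0 Bδ≡ε p≤B q<δ = begin-strict
    ∣ p * q ∣      ≡⟨ ℚ.∣p*q∣≡∣p∣*∣q∣ p q ⟩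
    ∣ p ∣ * ∣ q ∣  ≤⟨ ℚ.*-monoʳ-≤-nonNeg ∣ q ∣ p≤B ⟩
    B * ∣ q ∣      <⟨ ℚ.*-monoʳ-<-pos B q<δ ⟩
    B * δ          ≡⟨ Bδ≡ε ⟩
    ε              ∎
    where
    open ℚ.≤-Reasoning
    instance
      B-positive  = ℚ.positive B>0
      q-nonNeg    = ℚ.∣-∣-nonNeg q

  bounded : ∀ {u} → Cauchy u → Bounded u
  bounded {u} u-cauchy with u-cauchy 1ℚ (ℚ.positive⁻¹ 1ℚ)
  ... | N , near = B + (1ℚ + ∣ u N ∣) , B>0 , below
    where
    initial : ∀ k → ∃ λ C → 0ℚ ≤ C × (∀ n → n ℕ.< k → ∣ u n ∣ ≤ C)
    initial zero = 0ℚ , ℚ.≤-refl , λ _ ()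
    initial (suc k) with initial k
    ... | C , C≥0 , below-C = C ℚ.⊔ ∣ u k ∣ , ℚ.≤-trans C≥0 (ℚ.p≤p⊔q C ∣ u k ∣) , go
      where
      go : ∀ n → n ℕ.< suc k → ∣ u n ∣ ≤ C ℚ.⊔ ∣ u k ∣
      go n n<1+k with ℕ.m≤n⇒m<n∨m≡n (ℕ.≤-pred n<1+k)
      ... | inj₁ n<k    = ℚ.≤-trans (below-C n n<k) (ℚ.p≤p⊔q C ∣ u k ∣)
      ... | inj₂ ≡.refl = ℚ.p≤q⊔p C ∣ u k ∣
    B   = proj₁ (initial N)
    B≥0 = proj₁ (proj₂ (initial N))

    1+∣uN∣>0 : 0ℚ < 1ℚ + ∣ u N ∣
    1+∣uN∣>0 = ℚ.+-mono-<-≤ (ℚ.positive⁻¹ 1ℚ) (ℚ.0≤∣p∣ (u N))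

    B>0 : 0ℚ < B + (1ℚ + ∣ u N ∣)
    B>0 = ℚ.+-mono-≤-< B≥0 1+∣uN∣>0

    below : ∀ n → ∣ u n ∣ ≤ B + (1ℚ + ∣ u N ∣)
    below n with ℕ.<-≤-connex n N
    ... | inj₁ n<N = begin
      ∣ u n ∣                ≤⟨ proj₂ (proj₂ (initial N)) n n<N ⟩
      B                      ≡⟨ ℚ.+-identityʳ B ⟨
      B + 0ℚ                 ≤⟨ ℚ.+-monoʳ-≤ B (ℚ.<⇒≤ 1+∣uN∣>0) ⟩
      B + (1ℚ + ∣ u N ∣)     ∎
      where open ℚ.≤-Reasoning
    ... | inj₂ N≤n = begin
      ∣ u n ∣                    ≡⟨ cong ∣_∣ (solve 2 (λ a b → a := (a :- b) :+ b) ≡.refl (u n) (u N)) ⟩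
      ∣ u n - u N + u N ∣        ≤⟨ ℚ.∣p+q∣≤∣p∣+∣q∣ (u n - u N) (u N) ⟩
      ∣ u n - u N ∣ + ∣ u N ∣    ≤⟨ ℚ.+-monoˡ-≤ ∣ u N ∣ (ℚ.<⇒≤ (near n N N≤n ℕ.≤-refl)) ⟩
      1ℚ + ∣ u N ∣               ≡⟨ ℚ.+-identityˡ _ ⟨
      0ℚ + (1ℚ + ∣ u N ∣)        ≤⟨ ℚ.+-monoˡ-≤ (1ℚ + ∣ u N ∣) B≥0 ⟩
      B + (1ℚ + ∣ u N ∣)         ∎
      where open ℚ.≤-Reasoning

  null-≗ : ∀ {u v} → (∀ n → u n ≡ v n) → Null u → Null v
  null-≗ u≗v u-null ε ε>0 with u-null ε ε>0
  ... | N , small = N , λ n N≤n → subst (λ a → ∣ a ∣ < ε) (u≗v n) (small n N≤n)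

  null-0 : Null (λ _ → 0ℚ)
  null-0 ε ε>0 = 0 , λ _ _ → ε>0

  null-+ : ∀ {u v} → Null u → Null v → Null (λ n → u n + v n)
  null-+ {u} {v} u-null v-null ε ε>0
    with u-null (½ * ε) (half>0 ε>0) | v-null (½ * ε) (half>0 ε>0)
  ... | M , u-small | N , v-small = M ℕ.⊔ N , λ n M⊔N≤n →
    split-< {u n} {v n} (u-small n (ℕ.m⊔n≤o⇒m≤o M N M⊔N≤n)) (v-small n (ℕ.m⊔n≤o⇒n≤o M N M⊔N≤n))

  null-neg : ∀ {u} → Null u → Null (λ n → - u n)
  null-neg {u} u-null ε ε>0 with u-null ε ε>0
  ... | N , small = N , λ n N≤n → subst (_< ε) (sym (ℚ.∣-p∣≡∣p∣ (u n))) (small n N≤n)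

  null-* : ∀ {u v} → Bounded u → Null v → Null (λ n → u n * v n)
  null-* {u} {v} (B , B>0 , u≤B) v-null ε ε>0 with shrink B B>0 ε>0
  ... | δ , δ>0 , Bδ≡ε with v-null δ δ>0
  ... | N , small = N , λ n N≤n → scaled-< {p = u n} {v n} B>0 Bδ≡ε (u≤B n) (small n N≤n)

  cauchy-const : ∀ q → Cauchy (λ _ → q)
  cauchy-const q ε ε>0 = 0 , λ _ _ _ _ → subst (λ a → ∣ a ∣ < ε) (sym (ℚ.+-inverseʳ q)) ε>0

  cauchy-+ : ∀ {u v} → Cauchy u → Cauchy v → Cauchy (λ n → u n + v n)
  cauchy-+ {u} {v} u-cauchy v-cauchy ε ε>0
    with u-cauchy (½ * ε) (half>0 ε>0) | v-cauchy (½ * ε) (half>0 ε>0)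
  ... | M , u-near | N , v-near = M ℕ.⊔ N , λ m n ≤m ≤n →
    subst (λ a → ∣ a ∣ < ε)
      (solve 4 (λ a b c d → (a :- b) :+ (c :- d) := (a :+ c) :- (b :+ d)) ≡.refl (u m) (u n) (v m) (v n))
      (split-< {u m - u n} {v m - v n}
        (u-near m n (ℕ.m⊔n≤o⇒m≤o M N ≤m) (ℕ.m⊔n≤o⇒m≤o M N ≤n))
        (v-near m n (ℕ.m⊔n≤o⇒n≤o M N ≤m) (ℕ.m⊔n≤o⇒n≤o M N ≤n)))

  cauchy-neg : ∀ {u} → Cauchy u → Cauchy (λ n → - u n)
  cauchy-neg {u} u-cauchy ε ε>0 with u-cauchy ε ε>0
  ... | N , near = N , λ m n N≤m N≤n → subst (_< ε)
    (≡.trans (sym (ℚ.∣-p∣≡∣p∣ (u m - u n)))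
      (cong ∣_∣ (solve 2 (λ a b → :- (a :- b) := :- a :- :- b) ≡.refl (u m) (u n))))
    (near m n N≤m N≤n)

  cauchy-* : ∀ {u v} → Cauchy u → Cauchy v → Cauchy (λ n → u n * v n)
  cauchy-* {u} {v} u-cauchy v-cauchy ε ε>0 with bounded u-cauchy | bounded v-cauchy
  ... | B , B>0 , u≤B | C , C>0 , v≤C
    with shrink B B>0 (half>0 ε>0) | shrink C C>0 (half>0 ε>0)
  ... | δ , δ>0 , Bδ≡ | η , η>0 , Cη≡ with v-cauchy δ δ>0 | u-cauchy η η>0
  ... | M , v-near | N , u-near = M ℕ.⊔ N , λ m n ≤m ≤n →
    subst (λ a → ∣ a ∣ < ε)
      (solve 4 (λ a b c d → a :* (c :- d) :+ d :* (a :- b) := a :* c :- b :* d) ≡.refl (u m) (u n) (v m) (v n))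
      (split-< {u m * (v m - v n)} {v n * (u m - u n)}
        (scaled-< {p = u m} {v m - v n} B>0 Bδ≡ (u≤B m)
          (v-near m n (ℕ.m⊔n≤o⇒m≤o M N ≤m) (ℕ.m⊔n≤o⇒m≤o M N ≤n)))
        (scaled-< {p = v n} {u m - u n} C>0 Cη≡ (v≤C n)
          (u-near m n (ℕ.m⊔n≤o⇒n≤o M N ≤m) (ℕ.m⊔n≤o⇒n≤o M N ≤n))))

open RealArithmetic

infixl 6 _+ᴿ_
infixl 7 _*ᴿ_
infix  8 -ᴿ_

fromℚ : ℚ → ℝ
fromℚ q = mkℝ (λ _ → q) (cauchy-const q)

_+ᴿ_ _*ᴿ_ : ℝ → ℝ → ℝ
x +ᴿ y = mkℝ (λ n → seq x n ℚ.+ seq y n) (cauchy-+ {seq x} {seq y} (cauchy x) (cauchy y))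
x *ᴿ y = mkℝ (λ n → seq x n ℚ.* seq y n) (cauchy-* {seq x} {seq y} (cauchy x) (cauchy y))

-ᴿ_ : ℝ → ℝ
-ᴿ x = mkℝ (λ n → ℚ.- seq x n) (cauchy-neg {seq x} (cauchy x))

private
  pointwise : ∀ {x y} → (∀ n → seq x n ≡ seq y n) → x ≈ᴿ y
  pointwise {x} {y} x≗y = mk≈ (null-≗ (λ n → ≡.sym (x-y≡0 n)) null-0)
    where
    x-y≡0 : ∀ n → seq x n ℚ.- seq y n ≡ 0ℚ
    x-y≡0 n = ≡.trans (≡.cong (ℚ._- seq y n) (x≗y n)) (ℚ.+-inverseʳ (seq y n))

ℝ-commutativeRing : CommutativeRing 0ℓ 0ℓ
ℝ-commutativeRing = record
  { Carrier = ℝ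
  ; _≈_ = _≈ᴿ_
  ; _+_ = _+ᴿ_
  ; _*_ = _*ᴿ_
  ; -_  = -ᴿ_
  ; 0#  = fromℚ 0ℚ
  ; 1#  = fromℚ 1ℚ
  ; isCommutativeRing = record
    { isRing = record
      { +-isAbelianGroup = record
        { isGroup = record
          { isMonoid = record
            { isSemigroup = record
              { isMagma = record
                { isEquivalence = record
                  { refl  = pointwise λ _ → ≡.refl
                  ; sym   = λ {x} {y} (mk≈ p) → mk≈ (null-≗
                      (λ n → solve 2 (λ a b → :- (a :- b) := b :- a) ≡.refl (seq x n) (seq y n))
                      (null-neg p))
                  ; trans = λ {x} {y} {z} (mk≈ p) (mk≈ q) → mk≈ (null-≗
                      (λ n → solve 3 (λ a b c → (a :- b) :+ (b :- c) := a :- c) ≡.refl (seq x n) (seq y n) (seq z n))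
                      (null-+ p q))
                  }
                ; ∙-cong = λ {x} {y} {u} {v} (mk≈ p) (mk≈ q) → mk≈ (null-≗
                    (λ n → solve 4 (λ a b c d → (a :- b) :+ (c :- d) := (a :+ c) :- (b :+ d)) ≡.refl
                      (seq x n) (seq y n) (seq u n) (seq v n))
                    (null-+ p q))
                }
              ; assoc = λ x y z → pointwise λ n → ℚ.+-assoc (seq x n) (seq y n) (seq z n)
              }
            ; identity = (λ x → pointwise λ n → ℚ.+-identityˡ (seq x n))
                       , (λ x → pointwise λ n → ℚ.+-identityʳ (seq x n))
            }
          ; inverse = (λ x → pointwise λ n → ℚ.+-inverseˡ (seq x n))
                    , (λ x → pointwise λ n → ℚ.+-inverseʳ (seq x n))
          ; ⁻¹-cong = λ {x} {y} (mk≈ p) → mk≈ (null-≗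
              (λ n → solve 2 (λ a b → :- (a :- b) := :- a :- :- b) ≡.refl (seq x n) (seq y n))
              (null-neg p))
          }
        ; comm = λ x y → pointwise λ n → ℚ.+-comm (seq x n) (seq y n)
        }
      ; *-cong = λ {x} {y} {u} {v} (mk≈ p) (mk≈ q) → mk≈ (null-≗
          (λ n → solve 4 (λ a b c d → a :* (c :- d) :+ d :* (a :- b) := a :* c :- b :* d) ≡.refl
            (seq x n) (seq y n) (seq u n) (seq v n))
          (null-+ {λ n → seq x n ℚ.* (seq u n ℚ.- seq v n)} {λ n → seq v n ℚ.* (seq x n ℚ.- seq y n)}
            (null-* {seq x} (bounded {seq x} (cauchy x)) q)
            (null-* {seq v} (bounded {seq v} (cauchy v)) p)))
      ; *-assoc = λ x y z → pointwise λ n → ℚ.*-assoc (seq x n) (seq y n) (seq z n)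
      ; *-identity = (λ x → pointwise λ n → ℚ.*-identityˡ (seq x n))
                   , (λ x → pointwise λ n → ℚ.*-identityʳ (seq x n))
      ; distrib = (λ x y z → pointwise λ n → ℚ.*-distribˡ-+ (seq x n) (seq y n) (seq z n))
                , (λ x y z → pointwise λ n → ℚ.*-distribʳ-+ (seq x n) (seq y n) (seq z n))
      }
    ; *-comm = λ x y → pointwise λ n → ℚ.*-comm (seq x n) (seq y n)
    }
  }
  where open +-*-Solver using (solve; _:+_; _:*_; _:-_; :-_; _:=_)

-- A[i] = A[t]/(t² + 1), with elements written re + i·im.

module AdjoinI {c ℓ} (A : CommutativeRing c ℓ) where

  open CommutativeRing A
  open RingProperties ring
  open CommutativeSemigroupProperties +-commutativeSemigroup using (interchange)
  open SetoidReasoning setoid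

  infix 4 _≈ⁱ_

  record A[i] : Set c where
    constructor _+i_
    field
      re im : Carrier

  open A[i] public

  record _≈ⁱ_ (z w : A[i]) : Set ℓ where
    constructor _,_
    field
      re-≈ : re z ≈ re w
      im-≈ : im z ≈ im w

  open _≈ⁱ_ public

  infixl 6 _+ⁱ_
  infixl 7 _*ⁱ_

  _+ⁱ_ _*ⁱ_ : A[i] → A[i] → A[i]
  (a +i b) +ⁱ (c +i d) = (a + c) +i (b + d)
  (a +i b) *ⁱ (c +i d) = (a * c - b * d) +i (a * d + b * c)

  private

    *ⁱ-comm : ∀ z w → z *ⁱ w ≈ⁱ w *ⁱ z
    *ⁱ-comm (a +i b) (c +i d) =
      +-cong (*-comm a c) (-‿cong (*-comm b d)) ,
      trans (+-cong (*-comm a d) (*-comm b c)) (+-comm (d * a) (c * b))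

    neg-+ : ∀ a b → - (a + b) ≈ - a - b
    neg-+ a b = sym (-‿+-comm a b)

    *ⁱ-assoc : ∀ z w v → (z *ⁱ w) *ⁱ v ≈ⁱ z *ⁱ (w *ⁱ v)
    *ⁱ-assoc (a +i b) (c +i d) (e +i f) = re-part , im-part
      where
      re-part : (a * c - b * d) * e - (a * d + b * c) * f ≈ a * (c * e - d * f) - b * (c * f + d * e)
      re-part = begin
        (a * c - b * d) * e - (a * d + b * c) * f
          ≈⟨ +-cong ([y-z]x≈yx-zx e (a * c) (b * d)) (trans (-‿cong (distribʳ f (a * d) (b * c))) (neg-+ _ _)) ⟩
        (a * c * e - b * d * e) + (- (a * d * f) - b * c * f)
          ≈⟨ interchange _ _ _ _ ⟩
        (a * c * e - a * d * f) + (- (b * d * e) - b * c * f)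
          ≈⟨ +-cong (+-cong (*-assoc a c e) (-‿cong (*-assoc a d f)))
                    (trans (+-comm _ _) (+-cong (-‿cong (*-assoc b c f)) (-‿cong (*-assoc b d e)))) ⟩
        (a * (c * e) - a * (d * f)) + (- (b * (c * f)) - b * (d * e))
          ≈⟨ +-cong (x[y-z]≈xy-xz a (c * e) (d * f)) (trans (-‿cong (distribˡ b (c * f) (d * e))) (neg-+ _ _)) ⟨
        a * (c * e - d * f) - b * (c * f + d * e) ∎

      im-part : (a * c - b * d) * f + (a * d + b * c) * e ≈ a * (c * f + d * e) + b * (c * e - d * f)
      im-part = begin
        (a * c - b * d) * f + (a * d + b * c) * e
          ≈⟨ +-cong ([y-z]x≈yx-zx f (a * c) (b * d)) (distribʳ e (a * d) (b * c)) ⟩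
        (a * c * f - b * d * f) + (a * d * e + b * c * e)
          ≈⟨ interchange _ _ _ _ ⟩
        (a * c * f + a * d * e) + (- (b * d * f) + b * c * e)
          ≈⟨ +-cong (+-cong (*-assoc a c f) (*-assoc a d e))
                    (trans (+-comm _ _) (+-cong (*-assoc b c e) (-‿cong (*-assoc b d f)))) ⟩
        (a * (c * f) + a * (d * e)) + (b * (c * e) - b * (d * f))
          ≈⟨ +-cong (distribˡ a (c * f) (d * e)) (x[y-z]≈xy-xz b (c * e) (d * f)) ⟨
        a * (c * f + d * e) + b * (c * e - d * f) ∎

    *ⁱ-distribˡ : ∀ z w v → z *ⁱ (w +ⁱ v) ≈ⁱ z *ⁱ w +ⁱ z *ⁱ v
    *ⁱ-distribˡ (a +i b) (c +i d) (e +i f) =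
      trans (+-cong (distribˡ a c e) (trans (-‿cong (distribˡ b d f)) (neg-+ _ _))) (interchange _ _ _ _) ,
      trans (+-cong (distribˡ a d f) (distribˡ b c e)) (interchange _ _ _ _)

    *ⁱ-identityˡ : ∀ z → (1# +i 0#) *ⁱ z ≈ⁱ z
    *ⁱ-identityˡ (a +i b) =
      trans (+-cong (*-identityˡ a) (trans (-‿cong (zeroˡ b)) -0#≈0#)) (+-identityʳ a) ,
      trans (+-cong (*-identityˡ b) (zeroˡ a)) (+-identityʳ b)

    ≈ⁱ-trans : ∀ {z w v} → z ≈ⁱ w → w ≈ⁱ v → z ≈ⁱ v
    ≈ⁱ-trans (p , q) (r , s) = trans p r , trans q s

    +ⁱ-cong : ∀ {z w u v} → z ≈ⁱ w → u ≈ⁱ v → z +ⁱ u ≈ⁱ w +ⁱ v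
    +ⁱ-cong (p , q) (r , s) = +-cong p r , +-cong q s

  commutativeRing : CommutativeRing c ℓ
  commutativeRing = record
    { Carrier = A[i]
    ; _≈_ = _≈ⁱ_
    ; _+_ = _+ⁱ_
    ; _*_ = _*ⁱ_
    ; -_  = λ z → (- re z) +i (- im z)
    ; 0#  = 0# +i 0#
    ; 1#  = 1# +i 0#
    ; isCommutativeRing = record
      { isRing = record
        { +-isAbelianGroup = record
          { isGroup = record
            { isMonoid = record
              { isSemigroup = record
                { isMagma = record
                  { isEquivalence = record
                    { refl  = refl , refl
                    ; sym   = λ (p , q) → sym p , sym q
                    ; trans = ≈ⁱ-trans
                    }
                  ; ∙-cong = +ⁱ-cong
                  }
                ; assoc = λ z w v → +-assoc _ _ _ , +-assoc _ _ _
                }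
              ; identity = (λ z → +-identityˡ _ , +-identityˡ _) , (λ z → +-identityʳ _ , +-identityʳ _)
              }
            ; inverse = (λ z → -‿inverseˡ _ , -‿inverseˡ _) , (λ z → -‿inverseʳ _ , -‿inverseʳ _)
            ; ⁻¹-cong = λ (p , q) → -‿cong p , -‿cong q
            }
          ; comm = λ z w → +-comm _ _ , +-comm _ _
          }
        ; *-cong = λ (p , q) (r , s) →
            +-cong (*-cong p r) (-‿cong (*-cong q s)) , +-cong (*-cong p s) (*-cong q r)
        ; *-assoc = *ⁱ-assoc
        ; *-identity = *ⁱ-identityˡ , λ z → ≈ⁱ-trans (*ⁱ-comm z (1# +i 0#)) (*ⁱ-identityˡ z)
        ; distrib = *ⁱ-distribˡ , λ z w v →
            ≈ⁱ-trans (*ⁱ-comm (w +ⁱ v) z)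
              (≈ⁱ-trans (*ⁱ-distribˡ z w v) (+ⁱ-cong (*ⁱ-comm z w) (*ⁱ-comm z v)))
        }
      ; *-comm = *ⁱ-comm
      }
    }

ℂ-commutativeRing : CommutativeRing 0ℓ 0ℓ
ℂ-commutativeRing = AdjoinI.commutativeRing ℝ-commutativeRing

-- Univariate polynomials: a list holds the coefficients in ascending degree,
-- and lists differing by trailing zeros are equal.

module Polynomial {c ℓ} (A : CommutativeRing c ℓ) where

  open CommutativeRing A
  open RingProperties ring
  open CommutativeSemigroupProperties +-commutativeSemigroup using (interchange; x∙yz≈y∙xz)

  Poly : Set c
  Poly = List Carrier

  coeff : Poly → ℕ → Carrier
  coeff []      k       = 0#
  coeff (a ∷ p) zero    = a
  coeff (a ∷ p) (suc k) = coeff p k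

  infix 4 _≈ᵖ_

  record _≈ᵖ_ (p q : Poly) : Set ℓ where
    constructor mk≈
    field
      coeff-≈ : ∀ k → coeff p k ≈ coeff q k

  open _≈ᵖ_ public

  infixl 6 _+ᵖ_
  infixl 7 _*ᵖ_ _·ᵖ_
  infix  8 -ᵖ_

  _+ᵖ_ : Poly → Poly → Poly
  []      +ᵖ q       = q
  (a ∷ p) +ᵖ []      = a ∷ p
  (a ∷ p) +ᵖ (b ∷ q) = (a + b) ∷ (p +ᵖ q)

  -ᵖ_ : Poly → Poly
  -ᵖ p = map (-_) p

  _·ᵖ_ : Carrier → Poly → Poly
  a ·ᵖ p = map (a *_) p

  -- Recursion (a + X·p)·q = a·q + X·(p·q).
  _*ᵖ_ : Poly → Poly → Poly
  []      *ᵖ q = []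
  (a ∷ p) *ᵖ q = a ·ᵖ q +ᵖ (0# ∷ (p *ᵖ q))

  const : Carrier → Poly
  const a = a ∷ []

  X : Poly
  X = 0# ∷ 1# ∷ []

  private

    ≈ᵖ-refl : ∀ {p} → p ≈ᵖ p
    ≈ᵖ-refl = mk≈ λ _ → refl

    ≈ᵖ-sym : ∀ {p q} → p ≈ᵖ q → q ≈ᵖ p
    ≈ᵖ-sym (mk≈ e) = mk≈ λ k → sym (e k)

    ≈ᵖ-trans : ∀ {p q r} → p ≈ᵖ q → q ≈ᵖ r → p ≈ᵖ r
    ≈ᵖ-trans (mk≈ e) (mk≈ f) = mk≈ λ k → trans (e k) (f k)

  coeff-+ : ∀ p q k → coeff (p +ᵖ q) k ≈ coeff p k + coeff q k
  coeff-+ []      q       k       = sym (+-identityˡ _)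
  coeff-+ (a ∷ p) []      k       = sym (+-identityʳ _)
  coeff-+ (a ∷ p) (b ∷ q) zero    = refl
  coeff-+ (a ∷ p) (b ∷ q) (suc k) = coeff-+ p q k

  coeff-neg : ∀ p k → coeff (-ᵖ p) k ≈ - coeff p k
  coeff-neg []      k       = sym -0#≈0#
  coeff-neg (a ∷ p) zero    = refl
  coeff-neg (a ∷ p) (suc k) = coeff-neg p k

  coeff-· : ∀ a p k → coeff (a ·ᵖ p) k ≈ a * coeff p k
  coeff-· a []      k       = sym (zeroʳ a)
  coeff-· a (b ∷ p) zero    = refl
  coeff-· a (b ∷ p) (suc k) = coeff-· a p k

  private

    +ᵖ-cong : ∀ {p q r s} → p ≈ᵖ q → r ≈ᵖ s → p +ᵖ r ≈ᵖ q +ᵖ s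
    +ᵖ-cong {p} {q} {r} {s} (mk≈ e) (mk≈ f) = mk≈ λ k →
      trans (coeff-+ p r k) (trans (+-cong (e k) (f k)) (sym (coeff-+ q s k)))

    +ᵖ-assoc : ∀ p q r → (p +ᵖ q) +ᵖ r ≈ᵖ p +ᵖ (q +ᵖ r)
    +ᵖ-assoc p q r = mk≈ λ k →
      trans (coeff-+ (p +ᵖ q) r k) (trans (+-congʳ (coeff-+ p q k)) (trans (+-assoc _ _ _)
        (sym (trans (coeff-+ p (q +ᵖ r) k) (+-congˡ (coeff-+ q r k))))))

    +ᵖ-comm : ∀ p q → p +ᵖ q ≈ᵖ q +ᵖ p
    +ᵖ-comm p q = mk≈ λ k → trans (coeff-+ p q k) (trans (+-comm _ _) (sym (coeff-+ q p k)))

    +ᵖ-identityʳ : ∀ p → p +ᵖ [] ≈ᵖ p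
    +ᵖ-identityʳ p = mk≈ λ k → trans (coeff-+ p [] k) (+-identityʳ _)

    +ᵖ-interchange : ∀ p q r s → (p +ᵖ q) +ᵖ (r +ᵖ s) ≈ᵖ (p +ᵖ r) +ᵖ (q +ᵖ s)
    +ᵖ-interchange p q r s = mk≈ λ k →
      trans (trans (coeff-+ (p +ᵖ q) (r +ᵖ s) k) (+-cong (coeff-+ p q k) (coeff-+ r s k)))
        (trans (interchange _ _ _ _)
          (sym (trans (coeff-+ (p +ᵖ r) (q +ᵖ s) k) (+-cong (coeff-+ p r k) (coeff-+ q s k)))))

    -ᵖ-cong : ∀ {p q} → p ≈ᵖ q → -ᵖ p ≈ᵖ -ᵖ q
    -ᵖ-cong {p} {q} (mk≈ e) = mk≈ λ k → trans (coeff-neg p k) (trans (-‿cong (e k)) (sym (coeff-neg q k)))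

    -ᵖ-inverseˡ : ∀ p → (-ᵖ p) +ᵖ p ≈ᵖ []
    -ᵖ-inverseˡ p = mk≈ λ k → trans (coeff-+ (-ᵖ p) p k) (trans (+-congʳ (coeff-neg p k)) (-‿inverseˡ _))

    ∷-cong : ∀ {a b p q} → a ≈ b → p ≈ᵖ q → (a ∷ p) ≈ᵖ (b ∷ q)
    ∷-cong a≈b (mk≈ e) = mk≈ λ { zero → a≈b ; (suc k) → e k }

    0∷[] : (0# ∷ []) ≈ᵖ []
    0∷[] = mk≈ λ { zero → refl ; (suc k) → refl }

    ·ᵖ-cong : ∀ {a b p q} → a ≈ b → p ≈ᵖ q → a ·ᵖ p ≈ᵖ b ·ᵖ q
    ·ᵖ-cong {a} {b} {p} {q} a≈b (mk≈ e) = mk≈ λ k →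
      trans (coeff-· a p k) (trans (*-cong a≈b (e k)) (sym (coeff-· b q k)))

    0·ᵖ : ∀ p → 0# ·ᵖ p ≈ᵖ []
    0·ᵖ p = mk≈ λ k → trans (coeff-· 0# p k) (zeroˡ _)

    ·ᵖ-distribˡ : ∀ a p q → a ·ᵖ (p +ᵖ q) ≈ᵖ a ·ᵖ p +ᵖ a ·ᵖ q
    ·ᵖ-distribˡ a p q = mk≈ λ k →
      trans (coeff-· a (p +ᵖ q) k) (trans (*-congˡ (coeff-+ p q k)) (trans (distribˡ a _ _)
        (sym (trans (coeff-+ (a ·ᵖ p) (a ·ᵖ q) k) (+-cong (coeff-· a p k) (coeff-· a q k))))))

    ·ᵖ-distribʳ : ∀ a b p → (a + b) ·ᵖ p ≈ᵖ a ·ᵖ p +ᵖ b ·ᵖ p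
    ·ᵖ-distribʳ a b p = mk≈ λ k →
      trans (coeff-· (a + b) p k) (trans (distribʳ _ a b)
        (sym (trans (coeff-+ (a ·ᵖ p) (b ·ᵖ p) k) (+-cong (coeff-· a p k) (coeff-· b p k)))))

    ·ᵖ-assoc : ∀ a b p → (a * b) ·ᵖ p ≈ᵖ a ·ᵖ (b ·ᵖ p)
    ·ᵖ-assoc a b p = mk≈ λ k →
      trans (coeff-· (a * b) p k) (trans (*-assoc a b _)
        (sym (trans (coeff-· a (b ·ᵖ p) k) (*-congˡ (coeff-· b p k)))))

    ·ᵖ-identity : ∀ p → 1# ·ᵖ p ≈ᵖ p
    ·ᵖ-identity p = mk≈ λ k → trans (coeff-· 1# p k) (*-identityˡ _)

    *ᵖ-congˡ : ∀ p {q r} → q ≈ᵖ r → p *ᵖ q ≈ᵖ p *ᵖ r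
    *ᵖ-congˡ []      q≈r = ≈ᵖ-refl
    *ᵖ-congˡ (a ∷ p) q≈r = +ᵖ-cong (·ᵖ-cong refl q≈r) (∷-cong refl (*ᵖ-congˡ p q≈r))

    *ᵖ-zeroʳ : ∀ p → p *ᵖ [] ≈ᵖ []
    *ᵖ-zeroʳ []      = ≈ᵖ-refl
    *ᵖ-zeroʳ (a ∷ p) = ≈ᵖ-trans (∷-cong refl (*ᵖ-zeroʳ p)) 0∷[]

    *ᵖ-∷ : ∀ p b q → p *ᵖ (b ∷ q) ≈ᵖ b ·ᵖ p +ᵖ (0# ∷ (p *ᵖ q))
    *ᵖ-∷ []      b q = ≈ᵖ-sym 0∷[]
    *ᵖ-∷ (a ∷ p) b q = ∷-cong (+-congʳ (*-comm a b)) (mk≈ λ k →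
      trans (coeff-+ (a ·ᵖ q) (p *ᵖ (b ∷ q)) k)
        (trans (+-congˡ (trans (coeff-≈ (*ᵖ-∷ p b q) k) (coeff-+ (b ·ᵖ p) (0# ∷ (p *ᵖ q)) k)))
          (trans (x∙yz≈y∙xz _ _ _)
            (sym (trans (coeff-+ (b ·ᵖ p) (a ·ᵖ q +ᵖ (0# ∷ (p *ᵖ q))) k)
              (+-congˡ (coeff-+ (a ·ᵖ q) (0# ∷ (p *ᵖ q)) k)))))))

    *ᵖ-comm : ∀ p q → p *ᵖ q ≈ᵖ q *ᵖ p
    *ᵖ-comm []      q = ≈ᵖ-sym (*ᵖ-zeroʳ q)
    *ᵖ-comm (a ∷ p) q = ≈ᵖ-trans (+ᵖ-cong ≈ᵖ-refl (∷-cong refl (*ᵖ-comm p q))) (≈ᵖ-sym (*ᵖ-∷ q a p))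

    *ᵖ-cong : ∀ {p q r s} → p ≈ᵖ q → r ≈ᵖ s → p *ᵖ r ≈ᵖ q *ᵖ s
    *ᵖ-cong {p} {q} {r} {s} p≈q r≈s = ≈ᵖ-trans (*ᵖ-congˡ p r≈s)
      (≈ᵖ-trans (*ᵖ-comm p s) (≈ᵖ-trans (*ᵖ-congˡ s p≈q) (*ᵖ-comm s q)))

    *ᵖ-distribˡ : ∀ p q r → p *ᵖ (q +ᵖ r) ≈ᵖ p *ᵖ q +ᵖ p *ᵖ r
    *ᵖ-distribˡ []      q r = ≈ᵖ-refl
    *ᵖ-distribˡ (a ∷ p) q r = ≈ᵖ-trans
      (+ᵖ-cong (·ᵖ-distribˡ a q r) (∷-cong (sym (+-identityˡ 0#)) (*ᵖ-distribˡ p q r)))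
      (+ᵖ-interchange (a ·ᵖ q) (a ·ᵖ r) (0# ∷ (p *ᵖ q)) (0# ∷ (p *ᵖ r)))

    *ᵖ-distribʳ : ∀ p q r → (q +ᵖ r) *ᵖ p ≈ᵖ q *ᵖ p +ᵖ r *ᵖ p
    *ᵖ-distribʳ p q r = ≈ᵖ-trans (*ᵖ-comm (q +ᵖ r) p)
      (≈ᵖ-trans (*ᵖ-distribˡ p q r) (+ᵖ-cong (*ᵖ-comm p q) (*ᵖ-comm p r)))

    ·ᵖ-*ᵖ-assoc : ∀ a p q → (a ·ᵖ p) *ᵖ q ≈ᵖ a ·ᵖ (p *ᵖ q)
    ·ᵖ-*ᵖ-assoc a []      q = ≈ᵖ-refl
    ·ᵖ-*ᵖ-assoc a (b ∷ p) q = ≈ᵖ-trans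
      (+ᵖ-cong (·ᵖ-assoc a b q) (∷-cong (sym (zeroʳ a)) (·ᵖ-*ᵖ-assoc a p q)))
      (≈ᵖ-sym (·ᵖ-distribˡ a (b ·ᵖ q) (0# ∷ (p *ᵖ q))))

    0∷-*ᵖ : ∀ p q → (0# ∷ p) *ᵖ q ≈ᵖ 0# ∷ (p *ᵖ q)
    0∷-*ᵖ p q = +ᵖ-cong {q = []} (0·ᵖ q) ≈ᵖ-refl

    *ᵖ-assoc : ∀ p q r → (p *ᵖ q) *ᵖ r ≈ᵖ p *ᵖ (q *ᵖ r)
    *ᵖ-assoc []      q r = ≈ᵖ-refl
    *ᵖ-assoc (a ∷ p) q r = ≈ᵖ-trans (*ᵖ-distribʳ r (a ·ᵖ q) (0# ∷ (p *ᵖ q)))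
      (+ᵖ-cong (·ᵖ-*ᵖ-assoc a q r)
        (≈ᵖ-trans (0∷-*ᵖ (p *ᵖ q) r) (∷-cong refl (*ᵖ-assoc p q r))))

    *ᵖ-identityˡ : ∀ p → const 1# *ᵖ p ≈ᵖ p
    *ᵖ-identityˡ p = ≈ᵖ-trans (+ᵖ-cong (·ᵖ-identity p) 0∷[]) (+ᵖ-identityʳ p)

  commutativeRing : CommutativeRing c ℓ
  commutativeRing = record
    { Carrier = Poly
    ; _≈_ = _≈ᵖ_
    ; _+_ = _+ᵖ_
    ; _*_ = _*ᵖ_
    ; -_  = -ᵖ_
    ; 0#  = []
    ; 1#  = const 1#
    ; isCommutativeRing = record
      { isRing = record
        { +-isAbelianGroup = record
          { isGroup = record
            { isMonoid = record
              { isSemigroup = record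
                { isMagma = record
                  { isEquivalence = record { refl = ≈ᵖ-refl ; sym = ≈ᵖ-sym ; trans = ≈ᵖ-trans }
                  ; ∙-cong = +ᵖ-cong
                  }
                ; assoc = +ᵖ-assoc
                }
              ; identity = (λ _ → ≈ᵖ-refl) , +ᵖ-identityʳ
              }
            ; inverse = -ᵖ-inverseˡ , λ p → ≈ᵖ-trans (+ᵖ-comm p (-ᵖ p)) (-ᵖ-inverseˡ p)
            ; ⁻¹-cong = -ᵖ-cong
            }
          ; comm = +ᵖ-comm
          }
        ; *-cong = *ᵖ-cong
        ; *-assoc = *ᵖ-assoc
        ; *-identity = *ᵖ-identityˡ , λ p → ≈ᵖ-trans (*ᵖ-comm p (const 1#)) (*ᵖ-identityˡ p)
        ; distrib = *ᵖ-distribˡ , *ᵖ-distribʳ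
        }
      ; *-comm = *ᵖ-comm
      }
    }

-- A [X n ] is the iterated polynomial ring A[Xₙ₋₁]⋯[X₁][X₀].

infix 9 _[X_]

_[X_] : ∀ {c ℓ} → CommutativeRing c ℓ → ℕ → CommutativeRing c ℓ
A [X zero ]  = A
A [X suc n ] = Polynomial.commutativeRing (A [X n ])

var : ∀ {c ℓ} (A : CommutativeRing c ℓ) {n} → Fin n → CommutativeRing.Carrier (A [X n ])
var A {suc n} zero    = Polynomial.X (A [X n ])
var A {suc n} (suc i) = Polynomial.const (A [X n ]) (var A i)

-- A / gs is the quotient of A by the ideal generated by gs: the carrier is
-- unchanged and equality becomes congruence modulo the ideal.

module Quotient {c ℓ} (A : CommutativeRing c ℓ) where

  open CommutativeRing A
  open RingProperties ring
  open Sum semiring using (sum; sum-cong-≋; ∑-distrib-+; *-distribˡ-sum; sum-replicate-zero)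
  open SetoidReasoning setoid

  infix 4 _∈⟨_⟩

  record _∈⟨_⟩ {k} (a : Carrier) (gs : Vector Carrier k) : Set (c ⊔ ℓ) where
    constructor combination
    field
      coefficients : Vector Carrier k
      a≈∑          : a ≈ sum (λ i → coefficients i * gs i)

  open _∈⟨_⟩ public

  module _ {k} {gs : Vector Carrier k} where

    ∈-resp-≈ : ∀ {a b} → a ≈ b → a ∈⟨ gs ⟩ → b ∈⟨ gs ⟩
    ∈-resp-≈ a≈b (combination cs e) = combination cs (trans (sym a≈b) e)

    0∈ : 0# ∈⟨ gs ⟩
    0∈ = combination (λ _ → 0#) (sym (trans (sum-cong-≋ (λ i → zeroˡ (gs i))) (sum-replicate-zero k)))

    +-∈ : ∀ {a b} → a ∈⟨ gs ⟩ → b ∈⟨ gs ⟩ → a + b ∈⟨ gs ⟩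
    +-∈ {a} {b} (combination cs e) (combination ds f) = combination (λ i → cs i + ds i) (begin
      a + b                                               ≈⟨ +-cong e f ⟩
      sum (λ i → cs i * gs i) + sum (λ i → ds i * gs i)   ≈⟨ ∑-distrib-+ (λ i → cs i * gs i) (λ i → ds i * gs i) ⟨
      sum (λ i → cs i * gs i + ds i * gs i)               ≈⟨ sum-cong-≋ (λ i → sym (distribʳ (gs i) (cs i) (ds i))) ⟩
      sum (λ i → (cs i + ds i) * gs i)                    ∎)

    *-∈ : ∀ r {a} → a ∈⟨ gs ⟩ → r * a ∈⟨ gs ⟩
    *-∈ r {a} (combination cs e) = combination (λ i → r * cs i) (begin
      r * a                           ≈⟨ *-congˡ e ⟩
      r * sum (λ i → cs i * gs i)     ≈⟨ *-distribˡ-sum r (λ i → cs i * gs i) ⟩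
      sum (λ i → r * (cs i * gs i))   ≈⟨ sum-cong-≋ (λ i → sym (*-assoc r (cs i) (gs i))) ⟩
      sum (λ i → r * cs i * gs i)     ∎)

    neg-∈ : ∀ {a} → a ∈⟨ gs ⟩ → - a ∈⟨ gs ⟩
    neg-∈ {a} a∈ = ∈-resp-≈ (-1*x≈-x a) (*-∈ (- 1#) a∈)

  record Congruent {k} (gs : Vector Carrier k) (a b : Carrier) : Set (c ⊔ ℓ) where
    constructor mk≡mod
    field
      a-b∈ : a - b ∈⟨ gs ⟩

  open Congruent public

  private
    module _ {k} {gs : Vector Carrier k} where

      ≈⇒≡mod : ∀ {a b} → a ≈ b → Congruent gs a b
      ≈⇒≡mod {a} {b} a≈b = mk≡mod (∈-resp-≈ (sym (trans (+-congʳ a≈b) (-‿inverseʳ b))) 0∈)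

      ≡mod-trans : ∀ {a b d} → Congruent gs a b → Congruent gs b d → Congruent gs a d
      ≡mod-trans {a} {b} {d} (mk≡mod p) (mk≡mod q) = mk≡mod (∈-resp-≈ (begin
        (a - b) + (b - d)     ≈⟨ +-assoc a (- b) (b - d) ⟩
        a + (- b + (b - d))   ≈⟨ +-congˡ (+-assoc (- b) b (- d)) ⟨
        a + ((- b + b) - d)   ≈⟨ +-congˡ (+-congʳ (-‿inverseˡ b)) ⟩
        a + (0# - d)          ≈⟨ +-congˡ (+-identityˡ (- d)) ⟩
        a - d                 ∎) (+-∈ p q))

      ≡mod-sym : ∀ {a b} → Congruent gs a b → Congruent gs b a
      ≡mod-sym {a} {b} (mk≡mod p) = mk≡mod (∈-resp-≈ (begin
        - (a - b)     ≈⟨ -‿+-comm a (- b) ⟨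
        - a + - - b   ≈⟨ +-congˡ (-‿involutive b) ⟩
        - a + b       ≈⟨ +-comm (- a) b ⟩
        b - a         ∎) (neg-∈ p))

      ≡mod-+ : ∀ {a b d e} → Congruent gs a b → Congruent gs d e → Congruent gs (a + d) (b + e)
      ≡mod-+ {a} {b} {d} {e} (mk≡mod p) (mk≡mod q) = mk≡mod (∈-resp-≈ (begin
        (a - b) + (d - e)       ≈⟨ interchange a (- b) d (- e) ⟩
        (a + d) + (- b - e)     ≈⟨ +-congˡ (-‿+-comm b e) ⟩
        (a + d) - (b + e)       ∎) (+-∈ p q))
        where open CommutativeSemigroupProperties +-commutativeSemigroup using (interchange)

      ≡mod-neg : ∀ {a b} → Congruent gs a b → Congruent gs (- a) (- b)
      ≡mod-neg {a} {b} (mk≡mod p) = mk≡mod (∈-resp-≈ (sym (-‿+-comm a (- b))) (neg-∈ p))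

      ≡mod-*ˡ : ∀ r {a b} → Congruent gs a b → Congruent gs (r * a) (r * b)
      ≡mod-*ˡ r {a} {b} (mk≡mod p) = mk≡mod (∈-resp-≈ (x[y-z]≈xy-xz r a b) (*-∈ r p))

      ≡mod-* : ∀ {a b d e} → Congruent gs a b → Congruent gs d e → Congruent gs (a * d) (b * e)
      ≡mod-* {a} {b} {d} {e} p q = ≡mod-trans (≡mod-*ˡ a q) (≡mod-trans (≈⇒≡mod (*-comm a e))
        (≡mod-trans (≡mod-*ˡ e p) (≈⇒≡mod (*-comm e b))))

  quotient : ∀ {k} → Vector Carrier k → CommutativeRing c (c ⊔ ℓ)
  quotient gs = record
    { Carrier = Carrier
    ; _≈_ = Congruent gs
    ; _+_ = _+_
    ; _*_ = _*_
    ; -_  = -_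
    ; 0#  = 0#
    ; 1#  = 1#
    ; isCommutativeRing = record
      { isRing = record
        { +-isAbelianGroup = record
          { isGroup = record
            { isMonoid = record
              { isSemigroup = record
                { isMagma = record
                  { isEquivalence = record { refl = ≈⇒≡mod refl ; sym = ≡mod-sym ; trans = ≡mod-trans }
                  ; ∙-cong = ≡mod-+
                  }
                ; assoc = λ a b d → ≈⇒≡mod (+-assoc a b d)
                }
              ; identity = (λ a → ≈⇒≡mod (+-identityˡ a)) , (λ a → ≈⇒≡mod (+-identityʳ a))
              }
            ; inverse = (λ a → ≈⇒≡mod (-‿inverseˡ a)) , (λ a → ≈⇒≡mod (-‿inverseʳ a))
            ; ⁻¹-cong = ≡mod-neg
            }
          ; comm = λ a b → ≈⇒≡mod (+-comm a b)
          }
        ; *-cong = ≡mod-*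
        ; *-assoc = λ a b d → ≈⇒≡mod (*-assoc a b d)
        ; *-identity = (λ a → ≈⇒≡mod (*-identityˡ a)) , (λ a → ≈⇒≡mod (*-identityʳ a))
        ; distrib = (λ a b d → ≈⇒≡mod (distribˡ a b d)) , (λ a b d → ≈⇒≡mod (distribʳ a b d))
        }
      ; *-comm = λ a b → ≈⇒≡mod (*-comm a b)
      }
    }

infixl 7 _/_

_/_ : ∀ {c ℓ} (A : CommutativeRing c ℓ) {k} → Vector (CommutativeRing.Carrier A) k → CommutativeRing c (c ⊔ ℓ)
A / gs = Quotient.quotient A gs

-- Isomorphism of rings, with no ℂ-linearity required.
infix 4 _≅_

_≅_ : ∀ {a b ℓ₁ ℓ₂} → CommutativeRing a ℓ₁ → CommutativeRing b ℓ₂ → Set (a ⊔ b ⊔ ℓ₁ ⊔ ℓ₂)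
A ≅ B = Σ (Carrier A → Carrier B) (IsRingIsomorphism (rawRing A) (rawRing B))
  where open CommutativeRing

module _ where

  open CommutativeRing (ℂ-commutativeRing [X 2 ])
  private
    x = var ℂ-commutativeRing {2} 0F
    y = var ℂ-commutativeRing {2} 1F

  R₁ : CommutativeRing 0ℓ 0ℓ
  R₁ = ℂ-commutativeRing [X 2 ] / ((y - 1#) * (y - x) Vector.∷ Vector.[])

module _ where

  open CommutativeRing (ℂ-commutativeRing [X 3 ])
  open Exp semiring using (_^_)
  private
    x = var ℂ-commutativeRing {3} 0F
    y = var ℂ-commutativeRing {3} 1F
    z = var ℂ-commutativeRing {3} 2F

  R₂ : CommutativeRing 0ℓ 0ℓ
  R₂ = ℂ-commutativeRing [X 3 ] / ((z - x) * (z - y) Vector.∷ Vector.[])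

  R₃ : ℕ → ℕ → CommutativeRing 0ℓ 0ℓ
  R₃ m n = ℂ-commutativeRing [X 3 ] / ((z - x) * (z - y) Vector.∷ y ^ m - x ^ n Vector.∷ Vector.[])

  R₄ : ℕ → ℕ → CommutativeRing 0ℓ 0ℓ
  R₄ m n = ℂ-commutativeRing [X 3 ] / ((z - x) * (z - y) Vector.∷ x ^ n * y ^ m - 1# Vector.∷ Vector.[])

{-# OPTIONS --safe #-}
module Submission where

open import Defs
open import Data.List.Base using ([]; _∷_)
open import Data.List.Relation.Unary.AllPairs using (AllPairs)
open import Data.Nat.Base using (ℕ; NonZero)
open import Data.Nat.Coprimality using (Coprime)
open import Relation.Nullary.Negation using (¬_)

open import Algebra.Bundles using (CommutativeRing)
import Algebra.Definitions.RawMonoid as RawMonoidDefs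
open import Algebra.Morphism.Structures using (IsRingHomomorphism; IsRingIsomorphism)
import Algebra.Morphism.Construct.Composition as Composition
import Algebra.Properties.CommutativeSemigroup as CommutativeSemigroupProperties
import Algebra.Properties.Ring as RingProperties
import Algebra.Properties.Semiring.Exp as Exp
import Algebra.Properties.Semiring.Mult as Mult
import Algebra.Properties.Semiring.Sum as Sum
import Algebra.Solver.Ring.NaturalCoefficients.Default as SemiringSolver
open import Data.Fin.Base using (Fin; zero; suc)
open import Data.Fin.Patterns using (0F; 1F; 2F)
open import Data.List.Base using (map)
open import Data.List.Relation.Binary.Pointwise.Base using (Pointwise; []; _∷_)
open import Data.List.Relation.Unary.All using ([]; _∷_)
open import Data.List.Relation.Unary.AllPairs using ([]; _∷_)
open import Data.Nat.Base as ℕ using (zero; suc)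
open import Data.Nat.Divisibility using (∣-refl)
import Data.Nat.Properties as ℕ
open import Data.Product.Base using (∃; _×_; _,_; proj₁; proj₂)
open import Data.Rational.Base as ℚ using (ℚ; 0ℚ; 1ℚ; ½)
import Data.Rational.Properties as ℚ
open import Data.Rational.Solver using (module +-*-Solver)
open import Data.Sum.Base using (inj₁; inj₂)
open import Data.Unit.Base using (⊤; tt)
open import Data.Vec.Functional as Vector using (Vector)
open import Function.Base using (_∘_; id)
open import Level using (0ℓ; _⊔_)
open import Relation.Binary.PropositionalEquality as ≡ using (_≡_)
import Relation.Binary.Reasoning.Setoid as SetoidReasoning
open import Relation.Nullary.Decidable.Core using (yes; no)
open import Relation.Nullary.Negation using (contradiction)

-- Write K for ℂ. A derivation that kills all units also kills the image of K under any ring homomorphism,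
-- K-linear or not; this replaces linearity throughout.
--
-- * Every derivation of K[t] that kills units kills the image of any R₄ → K[t], because x and y are units and
--   (z − x)(z − y) = 0; but R₁, R₂ and R₃ have homomorphisms to K[t] whose image it does not kill.
-- * R₂ surjects onto K[s,t]. For h : R → K[s,t] with R = R₁ or R₃, a derivation that kills X = h(x) kills the image
--   of h. If h is onto, applying this to X_s ∂_t − X_t ∂_s gives X_s = 0, and then ∂_s kills s, a contradiction.
-- * Let φ : R₁ ≅ R₃. The curves (tᵐ, tⁿ, tᵐ) and (tᵐ, tⁿ, tⁿ) give R₃ → K[t], so each of them lies on one of the
--   lines y = 1 and y = x of R₁. If they lie on different lines, then their common points at t = 0 and t = 1
--   both go to the node of R₁, although x separates them. If they lie on the same line, then z = x or z = y on
--   both curves, so m = n, and m = n = 1 by coprimality. But then z − x is nilpotent and nonzero, while R₁ is reduced.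
--
-- Equality on K is undecidable; case distinctions are made under a double negation or towards a stable goal.

-- Fields

module _ {c ℓ} (A : CommutativeRing c ℓ) where

  open CommutativeRing A
  open RawMonoidDefs +-rawMonoid using () renaming (_×_ to _·_)

  Invertible : Carrier → Set (c ⊔ ℓ)
  Invertible a = ∃ λ b → a * b ≈ 1#

  -- Equality on ℝ is undecidable, so the field axiom is stated contrapositively; it makes ≈ stable under double negation.
  IsField : Set (c ⊔ ℓ)
  IsField = ∀ a → ¬ Invertible a → a ≈ 0#

  record CharacteristicZero : Set ℓ where
    constructor mkCharacteristicZero
    field
      suc·1≉0 : ∀ n → ¬ (suc n · 1# ≈ 0#)

  -- Anisotropy of the norm form of `A[i]`. One conclusion suffices, since exchanging `a` and `b`
  -- gives the other.
  SumOfSquares : Set (c ⊔ ℓ)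
  SumOfSquares = ∀ a b → a * a + b * b ≈ 0# → a ≈ 0#

module _ {c ℓ} (A : CommutativeRing c ℓ) where
  open CommutativeRing A
  open AdjoinI A using (_+i_; _,_; re)
  open RingProperties ring
  open CommutativeSemigroupProperties *-commutativeSemigroup using (x∙yz≈y∙xz)
  open SetoidReasoning setoid
  private
    module Aᵢ = CommutativeRing (AdjoinI.commutativeRing A)
    open RawMonoidDefs +-rawMonoid using () renaming (_×_ to _·_)
    open RawMonoidDefs Aᵢ.+-rawMonoid using () renaming (_×_ to _·ᵢ_)

  -- The inverse is the conjugate divided by the norm.
  norm-invertible⇒invertible : ∀ a b → Invertible A (a * a + b * b) → Invertible (AdjoinI.commutativeRing A) (a +i b)
  norm-invertible⇒invertible a b (d , norm*d≈1) = (a * d) +i (- (b * d)) ,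
    ((begin
      a * (a * d) - b * - (b * d)        ≈⟨ +-congˡ (-‿cong (-‿distribʳ-* b (b * d))) ⟨
      a * (a * d) - - (b * (b * d))      ≈⟨ +-congˡ (-‿involutive _) ⟩
      a * (a * d) + b * (b * d)          ≈⟨ +-cong (*-assoc a a d) (*-assoc b b d) ⟨
      a * a * d + b * b * d              ≈⟨ distribʳ d (a * a) (b * b) ⟨
      (a * a + b * b) * d                ≈⟨ norm*d≈1 ⟩
      1#                                 ∎)
    , (begin
      a * - (b * d) + b * (a * d)        ≈⟨ +-congʳ (-‿distribʳ-* a (b * d)) ⟨
      - (a * (b * d)) + b * (a * d)      ≈⟨ +-congʳ (-‿cong (x∙yz≈y∙xz a b d)) ⟩
      - (b * (a * d)) + b * (a * d)      ≈⟨ -‿inverseˡ _ ⟩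
      0#                                 ∎))

  -- If `a +i b` has no inverse, then neither has its norm, so the norm vanishes and anisotropy
  -- kills both parts.
  A[i]-isField : IsField A → SumOfSquares A → IsField (AdjoinI.commutativeRing A)
  A[i]-isField isField anisotropic (a +i b) ¬invertible =
    anisotropic a b norm≈0 , anisotropic b a (trans (+-comm (b * b) (a * a)) norm≈0)
    where
    norm≈0 : a * a + b * b ≈ 0#
    norm≈0 = isField (a * a + b * b) λ inv → ¬invertible (norm-invertible⇒invertible a b inv)

  A[i]-characteristicZero : CharacteristicZero A → CharacteristicZero (AdjoinI.commutativeRing A)
  A[i]-characteristicZero (mkCharacteristicZero suc·1≉0) = mkCharacteristicZero λ n (re≈0 , _) → suc·1≉0 n (trans (re-· (suc n)) re≈0)
    where
    re-· : ∀ n → n · 1# ≈ re (n ·ᵢ Aᵢ.1#)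
    re-· zero    = refl
    re-· (suc n) = +-congˡ (re-· n)

-- Homomorphisms and polynomials

CRing : Set₁
CRing = CommutativeRing 0ℓ 0ℓ

open CommutativeRing using (Carrier; rawRing)

infix 4 _⟶_

record _⟶_ (A B : CRing) : Set where
  constructor mk⟶
  field
    ⟦_⟧                : Carrier A → Carrier B
    isRingHomomorphism : IsRingHomomorphism (rawRing A) (rawRing B) ⟦_⟧

  open IsRingHomomorphism isRingHomomorphism public

open _⟶_ public using (⟦_⟧)

module _ {A B : CRing} where
  private
    module A = CommutativeRing A
    module B = CommutativeRing B
    open RingProperties B.ring using (+-inverseˡ-unique; +-identityˡ-unique)

  module _ (f : Carrier A → Carrier B)
    (cong : ∀ {x y} → x A.≈ y → f x B.≈ f y)
    (+-homo : ∀ x y → f (x A.+ y) B.≈ f x B.+ f y)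
    (*-homo : ∀ x y → f (x A.* y) B.≈ f x B.* f y)
    (1-homo : f A.1# B.≈ B.1#)
    where

    abstract
      -- Compatibility with zero and negation follows from additivity, because the target is a group
      -- under addition.
      mkIsRingHomomorphism : IsRingHomomorphism (rawRing A) (rawRing B) f
      mkIsRingHomomorphism = record
        { isSemiringHomomorphism = record
          { isNearSemiringHomomorphism = record
            { +-isMonoidHomomorphism = record
              { isMagmaHomomorphism = record
                { isRelHomomorphism = record { cong = cong }
                ; homo = +-homo
                }
              ; ε-homo = 0-homo
              }
            ; *-homo = *-homo
            }
          ; 1#-homo = 1-homo
          }
        ; -‿homo = λ x → +-inverseˡ-unique (f (A.- x)) (f x)
            (B.trans (B.sym (+-homo (A.- x) x)) (B.trans (cong (A.-‿inverseˡ x)) 0-homo))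
        }
        where
        0-homo : f A.0# B.≈ B.0#
        0-homo = +-identityˡ-unique (f A.0#) (f A.0#)
          (B.trans (B.sym (+-homo A.0# A.0#)) (cong (A.+-identityˡ A.0#)))

    mkHom : A ⟶ B
    mkHom = mk⟶ f mkIsRingHomomorphism

  module _ (h : A ⟶ B) where
    private
      module h = _⟶_ h
      open Exp A.semiring using () renaming (_^_ to _^ᴬ_)
      open Exp B.semiring using () renaming (_^_ to _^ᴮ_)

    ⟦⟧-minus : ∀ x y → ⟦ h ⟧ (x A.- y) B.≈ ⟦ h ⟧ x B.- ⟦ h ⟧ y
    ⟦⟧-minus x y = B.trans (h.+-homo x (A.- y)) (B.+-congˡ (h.-‿homo y))

    ⟦⟧-^ : ∀ x n → ⟦ h ⟧ (x ^ᴬ n) B.≈ ⟦ h ⟧ x ^ᴮ n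
    ⟦⟧-^ x zero    = h.1#-homo
    ⟦⟧-^ x (suc n) = B.trans (h.*-homo x (x ^ᴬ n)) (B.*-congˡ (⟦⟧-^ x n))

idʰ : ∀ {A : CRing} → A ⟶ A
idʰ {A} = mkHom id id (λ _ _ → refl) (λ _ _ → refl) refl
  where open CommutativeRing A

infixr 9 _⊚_

_⊚_ : ∀ {A B C : CRing} → B ⟶ C → A ⟶ B → A ⟶ C
_⊚_ {C = C} (mk⟶ g g-homo) (mk⟶ f f-homo) =
  mk⟶ (g ∘ f) (Composition.isRingHomomorphism (CommutativeRing.trans C) f-homo g-homo)

module PolynomialProperties (A : CRing) where

  open Polynomial A
  private
    module A = CommutativeRing A
    module P = CommutativeRing commutativeRing

  coeff-cong : ∀ k {p q} → p P.≈ q → coeff p k A.≈ coeff q k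
  coeff-cong k (mk≈ e) = e k

  coeff-const* : ∀ a p k → coeff (const a P.* p) k A.≈ a A.* coeff p k
  coeff-const* a p k = A.trans (coeff-+ (a ·ᵖ p) (A.0# ∷ []) k)
    (A.trans (A.+-cong (coeff-· a p k) (zeros k)) (A.+-identityʳ _))
    where
    zeros : ∀ k → coeff (A.0# ∷ []) k A.≈ A.0#
    zeros zero    = A.refl
    zeros (suc k) = A.refl

  X*p≈0∷p : ∀ p → X P.* p P.≈ A.0# ∷ p
  X*p≈0∷p p = mk≈ λ k → A.trans (coeff-+ (A.0# ·ᵖ p) (A.0# ∷ (const A.1# P.* p)) k)
    (A.trans (A.+-congʳ (A.trans (coeff-· A.0# p k) (A.zeroˡ _)))
      (A.trans (A.+-identityˡ _) (shifted k)))
    where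
    shifted : ∀ k → coeff (A.0# ∷ (const A.1# P.* p)) k A.≈ coeff (A.0# ∷ p) k
    shifted zero    = A.refl
    shifted (suc k) = A.trans (coeff-const* A.1# p k) (A.*-identityˡ _)

  coeff-X*-suc : ∀ p k → coeff (X P.* p) (suc k) A.≈ coeff p k
  coeff-X*-suc p k = coeff-cong (suc k) (X*p≈0∷p p)

  -- Rewrites the list constructor as a ring expression, so that Leibniz rules stated on lists can
  -- be settled by the semiring solver.
  ∷≈const+X* : ∀ a p → (a ∷ p) P.≈ const a P.+ X P.* p
  ∷≈const+X* a p = P.sym (P.trans (P.+-congˡ {const a} (X*p≈0∷p p))
    (mk≈ λ { zero → A.+-identityʳ a ; (suc k) → A.refl }))

  ∷*≈ : ∀ a p q → (a ∷ p) P.* q P.≈ const a P.* q P.+ X P.* (p P.* q)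
  ∷*≈ a p q = P.trans (P.*-congʳ {q} (∷≈const+X* a p))
    (P.trans (P.distribʳ q (const a) (X P.* p)) (P.+-congˡ {const a P.* q} (P.*-assoc X p q)))

  *∷≈ : ∀ p b q → p P.* (b ∷ q) P.≈ const b P.* p P.+ X P.* (p P.* q)
  *∷≈ p b q = P.trans (P.*-comm p (b ∷ q))
    (P.trans (∷*≈ b q p) (P.+-congˡ {const b P.* p} (P.*-congˡ {X} (P.*-comm q p))))

  polynomial-induction : ∀ {Q : Poly → Set} →
    (∀ {p q} → p P.≈ q → Q p → Q q) →
    (∀ {p q} → Q p → Q q → Q (p P.+ q)) →
    (∀ {p q} → Q p → Q q → Q (p P.* q)) →
    (∀ a → Q (const a)) → Q X → ∀ p → Q p
  -- The empty list is not of the form `const a`, but it equals `const A.0#` up to a trailing zero.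
  polynomial-induction resp +-closed *-closed Q-const Q-X []      =
    resp (mk≈ λ { zero → A.refl ; (suc k) → A.refl }) (Q-const A.0#)
  polynomial-induction resp +-closed *-closed Q-const Q-X (a ∷ p) =
    resp (P.sym (∷≈const+X* a p)) (+-closed (Q-const a) (*-closed Q-X
      (polynomial-induction resp +-closed *-closed Q-const Q-X p)))

  constʰ : A ⟶ commutativeRing
  constʰ = mkHom const
    (λ a≈b → mk≈ λ { zero → a≈b ; (suc k) → A.refl })
    (λ a b → P.refl {const (a A.+ b)})
    (λ a b → mk≈ λ { zero → A.sym (A.+-identityʳ _) ; (suc k) → A.refl })
    (P.refl {const A.1#})

  module _ {B : CRing} (φ : A ⟶ B) (b : Carrier B) where
    private
      module B = CommutativeRing B
      module φ = _⟶_ φ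
      open CommutativeSemigroupProperties B.+-commutativeSemigroup using (interchange)
      open CommutativeSemigroupProperties B.*-commutativeSemigroup using (x∙yz≈y∙xz)
      open SetoidReasoning B.setoid

      horner : Poly → Carrier B
      horner []      = B.0#
      horner (a ∷ p) = ⟦ φ ⟧ a B.+ b B.* horner p

      -- Zero is represented by every list of zeros; this settles the comparison of lists of
      -- different lengths in `horner-cong`.
      horner-0 : ∀ p → (∀ k → A.0# A.≈ coeff p k) → B.0# B.≈ horner p
      horner-0 []      0≈p = B.refl
      horner-0 (a ∷ p) 0≈p = begin
        B.0#                           ≈⟨ B.zeroʳ b ⟨
        b B.* B.0#                     ≈⟨ B.*-congˡ (horner-0 p (0≈p ∘ suc)) ⟩
        b B.* horner p                 ≈⟨ B.+-identityˡ _ ⟨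
        B.0# B.+ b B.* horner p        ≈⟨ B.+-congʳ (B.trans (B.sym φ.0#-homo) (φ.⟦⟧-cong (0≈p 0))) ⟩
        ⟦ φ ⟧ a B.+ b B.* horner p     ∎

      horner-cong : ∀ p q → (∀ k → coeff p k A.≈ coeff q k) → horner p B.≈ horner q
      horner-cong []      q       p≈q = horner-0 q p≈q
      horner-cong (a ∷ p) []      p≈q = B.sym (horner-0 (a ∷ p) (A.sym ∘ p≈q))
      horner-cong (a ∷ p) (c ∷ q) p≈q =
        B.+-cong (φ.⟦⟧-cong (p≈q 0)) (B.*-congˡ (horner-cong p q (p≈q ∘ suc)))

      horner-+ : ∀ p q → horner (p P.+ q) B.≈ horner p B.+ horner q
      horner-+ []      q       = B.sym (B.+-identityˡ _)
      horner-+ (a ∷ p) []      = B.sym (B.+-identityʳ _)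
      horner-+ (a ∷ p) (c ∷ q) = begin
        ⟦ φ ⟧ (a A.+ c) B.+ b B.* horner (p P.+ q)
          ≈⟨ B.+-cong (φ.+-homo a c) (B.trans (B.*-congˡ (horner-+ p q)) (B.distribˡ b _ _)) ⟩
        ⟦ φ ⟧ a B.+ ⟦ φ ⟧ c B.+ (b B.* horner p B.+ b B.* horner q)
          ≈⟨ interchange _ _ _ _ ⟩
        ⟦ φ ⟧ a B.+ b B.* horner p B.+ (⟦ φ ⟧ c B.+ b B.* horner q) ∎

      horner-· : ∀ a p → horner (a ·ᵖ p) B.≈ ⟦ φ ⟧ a B.* horner p
      horner-· a []      = B.sym (B.zeroʳ _)
      horner-· a (c ∷ p) = begin
        ⟦ φ ⟧ (a A.* c) B.+ b B.* horner (a ·ᵖ p)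
          ≈⟨ B.+-cong (φ.*-homo a c) (B.trans (B.*-congˡ (horner-· a p)) (x∙yz≈y∙xz b (⟦ φ ⟧ a) (horner p))) ⟩
        ⟦ φ ⟧ a B.* ⟦ φ ⟧ c B.+ ⟦ φ ⟧ a B.* (b B.* horner p)
          ≈⟨ B.distribˡ _ _ _ ⟨
        ⟦ φ ⟧ a B.* (⟦ φ ⟧ c B.+ b B.* horner p) ∎

      horner-* : ∀ p q → horner (p P.* q) B.≈ horner p B.* horner q
      horner-* []      q = B.sym (B.zeroˡ _)
      horner-* (a ∷ p) q = begin
        horner (a ·ᵖ q P.+ (A.0# ∷ (p P.* q)))
          ≈⟨ horner-+ (a ·ᵖ q) (A.0# ∷ (p P.* q)) ⟩
        horner (a ·ᵖ q) B.+ (⟦ φ ⟧ A.0# B.+ b B.* horner (p P.* q))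
          ≈⟨ B.+-cong (horner-· a q) (B.trans (B.+-congʳ φ.0#-homo) (B.+-identityˡ _)) ⟩
        ⟦ φ ⟧ a B.* horner q B.+ b B.* horner (p P.* q)
          ≈⟨ B.+-congˡ (B.trans (B.*-congˡ (horner-* p q)) (B.sym (B.*-assoc b _ _))) ⟩
        ⟦ φ ⟧ a B.* horner q B.+ b B.* horner p B.* horner q
          ≈⟨ B.distribʳ _ _ _ ⟨
        (⟦ φ ⟧ a B.+ b B.* horner p) B.* horner q ∎

      horner-const : ∀ a → horner (const a) B.≈ ⟦ φ ⟧ a
      horner-const a = B.trans (B.+-congˡ (B.zeroʳ b)) (B.+-identityʳ _)

    abstract
      evalʰ : commutativeRing ⟶ B
      evalʰ = mkHom horner (λ {p} {q} (mk≈ e) → horner-cong p q e) horner-+ horner-*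
        (B.trans (horner-const A.1#) φ.1#-homo)

      evalʰ-const : ∀ a → ⟦ evalʰ ⟧ (const a) B.≈ ⟦ φ ⟧ a
      evalʰ-const = horner-const

      evalʰ-X : ⟦ evalʰ ⟧ X B.≈ b
      evalʰ-X = begin
        ⟦ φ ⟧ A.0# B.+ b B.* horner (const A.1#)  ≈⟨ B.+-cong φ.0#-homo (B.*-congˡ (B.trans (horner-const A.1#) φ.1#-homo)) ⟩
        B.0# B.+ b B.* B.1#                       ≈⟨ B.+-identityˡ _ ⟩
        b B.* B.1#                                ≈⟨ B.*-identityʳ b ⟩
        b                                         ∎

-- Domains

record IsDomain (A : CRing) : Set where
  open CommutativeRing A
  field
    stable : ∀ {a} → ¬ ¬ (a ≈ 0#) → a ≈ 0#
    cancel : ∀ {a b} → a * b ≈ 0# → ¬ (a ≈ 0#) → b ≈ 0#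
    1≉0    : ¬ (1# ≈ 0#)

  -- Excluded middle for `a ≈ 0#`, available because the goal is a stable equation.
  stable-cases : ∀ {b} a → (a ≈ 0# → b ≈ 0#) → (¬ (a ≈ 0#) → b ≈ 0#) → b ≈ 0#
  stable-cases a a≈0⇒ a≉0⇒ = stable λ b≉0 → b≉0 (a≉0⇒ λ a≈0 → b≉0 (a≈0⇒ a≈0))

module _ {A : CRing} where
  open CommutativeRing A

  -- By the contrapositive field axiom it suffices to refute an inverse of the element in question.
  -- For `cancel`, an inverse `c` of `b` would give `a = a b c = 0`.
  field⇒domain : CharacteristicZero A → IsField A → IsDomain A
  field⇒domain (mkCharacteristicZero suc·1≉0) isField = record
    { stable = λ {a} ¬¬a≈0 → isField a λ (b , ab≈1) → ¬¬a≈0 λ a≈0 →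
        1≉0 (trans (sym ab≈1) (trans (*-congʳ a≈0) (zeroˡ b)))
    ; cancel = λ {a} {b} ab≈0 a≉0 → isField b λ (c , bc≈1) → a≉0 (begin
        a              ≈⟨ *-identityʳ a ⟨
        a * 1#         ≈⟨ *-congˡ bc≈1 ⟨
        a * (b * c)    ≈⟨ *-assoc a b c ⟨
        a * b * c      ≈⟨ *-congʳ ab≈0 ⟩
        0# * c         ≈⟨ zeroˡ c ⟩
        0#             ∎)
    ; 1≉0 = 1≉0
    }
    where
    open SetoidReasoning setoid
    1≉0 : ¬ (1# ≈ 0#)
    1≉0 1≈0 = suc·1≉0 0 (trans (+-identityʳ 1#) 1≈0)

  unit≉0 : IsDomain A → ∀ {u} → Invertible A u → ¬ (u ≈ 0#)
  unit≉0 dom (v , uv≈1) u≈0 = IsDomain.1≉0 dom (trans (sym uv≈1) (trans (*-congʳ u≈0) (zeroˡ v)))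

  power≉0 : IsDomain A → ∀ {a} → ¬ (a ≈ 0#) → ∀ n → ¬ (Exp._^_ semiring a n ≈ 0#)
  power≉0 dom a≉0 zero    = IsDomain.1≉0 dom
  power≉0 dom a≉0 (suc n) aⁿ⁺¹≈0 = power≉0 dom a≉0 n (IsDomain.cancel dom aⁿ⁺¹≈0 a≉0)

module _ {A B : CRing} (h : A ⟶ B) where
  private
    module A = CommutativeRing A
    module B = CommutativeRing B
    module h = _⟶_ h

  ⟦⟧-invertible : ∀ {a} → Invertible A a → Invertible B (⟦ h ⟧ a)
  ⟦⟧-invertible {a} (b , ab≈1) = ⟦ h ⟧ b , B.trans (B.sym (h.*-homo a b)) (B.trans (h.⟦⟧-cong ab≈1) h.1#-homo)

  -- A field is only weakly covered by 0 and its units, which suffices for a stable property.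
  field-image : ∀ {ℓ} {P : Carrier B → Set ℓ} → IsField A → (∀ {b} → ¬ ¬ P b → P b) →
    (∀ {b} → b B.≈ B.0# → P b) → (∀ b → Invertible B b → P b) → ∀ a → P (⟦ h ⟧ a)
  field-image isField P-stable P-0 P-unit a = P-stable λ ¬P →
    ¬P (P-0 (B.trans (h.⟦⟧-cong (isField a λ inv → ¬P (P-unit (⟦ h ⟧ a) (⟦⟧-invertible inv)))) h.0#-homo))

-- Degrees and units of polynomials over a domain

module DomainPolynomial {A : CRing} (dom : IsDomain A) where

  open Polynomial A
  open PolynomialProperties A
  open IsDomain dom
  private
    module A = CommutativeRing A
    module P = CommutativeRing commutativeRing
    open SetoidReasoning A.setoid

  -- A relation rather than a function: vanishing of coefficients is undecidable, so the degree of a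
  -- given list cannot be computed.
  record HasDegree (p : Poly) (d : ℕ) : Set where
    constructor hasDegree
    field
      leading≉0 : ¬ (coeff p d A.≈ A.0#)
      above     : ∀ k → d ℕ.< k → coeff p k A.≈ A.0#

  -- Stands in for the existence of a degree. A degree `d` of the tail would be a degree `suc d` of
  -- the whole, so the tail vanishes; a nonzero head would then have degree zero.
  ¬degree⇒≈0 : ∀ p → (∀ d → ¬ HasDegree p d) → p P.≈ P.0#
  ¬degree⇒≈0 []      _   = P.refl
  ¬degree⇒≈0 (a ∷ p) ¬deg = mk≈ λ { zero → stable λ a≉0 → ¬deg 0 (hasDegree a≉0 λ { (suc k) _ → tail≈0 k }) ; (suc k) → tail≈0 k }
    where
    tail≈0 : ∀ k → coeff p k A.≈ A.0#
    tail≈0 k = coeff-cong k (¬degree⇒≈0 p λ d (hasDegree lead above) →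
      ¬deg (suc d) (hasDegree lead λ { (suc k) (ℕ.s≤s d<k) → above k d<k }))

  coeff-*∷-suc : ∀ p b q k → coeff (p P.* (b ∷ q)) (suc k) A.≈ b A.* coeff p (suc k) A.+ coeff (p P.* q) k
  coeff-*∷-suc p b q k = begin
    coeff (p P.* (b ∷ q)) (suc k)                              ≈⟨ coeff-cong (suc k) (*∷≈ p b q) ⟩
    coeff (const b P.* p P.+ X P.* (p P.* q)) (suc k)          ≈⟨ coeff-+ (const b P.* p) _ (suc k) ⟩
    coeff (const b P.* p) (suc k) A.+ coeff (X P.* (p P.* q)) (suc k)
      ≈⟨ A.+-cong (coeff-const* b p (suc k)) (coeff-X*-suc (p P.* q) k) ⟩
    b A.* coeff p (suc k) A.+ coeff (p P.* q) k                ∎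

  coeff-*∷-≈0 : ∀ p b q k → q P.≈ P.0# → coeff (p P.* (b ∷ q)) k A.≈ coeff p k A.* b
  coeff-*∷-≈0 p b q k q≈0 = begin
    coeff (p P.* (b ∷ q)) k      ≈⟨ coeff-cong k (P.*-congˡ {p} {b ∷ q} {const b} (mk≈ λ { zero → A.refl ; (suc k) → coeff-cong k q≈0 })) ⟩
    coeff (p P.* const b) k      ≈⟨ coeff-cong k (P.*-comm p (const b)) ⟩
    coeff (const b P.* p) k      ≈⟨ coeff-const* b p k ⟩
    b A.* coeff p k              ≈⟨ A.*-comm b _ ⟩
    coeff p k A.* b              ∎

  -- Induction on the second factor `b + X q`. Above degree `d` the term `b p` contributes nothing,
  -- so `p q` is again low and `q` vanishes; then the coefficient at `d` is the leading coefficient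
  -- times `b`. With `p q = 0` this yields cancellation, and with `p q = 1` the constancy of units.
  product-low⇒≈0 : ∀ {p d} → HasDegree p d → ∀ q → (∀ k → d ℕ.≤ k → coeff (p P.* q) k A.≈ A.0#) → q P.≈ P.0#
  product-low⇒≈0 deg []      low = P.refl
  product-low⇒≈0 {p} {d} deg@(hasDegree lead above) (b ∷ q) low = mk≈ λ
    { zero    → cancel (A.trans (A.sym (coeff-*∷-≈0 p b q d q≈0)) (low d ℕ.≤-refl)) lead
    ; (suc k) → coeff-cong k q≈0
    }
    where
    q≈0 : q P.≈ P.0#
    q≈0 = product-low⇒≈0 deg q λ k d≤k → begin
      coeff (p P.* q) k                                  ≈⟨ A.+-identityˡ _ ⟨
      A.0# A.+ coeff (p P.* q) k                         ≈⟨ A.+-congʳ (A.trans (A.*-congˡ (above (suc k) (ℕ.s≤s d≤k))) (A.zeroʳ b)) ⟨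
      b A.* coeff p (suc k) A.+ coeff (p P.* q) k        ≈⟨ coeff-*∷-suc p b q k ⟨
      coeff (p P.* (b ∷ q)) (suc k)                      ≈⟨ low (suc k) (ℕ.m≤n⇒m≤1+n d≤k) ⟩
      A.0#                                               ∎

  const≈0⇒≈0 : ∀ {a} → const a P.≈ P.0# → a A.≈ A.0#
  const≈0⇒≈0 (mk≈ e) = e 0

  isDomain : IsDomain commutativeRing
  isDomain = record
    { stable = λ ¬¬p≈0 → mk≈ λ k → stable λ pₖ≉0 → ¬¬p≈0 λ (mk≈ p≈0) → pₖ≉0 (p≈0 k)
    ; cancel = λ {p} {q} pq≈0 p≉0 → mk≈ λ k → stable λ qₖ≉0 → p≉0 (¬degree⇒≈0 p λ d deg →
        qₖ≉0 (coeff-cong k (product-low⇒≈0 deg q λ k _ → coeff-cong k pq≈0)))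
    ; 1≉0 = λ 1≈0 → 1≉0 (const≈0⇒≈0 1≈0)
    }

  -- If `p` had positive degree, then `p q = 1` would have no coefficient from that degree on,
  -- forcing `q = 0`. Degree zero contradicts the nonzero higher coefficient.
  unit⇒constant : ∀ {p} → Invertible commutativeRing p → ∀ k → coeff p (suc k) A.≈ A.0#
  unit⇒constant {p} (q , pq≈1) k = stable λ pₖ≉0 → IsDomain.1≉0 isDomain (P.trans (P.sym pq≈1)
    (P.trans (P.*-congʳ {q} (¬degree⇒≈0 p (no-degree pₖ≉0))) (P.zeroˡ q)))
    where
    no-degree : ¬ (coeff p (suc k) A.≈ A.0#) → ∀ d → ¬ HasDegree p d
    no-degree pₖ≉0 zero    (hasDegree _ above) = pₖ≉0 (above (suc k) ℕ.z<s)
    no-degree pₖ≉0 (suc d) deg = IsDomain.1≉0 isDomain (P.trans (P.sym pq≈1)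
      (P.trans (P.*-congˡ {p} (product-low⇒≈0 deg q λ { (suc j) _ → coeff-cong (suc j) pq≈1 })) (P.zeroʳ p)))

  -- The constant coefficient is evaluation at zero, a ring homomorphism, and so preserves units.
  coeff₀-invertible : ∀ {p} → Invertible commutativeRing p → Invertible A (coeff p 0)
  coeff₀-invertible {p} inv with ⟦⟧-invertible (evalʰ idʰ A.0#) {p} inv
  ... | b , e = b , A.trans (A.*-congʳ {b} (A.sym (ev₀≈coeff₀ p))) e
    where
    module ev₀ = _⟶_ (evalʰ idʰ A.0#)
    ev₀≈coeff₀ : ∀ p → ⟦ evalʰ idʰ A.0# ⟧ p A.≈ coeff p 0
    ev₀≈coeff₀ []      = ev₀.0#-homo
    ev₀≈coeff₀ (a ∷ p) = begin
      ev₀.⟦ a ∷ p ⟧                             ≈⟨ ev₀.⟦⟧-cong (∷≈const+X* a p) ⟩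
      ev₀.⟦ const a P.+ X P.* p ⟧               ≈⟨ ev₀.+-homo (const a) (X P.* p) ⟩
      ev₀.⟦ const a ⟧ A.+ ev₀.⟦ X P.* p ⟧       ≈⟨ A.+-cong (evalʰ-const idʰ A.0# a) (ev₀.*-homo X p) ⟩
      a A.+ ev₀.⟦ X ⟧ A.* ev₀.⟦ p ⟧             ≈⟨ A.+-congˡ (A.*-congʳ (evalʰ-X idʰ A.0#)) ⟩
      a A.+ A.0# A.* ev₀.⟦ p ⟧                  ≈⟨ A.+-congˡ (A.zeroˡ _) ⟩
      a A.+ A.0#                                ≈⟨ A.+-identityʳ a ⟩
      a                                         ∎

polynomial-characteristicZero : ∀ {A : CRing} → CharacteristicZero A → CharacteristicZero (Polynomial.commutativeRing A)
polynomial-characteristicZero {A} (mkCharacteristicZero suc·1≉0) =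
  mkCharacteristicZero λ n (mk≈ e) → suc·1≉0 n (A.trans (A.sym (coeff₀-· (suc n))) (e 0))
  where
  module A = CommutativeRing A
  open Polynomial A
  module P = CommutativeRing commutativeRing
  open Mult A.semiring using () renaming (_×_ to _·ᴬ_)
  open Mult P.semiring using () renaming (_×_ to _·_)
  coeff₀-· : ∀ n → coeff (n · P.1#) 0 A.≈ n ·ᴬ A.1#
  coeff₀-· zero    = A.refl
  coeff₀-· (suc n) = A.trans (coeff-+ P.1# (n · P.1#) 0) (A.+-congˡ (coeff₀-· n))

-- Derivations

record Derivation (A : CRing) : Set where
  open CommutativeRing A
  field
    D      : Carrier A → Carrier A
    D-cong : ∀ {a b} → a ≈ b → D a ≈ D b
    D-+    : ∀ a b → D (a + b) ≈ D a + D b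
    D-*    : ∀ a b → D (a * b) ≈ a * D b + D a * b

  open RingProperties ring

  D-0 : D 0# ≈ 0#
  D-0 = +-identityˡ-unique (D 0#) (D 0#) (trans (sym (D-+ 0# 0#)) (D-cong (+-identityˡ 0#)))

  D-*-0 : ∀ {a b} → D a ≈ 0# → D b ≈ 0# → D (a * b) ≈ 0#
  D-*-0 {a} {b} Da≈0 Db≈0 = trans (D-* a b) (trans
    (+-cong (trans (*-congˡ Db≈0) (zeroʳ a)) (trans (*-congʳ Da≈0) (zeroˡ b))) (+-identityˡ 0#))

  KillsUnits : Set
  KillsUnits = ∀ u → Invertible A u → D u ≈ 0#

  module _ (D-unit : KillsUnits) where

    open Exp semiring using (_^_)
    open Mult semiring using (×-congʳ; ×-comm-*; ×-assoc-*; ×-homo-1) renaming (_×_ to _·_)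
    open SetoidReasoning setoid

    D-1 : D 1# ≈ 0#
    D-1 = D-unit 1# (1# , *-identityˡ 1#)

    D-^ : ∀ a n → D (a ^ suc n) ≈ suc n · (a ^ n * D a)
    D-^ a zero = begin
      D (a * 1#)                 ≈⟨ D-cong (*-identityʳ a) ⟩
      D a                        ≈⟨ *-identityˡ _ ⟨
      1# * D a                   ≈⟨ ×-homo-1 _ ⟨
      1 · (1# * D a)             ∎
    D-^ a (suc n) = begin
      D (a * a ^ suc n)                                       ≈⟨ D-* a (a ^ suc n) ⟩
      a * D (a ^ suc n) + D a * a ^ suc n                     ≈⟨ +-cong (*-congˡ (D-^ a n)) (*-comm _ _) ⟩
      a * (suc n · (a ^ n * D a)) + a ^ suc n * D a           ≈⟨ +-congʳ (×-comm-* (suc n) a _) ⟩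
      suc n · (a * (a ^ n * D a)) + a ^ suc n * D a           ≈⟨ +-congʳ (×-congʳ (suc n) (*-assoc a _ _)) ⟨
      suc n · (a ^ suc n * D a) + a ^ suc n * D a             ≈⟨ +-comm _ _ ⟩
      suc (suc n) · (a ^ suc n * D a)                         ∎

    -- Cancels the factors of the power rule: writing the multiple as a product with `suc n · 1#`
    -- makes characteristic zero applicable, and a nonzero `a` has nonzero powers. If `a` is zero,
    -- so is its derivative.
    D-^≈0⇒D≈0 : IsDomain A → CharacteristicZero A → ∀ a n .{{_ : ℕ.NonZero n}} → D (a ^ n) ≈ 0# → D a ≈ 0#
    D-^≈0⇒D≈0 dom (mkCharacteristicZero suc·1≉0) a (suc n) Daⁿ≈0 = stable-cases a
      (λ a≈0 → trans (D-cong a≈0) D-0)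
      (λ a≉0 → cancel (cancel [n·1]*aⁿDa≈0 (suc·1≉0 n)) (power≉0 dom a≉0 n))
      where
      open IsDomain dom
      [n·1]*aⁿDa≈0 : (suc n · 1#) * (a ^ n * D a) ≈ 0#
      [n·1]*aⁿDa≈0 = begin
        (suc n · 1#) * (a ^ n * D a)   ≈⟨ ×-assoc-* (suc n) 1# _ ⟩
        suc n · (1# * (a ^ n * D a))   ≈⟨ ×-congʳ (suc n) (*-identityˡ _) ⟩
        suc n · (a ^ n * D a)          ≈⟨ D-^ a n ⟨
        D (a ^ suc n)                  ≈⟨ Daⁿ≈0 ⟩
        0#                             ∎

    D-^-0 : ∀ {a} n → D a ≈ 0# → D (a ^ n) ≈ 0#
    D-^-0 zero    Da≈0 = D-1
    D-^-0 (suc n) Da≈0 = D-*-0 Da≈0 (D-^-0 n Da≈0)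

    D-power-curve : IsDomain A → CharacteristicZero A → ∀ a b m n .{{_ : ℕ.NonZero m}} →
      b ^ m ≈ a ^ n → D a ≈ 0# → D b ≈ 0#
    D-power-curve dom char0 a b m n bᵐ≈aⁿ Da≈0 =
      D-^≈0⇒D≈0 dom char0 b m (trans (D-cong bᵐ≈aⁿ) (D-^-0 n Da≈0))

module _ {A : CRing} where
  open CommutativeRing A
  open SemiringSolver commutativeSemiring using (solve; _:+_; _:*_; _:=_)

  linearCombination : Carrier A → Derivation A → Carrier A → Derivation A → Derivation A
  linearCombination f δ g ε = record
    { D      = λ a → f * D a + g * E a
    ; D-cong = λ a≈b → +-cong (*-congˡ (D-cong a≈b)) (*-congˡ (E-cong a≈b))
    ; D-+    = λ a b → trans (+-cong (*-congˡ (D-+ a b)) (*-congˡ (E-+ a b)))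
        (solve 6 (λ f g a b c d → (f :* (a :+ b) :+ g :* (c :+ d)) := ((f :* a :+ g :* c) :+ (f :* b :+ g :* d))) refl
          f g (D a) (D b) (E a) (E b))
    ; D-*    = λ a b → trans (+-cong (*-congˡ (D-* a b)) (*-congˡ (E-* a b)))
        (solve 8 (λ f g a b da db ea eb → (f :* (a :* db :+ da :* b) :+ g :* (a :* eb :+ ea :* b)) :=
            (a :* (f :* db :+ g :* eb) :+ (f :* da :+ g :* ea) :* b)) refl
          f g a b (D a) (D b) (E a) (E b))
    }
    where
    open Derivation δ
    open Derivation ε renaming (D to E; D-cong to E-cong; D-+ to E-+; D-* to E-*)

  linearCombination-killsUnits : ∀ f δ g ε → Derivation.KillsUnits δ → Derivation.KillsUnits ε → Derivation.KillsUnits (linearCombination f δ g ε)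
  linearCombination-killsUnits f δ g ε δ-unit ε-unit u inv = trans
    (+-cong (trans (*-congˡ (δ-unit u inv)) (zeroʳ f)) (trans (*-congˡ (ε-unit u inv)) (zeroʳ g))) (+-identityˡ 0#)

-- Derivations of polynomial rings

module PolynomialDerivations (A : CRing) where

  open Polynomial A
  open PolynomialProperties A
  private
    module A = CommutativeRing A
    module P = CommutativeRing commutativeRing

  module _ (δ : Derivation A) where
    open Derivation δ
    open SemiringSolver P.commutativeSemiring using (solve; _:+_; _:*_; _:=_)

    private
      coeff-map : ∀ p k → coeff (map D p) k A.≈ D (coeff p k)
      coeff-map []      k       = A.sym D-0
      coeff-map (a ∷ p) zero    = A.refl
      coeff-map (a ∷ p) (suc k) = coeff-map p k

      map-cong : ∀ {p q} → p P.≈ q → map D p P.≈ map D q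
      map-cong {p} {q} (mk≈ e) = mk≈ λ k →
        A.trans (coeff-map p k) (A.trans (D-cong (e k)) (A.sym (coeff-map q k)))

      map-+ : ∀ p q → map D (p P.+ q) P.≈ map D p P.+ map D q
      map-+ p q = mk≈ λ k → A.trans (coeff-map (p P.+ q) k) (A.trans (D-cong (coeff-+ p q k))
        (A.trans (D-+ _ _) (A.sym (A.trans (coeff-+ (map D p) (map D q) k)
          (A.+-cong (coeff-map p k) (coeff-map q k))))))

      map-const* : ∀ a p → map D (const a P.* p) P.≈ const a P.* map D p P.+ const (D a) P.* p
      map-const* a p = mk≈ λ k → A.trans (coeff-map (const a P.* p) k)
        (A.trans (D-cong (coeff-const* a p k)) (A.trans (D-* a (coeff p k)) (A.sym
          (A.trans (coeff-+ (const a P.* map D p) (const (D a) P.* p) k)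
            (A.+-cong (A.trans (coeff-const* a (map D p) k) (A.*-congˡ (coeff-map p k)))
              (coeff-const* (D a) p k))))))

      map-X* : ∀ p → map D (X P.* p) P.≈ X P.* map D p
      map-X* p = P.trans (map-cong (X*p≈0∷p p)) (P.trans
        (mk≈ λ { zero → D-0 ; (suc k) → A.refl }) (P.sym (X*p≈0∷p (map D p))))

      map-* : ∀ p q → map D (p P.* q) P.≈ p P.* map D q P.+ map D p P.* q
      map-* []      q = P.refl
      map-* (a ∷ p) q = begin
        map D ((a ∷ p) P.* q)
          ≈⟨ map-cong (∷*≈ a p q) ⟩
        map D (const a P.* q P.+ X P.* (p P.* q))
          ≈⟨ map-+ (const a P.* q) (X P.* (p P.* q)) ⟩
        map D (const a P.* q) P.+ map D (X P.* (p P.* q))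
          ≈⟨ P.+-cong (map-const* a q) (P.trans (map-X* (p P.* q)) (P.*-congˡ {X} (map-* p q))) ⟩
        const a P.* map D q P.+ const (D a) P.* q P.+ X P.* (p P.* map D q P.+ map D p P.* q)
          ≈⟨ solve 7 (λ a a′ x p p′ q q′ →
               (a :* q′ :+ a′ :* q :+ x :* (p :* q′ :+ p′ :* q)) := ((a :+ x :* p) :* q′ :+ (a′ :+ x :* p′) :* q))
               P.refl (const a) (const (D a)) X p (map D p) q (map D q) ⟩
        (const a P.+ X P.* p) P.* map D q P.+ (const (D a) P.+ X P.* map D p) P.* q
          ≈⟨ P.+-cong (P.*-congʳ {map D q} (∷≈const+X* a p)) (P.*-congʳ {q} (∷≈const+X* (D a) (map D p))) ⟨
        (a ∷ p) P.* map D q P.+ map D (a ∷ p) P.* q ∎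
        where open SetoidReasoning P.setoid

    abstract
      -- Extends `δ` by zero on `X`. Over `K[t]` with the derivative in `t`, this is the partial
      -- derivative in `t` on `K[t][s]`.
      coefficientwise : Derivation commutativeRing
      coefficientwise = record
        { D      = map D
        ; D-cong = map-cong
        ; D-+    = map-+
        ; D-*    = map-*
        }

      -- Over a domain a unit is a constant polynomial whose coefficient is a unit, and `D` kills
      -- the latter.
      coefficientwise-killsUnits : IsDomain A → KillsUnits → Derivation.KillsUnits coefficientwise
      coefficientwise-killsUnits dom D-unit p inv = mk≈ λ
        { zero    → A.trans (coeff-map p 0) (D-unit (coeff p 0) (coeff₀-invertible {p} inv))
        ; (suc k) → A.trans (coeff-map p (suc k)) (A.trans (D-cong (unit⇒constant {p} inv k)) D-0)
        }
        where open DomainPolynomial dom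

      coefficientwise-const : ∀ a → Derivation.D coefficientwise (const a) P.≈ const (D a)
      coefficientwise-const a = P.refl

  private

    -- The recursion is the Leibniz rule for `a + X p`, namely `p + X p′`.
    ∂ : Poly → Poly
    ∂ []      = []
    ∂ (a ∷ p) = p P.+ (A.0# ∷ ∂ p)

    open Mult A.semiring using (×-congʳ) renaming (_×_ to _·_)

    -- The recursion depends on the list; this formula depends only on the coefficients and so gives
    -- `∂-cong`.
    coeff-∂ : ∀ p k → coeff (∂ p) k A.≈ suc k · coeff p (suc k)
    coeff-∂ []      k       = A.sym (n·0≈0 (suc k))
      where
      n·0≈0 : ∀ n → n · A.0# A.≈ A.0#
      n·0≈0 zero    = A.refl
      n·0≈0 (suc n) = A.trans (A.+-identityˡ _) (n·0≈0 n)
    coeff-∂ (a ∷ p) zero    = coeff-+ p (A.0# ∷ ∂ p) 0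
    coeff-∂ (a ∷ p) (suc k) = A.trans (coeff-+ p (A.0# ∷ ∂ p) (suc k)) (A.+-congˡ (coeff-∂ p k))

    ∂-cong : ∀ {p q} → p P.≈ q → ∂ p P.≈ ∂ q
    ∂-cong {p} {q} (mk≈ e) = mk≈ λ k →
      A.trans (coeff-∂ p k) (A.trans (×-congʳ (suc k) (e (suc k))) (A.sym (coeff-∂ q k)))

    open SemiringSolver P.commutativeSemiring using (solve; _:+_; _:*_; _:=_)
    open SetoidReasoning P.setoid

    ∂-∷ : ∀ a p → ∂ (a ∷ p) P.≈ p P.+ X P.* ∂ p
    ∂-∷ a p = P.+-congˡ {p} (P.sym (X*p≈0∷p (∂ p)))

    ∂-+ : ∀ p q → ∂ (p P.+ q) P.≈ ∂ p P.+ ∂ q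
    ∂-+ []      q       = P.refl
    ∂-+ (a ∷ p) []      = P.sym (P.+-identityʳ (∂ (a ∷ p)))
    ∂-+ (a ∷ p) (b ∷ q) = begin
      ∂ ((a A.+ b) ∷ (p P.+ q))                     ≈⟨ ∂-∷ (a A.+ b) (p P.+ q) ⟩
      p P.+ q P.+ X P.* ∂ (p P.+ q)                 ≈⟨ P.+-congˡ {p P.+ q} (P.*-congˡ {X} (∂-+ p q)) ⟩
      p P.+ q P.+ X P.* (∂ p P.+ ∂ q)
        ≈⟨ solve 5 (λ x p q p′ q′ → (p :+ q :+ x :* (p′ :+ q′)) := ((p :+ x :* p′) :+ (q :+ x :* q′)))
             P.refl X p q (∂ p) (∂ q) ⟩
      p P.+ X P.* ∂ p P.+ (q P.+ X P.* ∂ q)         ≈⟨ P.+-cong (∂-∷ a p) (∂-∷ b q) ⟨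
      ∂ (a ∷ p) P.+ ∂ (b ∷ q)                       ∎

    ∂-X* : ∀ p → ∂ (X P.* p) P.≈ p P.+ X P.* ∂ p
    ∂-X* p = P.trans (∂-cong (X*p≈0∷p p)) (∂-∷ A.0# p)

    ∂-const* : ∀ a p → ∂ (const a P.* p) P.≈ const a P.* ∂ p
    ∂-const* a p = mk≈ λ k → A.trans (coeff-∂ (const a P.* p) k)
      (A.trans (×-congʳ (suc k) (coeff-const* a p (suc k)))
        (A.trans (A.sym (×-comm-* (suc k) a (coeff p (suc k))))
          (A.sym (A.trans (coeff-const* a (∂ p) k) (A.*-congˡ (coeff-∂ p k))))))
      where open Mult A.semiring using (×-comm-*)

    ∂-* : ∀ p q → ∂ (p P.* q) P.≈ p P.* ∂ q P.+ ∂ p P.* q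
    ∂-* []      q = P.refl
    ∂-* (a ∷ p) q = begin
      ∂ ((a ∷ p) P.* q)                                 ≈⟨ ∂-cong (∷*≈ a p q) ⟩
      ∂ (const a P.* q P.+ X P.* (p P.* q))             ≈⟨ ∂-+ (const a P.* q) (X P.* (p P.* q)) ⟩
      ∂ (const a P.* q) P.+ ∂ (X P.* (p P.* q))
        ≈⟨ P.+-cong (∂-const* a q) (P.trans (∂-X* (p P.* q)) (P.+-congˡ {p P.* q} (P.*-congˡ {X} (∂-* p q)))) ⟩
      const a P.* ∂ q P.+ (p P.* q P.+ X P.* (p P.* ∂ q P.+ ∂ p P.* q))
        ≈⟨ solve 6 (λ a x p p′ q q′ →
             (a :* q′ :+ (p :* q :+ x :* (p :* q′ :+ p′ :* q))) := ((a :+ x :* p) :* q′ :+ (p :+ x :* p′) :* q))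
             P.refl (const a) X p (∂ p) q (∂ q) ⟩
      (const a P.+ X P.* p) P.* ∂ q P.+ (p P.+ X P.* ∂ p) P.* q
        ≈⟨ P.+-cong (P.*-congʳ {∂ q} (∷≈const+X* a p)) (P.*-congʳ {q} (∂-∷ a p)) ⟨
      (a ∷ p) P.* ∂ q P.+ ∂ (a ∷ p) P.* q               ∎

  abstract
    derivative : Derivation commutativeRing
    derivative = record
      { D      = ∂
      ; D-cong = ∂-cong
      ; D-+    = ∂-+
      ; D-*    = ∂-*
      }

    derivative-killsUnits : IsDomain A → Derivation.KillsUnits derivative
    derivative-killsUnits dom p inv = mk≈ λ k → A.trans (coeff-∂ p k)
      (A.trans (×-congʳ (suc k) (DomainPolynomial.unit⇒constant dom {p} inv k)) (A.sym (coeff-∂ [] k)))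

    derivative-const : ∀ a → Derivation.D derivative (const a) P.≈ P.0#
    derivative-const a = mk≈ λ { zero → A.refl ; (suc k) → A.refl }

    derivative-X : Derivation.D derivative X P.≈ P.1#
    derivative-X = mk≈ λ { zero → A.+-identityʳ A.1# ; (suc zero) → A.refl ; (suc (suc k)) → A.refl }

-- Universal properties of polynomial rings and quotients

module _ (A : CRing) where

  open Polynomial using (const)

  [X]-scalarʰ : ∀ n → A ⟶ A [X n ]
  [X]-scalarʰ zero    = idʰ
  [X]-scalarʰ (suc n) = PolynomialProperties.constʰ (A [X n ]) ⊚ [X]-scalarʰ n

  [X]-scalar : ∀ n → Carrier A → Carrier (A [X n ])
  [X]-scalar n = ⟦ [X]-scalarʰ n ⟧

  [X]-induction : ∀ n (let module P = CommutativeRing (A [X n ])) {Q : Carrier (A [X n ]) → Set} →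
    (∀ {p q} → p P.≈ q → Q p → Q q) →
    (∀ {p q} → Q p → Q q → Q (p P.+ q)) →
    (∀ {p q} → Q p → Q q → Q (p P.* q)) →
    (∀ a → Q ([X]-scalar n a)) → (∀ (i : Fin n) → Q (var A i)) → ∀ p → Q p
  [X]-induction zero    resp +-closed *-closed Q-scalar Q-var = Q-scalar
  [X]-induction (suc n) {Q} resp +-closed *-closed Q-scalar Q-var =
    polynomial-induction resp +-closed *-closed Q-const (Q-var zero)
    where
    open PolynomialProperties (A [X n ])
    module C = _⟶_ constʰ
    module A[Xₙ₊₁] = CommutativeRing (A [X suc n ])
    Q-const : ∀ p → Q (const (A [X n ]) p)
    Q-const = [X]-induction n {λ p → Q (const (A [X n ]) p)}
      (λ p≈q → resp (C.⟦⟧-cong p≈q))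
      (λ {p} {q} Qp Qq → resp (A[Xₙ₊₁].sym (C.+-homo p q)) (+-closed Qp Qq))
      (λ {p} {q} Qp Qq → resp (A[Xₙ₊₁].sym (C.*-homo p q)) (*-closed Qp Qq))
      Q-scalar (Q-var ∘ suc)

  module _ {B : CRing} (φ : A ⟶ B) where
    private module B = CommutativeRing B

    [X]-evalʰ : ∀ n → Vector (Carrier B) n → A [X n ] ⟶ B
    [X]-evalʰ zero    bs = φ
    [X]-evalʰ (suc n) bs = PolynomialProperties.evalʰ (A [X n ]) ([X]-evalʰ n (bs ∘ suc)) (bs zero)

    [X]-evalʰ-scalar : ∀ n bs a → ⟦ [X]-evalʰ n bs ⟧ ([X]-scalar n a) B.≈ ⟦ φ ⟧ a
    [X]-evalʰ-scalar zero    bs a = B.refl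
    [X]-evalʰ-scalar (suc n) bs a =
      B.trans (PolynomialProperties.evalʰ-const (A [X n ]) ([X]-evalʰ n (bs ∘ suc)) (bs zero) ([X]-scalar n a)) ([X]-evalʰ-scalar n (bs ∘ suc) a)

    [X]-evalʰ-var : ∀ n bs i → ⟦ [X]-evalʰ n bs ⟧ (var A i) B.≈ bs i
    [X]-evalʰ-var (suc n) bs zero    = PolynomialProperties.evalʰ-X (A [X n ]) ([X]-evalʰ n (bs ∘ suc)) (bs zero)
    [X]-evalʰ-var (suc n) bs (suc i) =
      B.trans (PolynomialProperties.evalʰ-const (A [X n ]) ([X]-evalʰ n (bs ∘ suc)) (bs zero) (var A i)) ([X]-evalʰ-var n (bs ∘ suc) i)

module _ {A : CRing} {k} {gs : Vector (Carrier A) k} where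
  private
    module A = CommutativeRing A
    module Q = CommutativeRing (A / gs)
  open Quotient A

  ≈⇒≈/ : ∀ {a b} → a A.≈ b → a Q.≈ b
  ≈⇒≈/ {a} {b} a≈b = mk≡mod (∈-resp-≈ (A.sym (A.trans (A.+-congʳ a≈b) (A.-‿inverseʳ b))) 0∈)

  projʰ : A ⟶ A / gs
  projʰ = mkHom id ≈⇒≈/ (λ a b → Q.refl) (λ a b → Q.refl) Q.refl

  ∈⇒≈/0 : ∀ {a} → a ∈⟨ gs ⟩ → a Q.≈ A.0#
  ∈⇒≈/0 {a} a∈ = mk≡mod (∈-resp-≈ (A.sym (A.trans (A.+-congˡ (RingProperties.-0#≈0# A.ring)) (A.+-identityʳ a))) a∈)

  ≈/0⇒∈ : ∀ {a} → a Q.≈ A.0# → a ∈⟨ gs ⟩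
  ≈/0⇒∈ {a} (mk≡mod a-0∈) = ∈-resp-≈ (A.trans (A.+-congˡ (RingProperties.-0#≈0# A.ring)) (A.+-identityʳ a)) a-0∈

module _ {A : CRing} where

  open Quotient A
  private module A = CommutativeRing A
  open Sum A.semiring using (sum)

  generator∈ : ∀ {k} (gs : Vector (Carrier A) k) i → gs i ∈⟨ gs ⟩
  generator∈ {suc k} gs zero    = combination (A.1# Vector.∷ λ _ → A.0#)
    (A.sym (A.trans (A.+-cong (A.*-identityˡ _) (a≈∑-0 (gs ∘ suc))) (A.+-identityʳ _)))
    where
    a≈∑-0 : ∀ {k} (gs : Vector (Carrier A) k) → sum (λ i → A.0# A.* gs i) A.≈ A.0#
    a≈∑-0 {zero}  gs = A.refl
    a≈∑-0 {suc k} gs = A.trans (A.+-cong (A.zeroˡ _) (a≈∑-0 (gs ∘ suc))) (A.+-identityˡ _)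
  generator∈ {suc k} gs (suc i) with generator∈ (gs ∘ suc) i
  ... | combination cs e = combination (A.0# Vector.∷ cs)
    (A.trans e (A.sym (A.trans (A.+-congʳ (A.zeroˡ _)) (A.+-identityˡ _))))

  principal : Carrier A → Vector (Carrier A) 1
  principal g = g Vector.∷ Vector.[]

  ∈principal : ∀ {g a} → CommutativeRing._≈_ (A / principal g) a A.0# → ∃ λ c → a A.≈ c A.* g
  ∈principal {g} a≈0 = multiple (≈/0⇒∈ a≈0)
    where
    multiple : ∀ {a} → a ∈⟨ principal g ⟩ → ∃ λ c → a A.≈ c A.* g
    multiple (combination cs e) = cs 0F , A.trans e (A.+-identityʳ _)

  principal≈0 : ∀ g → CommutativeRing._≈_ (A / principal g) g A.0#
  principal≈0 g = ∈⇒≈/0 (generator∈ (principal g) 0F)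

  module _ {k} {gs : Vector (Carrier A) k} {B : CRing} (h : A ⟶ B)
    (h-gs≈0 : ∀ i → CommutativeRing._≈_ B (⟦ h ⟧ (gs i)) (CommutativeRing.0# B))
    where
    private
      module B = CommutativeRing B
      module h = _⟶_ h

      sum≈0 : ∀ {k} (as : Vector (Carrier A) k) → (∀ i → ⟦ h ⟧ (as i) B.≈ B.0#) → ⟦ h ⟧ (sum as) B.≈ B.0#
      sum≈0 {zero}  as as≈0 = h.0#-homo
      sum≈0 {suc k} as as≈0 = B.trans (h.+-homo (as zero) _)
        (B.trans (B.+-cong (as≈0 zero) (sum≈0 (as ∘ suc) (as≈0 ∘ suc))) (B.+-identityˡ _))

      ideal≈0 : ∀ {a} → a ∈⟨ gs ⟩ → ⟦ h ⟧ a B.≈ B.0#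
      ideal≈0 (combination cs e) = B.trans (h.⟦⟧-cong e) (sum≈0 (λ i → cs i A.* gs i) λ i →
        B.trans (h.*-homo (cs i) (gs i)) (B.trans (B.*-congˡ (h-gs≈0 i)) (B.zeroʳ _)))

    liftʰ : A / gs ⟶ B
    liftʰ = mkHom ⟦ h ⟧
      (λ {a} {b} (mk≡mod a-b∈) → RingProperties.x∙y⁻¹≈ε⇒x≈y B.ring _ _ (B.trans (B.sym (⟦⟧-minus h a b)) (ideal≈0 a-b∈)))
      h.+-homo h.*-homo h.1#-homo

-- Isomorphisms and their inverses

module _ {A B : CRing} where
  private
    module A = CommutativeRing A
    module B = CommutativeRing B

  ≅⇒⟶ : A ≅ B → A ⟶ B
  ≅⇒⟶ (f , f-iso) = mk⟶ f (IsRingIsomorphism.isRingHomomorphism f-iso)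

  module _ (A≅B : A ≅ B) where
    private
      f = proj₁ A≅B
      module f = IsRingIsomorphism (proj₂ A≅B)
      g : Carrier B → Carrier A
      g b = proj₁ (f.surjective b)

    ≅-rightInverse : ∀ b → f (g b) B.≈ b
    ≅-rightInverse b = proj₂ (f.surjective b) A.refl

    -- The chosen preimages form a homomorphism because each law may be checked after applying the
    -- injective map `f`.
    ≅⇒⟵ : B ⟶ A
    ≅⇒⟵ = mkHom g
      (λ {b} {c} b≈c → f.injective (B.trans (≅-rightInverse b) (B.trans b≈c (B.sym (≅-rightInverse c)))))
      (λ b c → f.injective (B.trans (≅-rightInverse (b B.+ c)) (B.sym (B.trans (f.+-homo (g b) (g c))
        (B.+-cong (≅-rightInverse b) (≅-rightInverse c))))))
      (λ b c → f.injective (B.trans (≅-rightInverse (b B.* c)) (B.sym (B.trans (f.*-homo (g b) (g c))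
        (B.*-cong (≅-rightInverse b) (≅-rightInverse c))))))
      (f.injective (B.trans (≅-rightInverse B.1#) (B.sym f.1#-homo)))

    ≅-leftInverse : ∀ a → g (f a) A.≈ a
    ≅-leftInverse a = f.injective (≅-rightInverse (f a))

module _ {A B : CRing} (h : A ⟶ B) where
  private
    module A = CommutativeRing A
    module B = CommutativeRing B
    module h = _⟶_ h
    open Exp A.semiring using () renaming (_^_ to _^ᴬ_)
    open Exp B.semiring using (^-congˡ) renaming (_^_ to _^ᴮ_)

  ⟦⟧-difference : ∀ a b {a′ b′} → ⟦ h ⟧ a B.≈ a′ → ⟦ h ⟧ b B.≈ b′ → ⟦ h ⟧ (a A.- b) B.≈ a′ B.- b′
  ⟦⟧-difference a b ha≈a′ hb≈b′ = B.trans (⟦⟧-minus h a b) (B.+-cong ha≈a′ (B.-‿cong hb≈b′))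

  ⟦⟧-differences : ∀ a b c {a′ b′ c′} → ⟦ h ⟧ a B.≈ a′ → ⟦ h ⟧ b B.≈ b′ → ⟦ h ⟧ c B.≈ c′ →
    ⟦ h ⟧ ((a A.- b) A.* (a A.- c)) B.≈ (a′ B.- b′) B.* (a′ B.- c′)
  ⟦⟧-differences a b c ha≈a′ hb≈b′ hc≈c′ = B.trans (h.*-homo _ _) (B.*-cong (⟦⟧-difference a b ha≈a′ hb≈b′) (⟦⟧-difference a c ha≈a′ hc≈c′))

  ⟦⟧-^-cong : ∀ a n {a′} → ⟦ h ⟧ a B.≈ a′ → ⟦ h ⟧ (a ^ᴬ n) B.≈ a′ ^ᴮ n
  ⟦⟧-^-cong a n ha≈a′ = B.trans (⟦⟧-^ h a n) (^-congˡ n ha≈a′)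

module _ {A : CRing} where
  open CommutativeRing A
  open RingProperties ring using (x∙y⁻¹≈ε⇒x≈y)

  module _ (dom : IsDomain A) (δ : Derivation A) where
    open IsDomain dom
    open Derivation δ

    -- In a domain `a` equals `b` or `c`, and either way its derivative vanishes. This handles `z`
    -- in R₂, R₃ and R₄, and `y` in R₁.
    D-differences : ∀ {a b c} → (a - b) * (a - c) ≈ 0# → D b ≈ 0# → D c ≈ 0# → D a ≈ 0#
    D-differences {a} {b} {c} e Db≈0 Dc≈0 = stable-cases (a - b)
      (λ a-b≈0 → trans (D-cong (x∙y⁻¹≈ε⇒x≈y a b a-b≈0)) Db≈0)
      (λ a-b≉0 → trans (D-cong (x∙y⁻¹≈ε⇒x≈y a c (cancel e a-b≉0))) Dc≈0)

  open Exp semiring using (_^_)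

  power-invertible : ∀ {a} n .{{_ : ℕ.NonZero n}} → Invertible A (a ^ n) → Invertible A a
  power-invertible {a} (suc n) (b , aⁿ⁺¹b≈1) = a ^ n * b , trans (sym (*-assoc a (a ^ n) b)) aⁿ⁺¹b≈1

≅-sym : ∀ {A B : CRing} → A ≅ B → B ≅ A
≅-sym {A} {B} A≅B = ⟦ g ⟧ , record
  { isRingMonomorphism = record
    { isRingHomomorphism = _⟶_.isRingHomomorphism g
    ; injective = λ {b} {c} gb≈gc → B.trans (B.sym (≅-rightInverse {A} {B} A≅B b))
        (B.trans (_⟶_.⟦⟧-cong f gb≈gc) (≅-rightInverse {A} {B} A≅B c))
    }
  ; surjective = λ a → ⟦ f ⟧ a , λ b≈fa → A.trans (_⟶_.⟦⟧-cong g b≈fa) (≅-leftInverse {A} {B} A≅B a)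
  }
  where
  module A = CommutativeRing A
  module B = CommutativeRing B
  f : A ⟶ B
  f = ≅⇒⟶ A≅B
  g : B ⟶ A
  g = ≅⇒⟵ A≅B

module _ {P : CRing} where
  private module P = CommutativeRing P
  open Quotient P

  Congruent-resp : ∀ {k} {gs gs′ : Vector (Carrier P) k} → (∀ i → gs i P.≈ gs′ i) →
    ∀ {a b} → Congruent gs a b → Congruent gs′ a b
  Congruent-resp gs≈gs′ (mk≡mod (combination cs e)) = mk≡mod (combination cs
    (P.trans e (sum-cong-≋ λ i → P.*-congˡ (gs≈gs′ i))))
    where open Sum P.semiring using (sum-cong-≋)

-- Algebras given by generators and relations

Relations : ℕ → Set₁
Relations n = (B : CRing) → Vector (Carrier B) n → Set

-- R is the K-algebra generated by the entries of gen, with relations Rel.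
record IsPresentation (K : CRing) {n} (Rel : Relations n) (R : CRing) : Set₁ where
  private module R = CommutativeRing R
  field
    scalarʰ      : K ⟶ R
    gen          : Vector (Carrier R) n
    relations    : Rel R gen
    induction    : ∀ {Q : Carrier R → Set} →
                   (∀ {p q} → p R.≈ q → Q p → Q q) →
                   (∀ {p q} → Q p → Q q → Q (p R.+ q)) →
                   (∀ {p q} → Q p → Q q → Q (p R.* q)) →
                   (∀ a → Q (⟦ scalarʰ ⟧ a)) → (∀ i → Q (gen i)) → ∀ r → Q r
    evalʰ        : ∀ {B} (φ : K ⟶ B) bs → Rel B bs → R ⟶ B
    evalʰ-scalar : ∀ {B} (let module B = CommutativeRing B) (φ : K ⟶ B) bs (rel : Rel B bs) →
                   ∀ a → ⟦ evalʰ φ bs rel ⟧ (⟦ scalarʰ ⟧ a) B.≈ ⟦ φ ⟧ a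
    evalʰ-gen    : ∀ {B} (let module B = CommutativeRing B) (φ : K ⟶ B) bs (rel : Rel B bs) →
                   ∀ i → ⟦ evalʰ φ bs rel ⟧ (gen i) B.≈ bs i

  module _ {B : CRing} where
    private module B = CommutativeRing B

    ⟶-ext : (f g : R ⟶ B) → (∀ a → ⟦ f ⟧ (⟦ scalarʰ ⟧ a) B.≈ ⟦ g ⟧ (⟦ scalarʰ ⟧ a)) →
      (∀ i → ⟦ f ⟧ (gen i) B.≈ ⟦ g ⟧ (gen i)) → ∀ r → ⟦ f ⟧ r B.≈ ⟦ g ⟧ r
    ⟶-ext f g f≈g-scalar f≈g-var = induction {λ r → ⟦ f ⟧ r B.≈ ⟦ g ⟧ r}
      (λ {p} {q} p≈q fp≈gp → B.trans (f.⟦⟧-cong (R.sym p≈q)) (B.trans fp≈gp (g.⟦⟧-cong p≈q)))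
      (λ {p} {q} e e′ → B.trans (f.+-homo p q) (B.trans (B.+-cong e e′) (B.sym (g.+-homo p q))))
      (λ {p} {q} e e′ → B.trans (f.*-homo p q) (B.trans (B.*-cong e e′) (B.sym (g.*-homo p q))))
      f≈g-scalar f≈g-var
      where
      module f = _⟶_ f
      module g = _⟶_ g

    -- The elements killed by `D` after `h` are closed under the ring operations, so only scalars
    -- and generators matter. A scalar is zero or a unit up to double negation, and `D` kills both;
    -- stability removes the double negation.
    derivation-vanishes : IsField K → IsDomain B → (h : R ⟶ B) (δ : Derivation B) (let open Derivation δ) → KillsUnits →
      (∀ i → D (⟦ h ⟧ (gen i)) B.≈ B.0#) → ∀ r → D (⟦ h ⟧ r) B.≈ B.0#
    derivation-vanishes isField dom h δ D-unit D-var = induction {λ r → D (⟦ h ⟧ r) B.≈ B.0#}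
      (λ {p} {q} p≈q e → B.trans (D-cong (h.⟦⟧-cong (R.sym p≈q))) e)
      (λ {p} {q} e e′ → B.trans (D-cong (h.+-homo p q)) (B.trans (D-+ _ _) (B.trans (B.+-cong e e′) (B.+-identityˡ _))))
      (λ {p} {q} e e′ → B.trans (D-cong (h.*-homo p q)) (D-*-0 e e′))
      (field-image (h ⊚ scalarʰ) {P = λ b → D b B.≈ B.0#} isField (IsDomain.stable dom)
        (λ b≈0 → B.trans (D-cong b≈0) D-0) D-unit)
      D-var
      where
      module h = _⟶_ h
      open Derivation δ

-- The two homomorphisms will be identity maps between definitions of one ring that are too costly to compare by conversion.
transport : ∀ {K n} {Rel : Relations n} {A B : CRing} (let module A = CommutativeRing A) (let module B = CommutativeRing B) →
  (∀ (h : A ⟶ B) as → Rel A as → Rel B (⟦ h ⟧ ∘ as)) →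
  (f : A ⟶ B) (g : B ⟶ A) → (∀ b → ⟦ f ⟧ (⟦ g ⟧ b) B.≈ b) → (∀ a → ⟦ g ⟧ (⟦ f ⟧ a) A.≈ a) →
  IsPresentation K Rel A → IsPresentation K Rel B
transport {A = A} {B} Rel-resp f g fg≈id gf≈id pres = record
  { scalarʰ      = f ⊚ scalarʰ
  ; gen          = ⟦ f ⟧ ∘ gen
  ; relations    = Rel-resp f gen relations
  ; induction    = λ {Q} resp +-closed *-closed Q-scalar Q-gen b → resp (fg≈id b) (induction {Q ∘ ⟦ f ⟧}
      (λ p≈q → resp (f.⟦⟧-cong p≈q))
      (λ {p} {q} Qp Qq → resp (B.sym (f.+-homo p q)) (+-closed Qp Qq))
      (λ {p} {q} Qp Qq → resp (B.sym (f.*-homo p q)) (*-closed Qp Qq))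
      Q-scalar Q-gen (⟦ g ⟧ b))
  ; evalʰ        = λ φ bs rel → evalʰ φ bs rel ⊚ g
  ; evalʰ-scalar = λ {C} φ bs rel a → CommutativeRing.trans C
      (_⟶_.⟦⟧-cong (evalʰ φ bs rel) (gf≈id (⟦ scalarʰ ⟧ a))) (evalʰ-scalar φ bs rel a)
  ; evalʰ-gen    = λ {C} φ bs rel i → CommutativeRing.trans C
      (_⟶_.⟦⟧-cong (evalʰ φ bs rel) (gf≈id (gen i))) (evalʰ-gen φ bs rel i)
  }
  where
  module A = CommutativeRing A
  module B = CommutativeRing B
  module f = _⟶_ f
  open IsPresentation pres

Free : ∀ {n} → Relations n
Free B bs = ⊤

[X]-isPresentation : ∀ K n → IsPresentation K (Free {n}) (K [X n ])
[X]-isPresentation K n = record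
  { scalarʰ      = [X]-scalarʰ K n
  ; gen          = var K
  ; relations    = tt
  ; induction    = [X]-induction K n
  ; evalʰ        = λ φ bs _ → [X]-evalʰ K φ n bs
  ; evalʰ-scalar = λ φ bs _ → [X]-evalʰ-scalar K φ n bs
  ; evalʰ-gen    = λ φ bs _ → [X]-evalʰ-var K φ n bs
  }

module _ {K P : CRing} {n k} (free : IsPresentation K (Free {n}) P)
  (gs : Vector (Carrier P) k) {Rel : Relations n}
  where
  open IsPresentation free

  -- Maps out of the quotient are maps out of the free algebra killing `gs`; the second hypothesis
  -- says that solutions of `Rel` give such maps. Induction is inherited, since the carrier is
  -- unchanged and equality only gets coarser.
  /-isPresentation : Rel (P / gs) gen →
    (∀ {B} (let module B = CommutativeRing B) (h : P ⟶ B) {bs} → (∀ i → ⟦ h ⟧ (gen i) B.≈ bs i) →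
      Rel B bs → ∀ j → ⟦ h ⟧ (gs j) B.≈ B.0#) →
    IsPresentation K Rel (P / gs)
  /-isPresentation rel rel⇒gs≈0 = record
    { scalarʰ      = projʰ ⊚ scalarʰ
    ; gen          = gen
    ; relations    = rel
    ; induction    = λ resp → induction (λ p≈q → resp (≈⇒≈/ p≈q))
    ; evalʰ        = λ φ bs rel → liftʰ (evalʰ φ bs tt) (rel⇒gs≈0 (evalʰ φ bs tt) (evalʰ-gen φ bs tt) rel)
    ; evalʰ-scalar = λ φ bs rel → evalʰ-scalar φ bs tt
    ; evalʰ-gen    = λ φ bs rel → evalʰ-gen φ bs tt
    }

-- The relations of the four rings

Rel₁ : Relations 2
Rel₁ B b = (b 1F - 1#) * (b 1F - b 0F) ≈ 0#
  where open CommutativeRing B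

Rel₂ : Relations 3
Rel₂ B b = (b 2F - b 0F) * (b 2F - b 1F) ≈ 0#
  where open CommutativeRing B

Rel₃ Rel₄ : ℕ → ℕ → Relations 3
Rel₃ m n B b = Rel₂ B b × b 1F ^ m ≈ b 0F ^ n
  where
  open CommutativeRing B
  open Exp semiring using (_^_)
Rel₄ m n B b = Rel₂ B b × b 0F ^ n * b 1F ^ m ≈ 1#
  where
  open CommutativeRing B
  open Exp semiring using (_^_)

module _ {A B : CRing} (h : A ⟶ B) where
  private
    module A = CommutativeRing A
    module B = CommutativeRing B
    module h = _⟶_ h

  ⟦⟧-differences≈0 : ∀ a b c → (a A.- b) A.* (a A.- c) A.≈ A.0# →
    (⟦ h ⟧ a B.- ⟦ h ⟧ b) B.* (⟦ h ⟧ a B.- ⟦ h ⟧ c) B.≈ B.0#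
  ⟦⟧-differences≈0 a b c e = B.trans (B.sym (⟦⟧-differences h a b c B.refl B.refl B.refl))
    (B.trans (h.⟦⟧-cong e) h.0#-homo)

  ⟦⟧-Rel₁ : ∀ as → Rel₁ A as → Rel₁ B (⟦ h ⟧ ∘ as)
  ⟦⟧-Rel₁ as e = B.trans (B.sym (⟦⟧-differences h (as 1F) A.1# (as 0F) B.refl h.1#-homo B.refl))
    (B.trans (h.⟦⟧-cong e) h.0#-homo)

  ⟦⟧-Rel₂ : ∀ as → Rel₂ A as → Rel₂ B (⟦ h ⟧ ∘ as)
  ⟦⟧-Rel₂ as = ⟦⟧-differences≈0 (as 2F) (as 0F) (as 1F)

  ⟦⟧-Rel₃ : ∀ m n as → Rel₃ m n A as → Rel₃ m n B (⟦ h ⟧ ∘ as)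
  ⟦⟧-Rel₃ m n as (e , e′) = ⟦⟧-Rel₂ as e ,
    B.trans (B.sym (⟦⟧-^ h (as 1F) m)) (B.trans (h.⟦⟧-cong e′) (⟦⟧-^ h (as 0F) n))

  ⟦⟧-Rel₄ : ∀ m n as → Rel₄ m n A as → Rel₄ m n B (⟦ h ⟧ ∘ as)
  ⟦⟧-Rel₄ m n as (e , e′) = ⟦⟧-Rel₂ as e ,
    B.trans (B.*-cong (B.sym (⟦⟧-^ h (as 0F) n)) (B.sym (⟦⟧-^ h (as 1F) m)))
      (B.trans (B.sym (h.*-homo _ _)) (B.trans (h.⟦⟧-cong e′) h.1#-homo))

module _ {K P : CRing} where
  open CommutativeRing P hiding (Carrier)
  open RingProperties using (x≈y⇒x∙y⁻¹≈ε; x∙y⁻¹≈ε⇒x≈y)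

  module _ (free : IsPresentation K (Free {2}) P) where
    private
      open IsPresentation free using (gen)
      x = gen 0F
      y = gen 1F

    gs₁ : Vector (Carrier P) 1
    gs₁ = (y - 1#) * (y - x) Vector.∷ Vector.[]

    R₁-isPresentation : IsPresentation K Rel₁ (P / gs₁)
    R₁-isPresentation = /-isPresentation free gs₁ (∈⇒≈/0 (generator∈ gs₁ 0F))
      λ {B} h e rel → λ { 0F → CommutativeRing.trans B
        (⟦⟧-differences h y 1# x (e 1F) (_⟶_.1#-homo h) (e 0F)) rel }

  module _ (free : IsPresentation K (Free {3}) P) where
    private
      open IsPresentation free using (gen)
      x = gen 0F
      y = gen 1F
      z = gen 2F
      open Exp semiring using (_^_)

    gs₂ : Vector (Carrier P) 1
    gs₂ = (z - x) * (z - y) Vector.∷ Vector.[]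

    gs₃ gs₄ : ℕ → ℕ → Vector (Carrier P) 2
    gs₃ m n = (z - x) * (z - y) Vector.∷ y ^ m - x ^ n Vector.∷ Vector.[]
    gs₄ m n = (z - x) * (z - y) Vector.∷ x ^ n * y ^ m - 1# Vector.∷ Vector.[]

    R₂-isPresentation : IsPresentation K Rel₂ (P / gs₂)
    R₂-isPresentation = /-isPresentation free gs₂ (∈⇒≈/0 (generator∈ gs₂ 0F))
      λ {B} h e rel → λ { 0F → CommutativeRing.trans B
        (⟦⟧-differences h z x y (e 2F) (e 0F) (e 1F)) rel }

    module _ (m n : ℕ) where

      R₃-isPresentation : IsPresentation K (Rel₃ m n) (P / gs₃ m n)
      R₃-isPresentation = /-isPresentation free (gs₃ m n)
        (∈⇒≈/0 (generator∈ (gs₃ m n) 0F) ,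
          Q.trans (Q.sym (⟦⟧-^ (projʰ {gs = gs₃ m n}) y m)) (Q.trans
            (x∙y⁻¹≈ε⇒x≈y Q.ring (y ^ m) (x ^ n) (∈⇒≈/0 (generator∈ (gs₃ m n) 1F))) (⟦⟧-^ (projʰ {gs = gs₃ m n}) x n)))
        λ {B} h e (rel , rel′) → let module B = CommutativeRing B in λ
          { 0F → B.trans (⟦⟧-differences h z x y (e 2F) (e 0F) (e 1F)) rel
          ; 1F → B.trans (⟦⟧-difference h (y ^ m) (x ^ n) (⟦⟧-^-cong h y m (e 1F)) (⟦⟧-^-cong h x n (e 0F)))
                   (x≈y⇒x∙y⁻¹≈ε B.ring rel′)
          }
        where
        module Q = CommutativeRing (P / gs₃ m n)

      R₄-isPresentation : IsPresentation K (Rel₄ m n) (P / gs₄ m n)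
      R₄-isPresentation = /-isPresentation free (gs₄ m n)
        (∈⇒≈/0 (generator∈ (gs₄ m n) 0F) ,
          Q.trans (Q.*-cong (Q.sym (⟦⟧-^ (projʰ {gs = gs₄ m n}) x n)) (Q.sym (⟦⟧-^ (projʰ {gs = gs₄ m n}) y m)))
            (x∙y⁻¹≈ε⇒x≈y Q.ring (x ^ n * y ^ m) 1# (∈⇒≈/0 (generator∈ (gs₄ m n) 1F))))
        λ {B} h e (rel , rel′) → let module B = CommutativeRing B in λ
          { 0F → B.trans (⟦⟧-differences h z x y (e 2F) (e 0F) (e 1F)) rel
          ; 1F → B.trans (⟦⟧-difference h (x ^ n * y ^ m) 1#
                     (B.trans (_⟶_.*-homo h _ _) (B.*-cong (⟦⟧-^-cong h x n (e 0F)) (⟦⟧-^-cong h y m (e 1F))))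
                     (_⟶_.1#-homo h))
                   (x≈y⇒x∙y⁻¹≈ε B.ring rel′)
          }
        where
        module Q = CommutativeRing (P / gs₄ m n)

-- Curves and planes

-- Records what the arguments use of `K[t]`: the universal property, and a derivation that kills
-- units but not `t`.
record IsAffineLine (K T : CRing) : Set₁ where
  private module T = CommutativeRing T
  field
    presentation : IsPresentation K (Free {1}) T
    isDomain     : IsDomain T
    char0        : CharacteristicZero T
    ∂            : Derivation T
    ∂-killsUnits : Derivation.KillsUnits ∂

  open IsPresentation presentation public
  open IsDomain isDomain public
  open Derivation ∂ public

  t : Carrier T
  t = gen 0F

  field
    Dt≉0 : ¬ (D t T.≈ T.0#)

record IsAffinePlane (K S : CRing) : Set₁ where
  private module S = CommutativeRing S
  field
    presentation  : IsPresentation K (Free {2}) S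
    isDomain      : IsDomain S
    char0         : CharacteristicZero S
    ∂₁ ∂₂         : Derivation S
    ∂₁-killsUnits : Derivation.KillsUnits ∂₁
    ∂₂-killsUnits : Derivation.KillsUnits ∂₂

  open IsPresentation presentation public
  open IsDomain isDomain public
  open Derivation ∂₁ public using () renaming (D to D₁)
  open Derivation ∂₂ public using () renaming (D to D₂)

  s : Carrier S
  s = gen 0F

  t : Carrier S
  t = gen 1F

  field
    D₁s≉0 : ¬ (D₁ s S.≈ S.0#)
    D₁t≈0 : D₁ t S.≈ S.0#
    D₂t≉0 : ¬ (D₂ t S.≈ S.0#)

module _ {K : CRing} (K-char0 : CharacteristicZero K) (isField : IsField K) where

  private
    module K = CommutativeRing K
    K-isDomain : IsDomain K
    K-isDomain = field⇒domain K-char0 isField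

  [X]-isDomain : ∀ n → IsDomain (K [X n ])
  [X]-isDomain zero    = K-isDomain
  [X]-isDomain (suc n) = DomainPolynomial.isDomain ([X]-isDomain n)

  [X]-characteristicZero : ∀ n → CharacteristicZero (K [X n ])
  [X]-characteristicZero zero    = K-char0
  [X]-characteristicZero (suc n) = polynomial-characteristicZero ([X]-characteristicZero n)

  [X]-isAffineLine : IsAffineLine K (K [X 1 ])
  [X]-isAffineLine = record
    { presentation = [X]-isPresentation K 1
    ; isDomain     = [X]-isDomain 1
    ; char0        = [X]-characteristicZero 1
    ; ∂            = derivative
    ; ∂-killsUnits = derivative-killsUnits K-isDomain
    ; Dt≉0         = λ e → IsDomain.1≉0 ([X]-isDomain 1) (P.trans (P.sym derivative-X) e)
    }
    where
    open PolynomialDerivations K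
    module P = CommutativeRing (K [X 1 ])

  [X]-isAffinePlane : IsAffinePlane K (K [X 2 ])
  [X]-isAffinePlane = record
    { presentation  = [X]-isPresentation K 2
    ; isDomain      = [X]-isDomain 2
    ; char0         = [X]-characteristicZero 2
    ; ∂₁            = derivative
    ; ∂₂            = coefficientwise ∂
    ; ∂₁-killsUnits = derivative-killsUnits ([X]-isDomain 1)
    ; ∂₂-killsUnits = coefficientwise-killsUnits ∂ ([X]-isDomain 1) ∂-killsUnits
    ; D₁s≉0         = λ e → IsDomain.1≉0 ([X]-isDomain 2) (P.trans (P.sym derivative-X) e)
    ; D₁t≈0         = derivative-const _
    ; D₂t≉0         = λ e → Dt≉0 (DomainPolynomial.const≈0⇒≈0 ([X]-isDomain 1)
        (P.trans (P.sym (coefficientwise-const ∂ t)) e))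
    }
    where
    open PolynomialDerivations (K [X 1 ])
    open IsAffineLine [X]-isAffineLine using (∂; ∂-killsUnits; t; Dt≉0)
    module P = CommutativeRing (K [X 2 ])

  -- Since both exponents are positive, `x` and `y` divide 1 and are killed as units; then `z` is
  -- killed through its quadratic relation.
  R₄-constant : ∀ {m n} .{{_ : ℕ.NonZero m}} .{{_ : ℕ.NonZero n}} {R B : CRing} → IsPresentation K (Rel₄ m n) R →
    IsDomain B → (h : R ⟶ B) (δ : Derivation B) → Derivation.KillsUnits δ →
    ∀ r → CommutativeRing._≈_ B (Derivation.D δ (⟦ h ⟧ r)) (CommutativeRing.0# B)
  R₄-constant {m} {n} {R} {B} pres dom h δ D-unit = derivation-vanishes isField dom h δ D-unit
    λ { 0F → Dx≈0 ; 1F → Dy≈0 ; 2F → D-differences dom δ (proj₁ rel) Dx≈0 Dy≈0 }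
    where
    open IsPresentation pres
    open CommutativeRing B hiding (Carrier)
    open Derivation δ
    rel = ⟦⟧-Rel₄ h m n gen relations
    Dx≈0 : D (⟦ h ⟧ (gen 0F)) ≈ 0#
    Dx≈0 = D-unit _ (power-invertible {B} n (_ , proj₂ rel))
    Dy≈0 : D (⟦ h ⟧ (gen 1F)) ≈ 0#
    Dy≈0 = D-unit _ (power-invertible {B} m (_ , trans (*-comm _ _) (proj₂ rel)))

  -- The derivations of B that vanish on h x vanish on the whole image of h: the transcendence degree is at most one.
  CurveIn : (R B : CRing) → Carrier R → Set
  CurveIn R B x = (h : R ⟶ B) (δ : Derivation B) (let open Derivation δ) →
    (let open CommutativeRing B using (_≈_; 0#)) → KillsUnits → D (⟦ h ⟧ x) ≈ 0# → ∀ r → D (⟦ h ⟧ r) ≈ 0#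

  module _ {R B : CRing} (dom : IsDomain B) where

    -- In the domain, `y` becomes 1 or `x`, and both are killed.
    R₁-curve : (pres : IsPresentation K Rel₁ R) → CurveIn R B (IsPresentation.gen pres 0F)
    R₁-curve pres h δ D-unit Dx≈0 = derivation-vanishes isField dom h δ D-unit
      λ { 0F → Dx≈0 ; 1F → D-differences dom δ (⟦⟧-Rel₁ h gen relations) (D-1 D-unit) Dx≈0 }
      where
      open IsPresentation pres
      open Derivation δ

    -- The derivative of `y ^ m = x ^ n` vanishes, so characteristic zero gives that of `y`; the
    -- value of `z` is that of `x` or `y`.
    R₃-curve : CharacteristicZero B → ∀ {m n} .{{_ : ℕ.NonZero m}} →
      (pres : IsPresentation K (Rel₃ m n) R) → CurveIn R B (IsPresentation.gen pres 0F)
    R₃-curve char0 {m} {n} pres h δ D-unit Dx≈0 = derivation-vanishes isField dom h δ D-unit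
      λ { 0F → Dx≈0 ; 1F → Dy≈0 ; 2F → D-differences dom δ (proj₁ rel) Dx≈0 Dy≈0 }
      where
      open IsPresentation pres
      open Derivation δ
      rel = ⟦⟧-Rel₃ h m n gen relations
      Dy≈0 = D-power-curve D-unit dom char0 _ _ m n (proj₂ rel) Dx≈0

  -- R₂ against R₁ and R₃: homomorphisms onto the plane

  module _ {S : CRing} (plane : IsAffinePlane K S) where

    open IsAffinePlane plane
    open CommutativeRing S hiding (Carrier)

    -- If X = h x, the derivation D₁X ∂₂ − D₂X ∂₁ kills X, hence t, so D₁X ≈ 0; then ∂₁ kills s.
    curve-not-onto-plane : ∀ {R} x → CurveIn R S x → (h : R ⟶ S) →
      (∃ λ r → ⟦ h ⟧ r ≈ s) → ¬ (∃ λ r → ⟦ h ⟧ r ≈ t)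
    curve-not-onto-plane x curve h (r , hr≈s) (r′ , hr′≈t) =
      D₁s≉0 (trans (Derivation.D-cong ∂₁ (sym hr≈s)) (curve h ∂₁ ∂₁-killsUnits D₁X≈0 r))
      where
      X = ⟦ h ⟧ x
      δ = linearCombination (D₁ X) ∂₂ (- D₂ X) ∂₁
      δ-killsUnits : Derivation.KillsUnits δ
      δ-killsUnits = linearCombination-killsUnits (D₁ X) ∂₂ (- D₂ X) ∂₁ ∂₂-killsUnits ∂₁-killsUnits
      open RingProperties ring using (-‿distribˡ-*)
      open SetoidReasoning setoid
      δX≈0 : D₁ X * D₂ X + - D₂ X * D₁ X ≈ 0#
      δX≈0 = begin
        D₁ X * D₂ X + - D₂ X * D₁ X         ≈⟨ +-cong (*-comm _ _) (sym (-‿distribˡ-* _ _)) ⟩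
        D₂ X * D₁ X - D₂ X * D₁ X           ≈⟨ -‿inverseʳ _ ⟩
        0#                                  ∎
      D₂t*D₁X≈0 : D₂ t * D₁ X ≈ 0#
      D₂t*D₁X≈0 = begin
        D₂ t * D₁ X                         ≈⟨ *-comm _ _ ⟩
        D₁ X * D₂ t                         ≈⟨ +-identityʳ _ ⟨
        D₁ X * D₂ t + 0#                    ≈⟨ +-congˡ (trans (*-congˡ D₁t≈0) (zeroʳ _)) ⟨
        D₁ X * D₂ t + - D₂ X * D₁ t         ≈⟨ Derivation.D-cong δ hr′≈t ⟨
        Derivation.D δ (⟦ h ⟧ r′)           ≈⟨ curve h δ δ-killsUnits δX≈0 r′ ⟩
        0#                                  ∎
      D₁X≈0 : D₁ X ≈ 0#
      D₁X≈0 = cancel D₂t*D₁X≈0 D₂t≉0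

    -- The point `(s, t, s)` lies on the component `z = x` of R₂, which is a plane; composing it
    -- with the isomorphism would make `R` map onto that plane.
    curve≇R₂ : ∀ {R R₂} (x : Carrier R) → CurveIn R S x → IsPresentation K Rel₂ R₂ → ¬ (R ≅ R₂)
    curve≇R₂ {R} {R₂} x curve pres R≅R₂ = curve-not-onto-plane x curve (h ⊚ ≅⇒⟶ R≅R₂) (onto 0F) (onto 1F)
      where
      module R₂ = IsPresentation pres
      bs : Vector (Carrier S) 3
      bs = s Vector.∷ t Vector.∷ s Vector.∷ Vector.[]
      rel : Rel₂ S bs
      rel = trans (*-congʳ (-‿inverseʳ s)) (zeroˡ _)
      h : R₂ ⟶ S
      h = R₂.evalʰ scalarʰ bs rel
      onto : ∀ i → ∃ λ r → ⟦ h ⟧ (⟦ ≅⇒⟶ {R} {R₂} R≅R₂ ⟧ r) ≈ bs i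
      onto i = ⟦ ≅⇒⟵ {R} {R₂} R≅R₂ ⟧ (R₂.gen i) ,
        trans (_⟶_.⟦⟧-cong h (≅-rightInverse {R} {R₂} R≅R₂ (R₂.gen i))) (R₂.evalʰ-gen scalarʰ bs rel i)

  -- Homomorphisms to the affine line, and R₄ against the others

  module _ {T : CRing} (line : IsAffineLine K T) where

    open IsAffineLine line
    private module T = CommutativeRing T
    open CommutativeRing T hiding (Carrier)
    open Exp semiring using (_^_; ^-assocʳ)
    open RingProperties ring using (x∙y⁻¹≈ε⇒x≈y; x≈y⇒x∙y⁻¹≈ε; x[y-z]≈xy-xz)
    open SetoidReasoning setoid

    NonconstantCurve : CRing → Set
    NonconstantCurve R = ∃ λ (h : R ⟶ T) → ∃ λ r → ¬ (D (⟦ h ⟧ r) ≈ 0#)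

    module _ {m n} .{{_ : ℕ.NonZero m}} .{{_ : ℕ.NonZero n}} {R R₄ : CRing} (pres₄ : IsPresentation K (Rel₄ m n) R₄) where

      R≇R₄ : NonconstantCurve R → ¬ (R ≅ R₄)
      R≇R₄ (h , r , Dhr≉0) R≅R₄ = Dhr≉0 (trans
        (D-cong (_⟶_.⟦⟧-cong h (R.sym (≅-leftInverse {R} {R₄} R≅R₄ r))))
        (R₄-constant pres₄ isDomain (h ⊚ ≅⇒⟵ {R} {R₄} R≅R₄) ∂ ∂-killsUnits (⟦ ≅⇒⟶ {R} {R₄} R≅R₄ ⟧ r)))
        where module R = CommutativeRing R

    ev : Carrier K → T ⟶ K
    ev c = evalʰ idʰ (c Vector.∷ Vector.[]) tt

    ev-t : ∀ c → ⟦ ev c ⟧ t K.≈ c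
    ev-t c = evalʰ-gen idʰ (c Vector.∷ Vector.[]) tt 0F

    open Exp K.semiring using () renaming (_^_ to _^ᴷ_)

    ev₀-tⁿ : ∀ n .{{_ : ℕ.NonZero n}} → ⟦ ev K.0# ⟧ (t ^ n) K.≈ K.0#
    ev₀-tⁿ (suc n) = K.trans (⟦⟧-^-cong (ev K.0#) t (suc n) (ev-t K.0#)) (K.zeroˡ _)

    ev₁-tⁿ : ∀ n → ⟦ ev K.1# ⟧ (t ^ n) K.≈ K.1#
    ev₁-tⁿ n = K.trans (⟦⟧-^-cong (ev K.1#) t n (ev-t K.1#)) (1ⁿ≈1 n)
      where
      1ⁿ≈1 : ∀ n → K.1# ^ᴷ n K.≈ K.1#
      1ⁿ≈1 zero    = K.refl
      1ⁿ≈1 (suc n) = K.trans (K.*-identityˡ _) (1ⁿ≈1 n)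

    t≉0 : ¬ (t ≈ 0#)
    t≉0 t≈0 = Dt≉0 (trans (D-cong t≈0) D-0)

    *-cancelˡ-≈ : ∀ {a b c} → ¬ (a ≈ 0#) → a * b ≈ a * c → b ≈ c
    *-cancelˡ-≈ {a} {b} {c} a≉0 ab≈ac = x∙y⁻¹≈ε⇒x≈y b c
      (cancel (trans (x[y-z]≈xy-xz a b c) (x≈y⇒x∙y⁻¹≈ε ab≈ac)) a≉0)

    1≉tⁿ : ∀ n .{{_ : ℕ.NonZero n}} → ¬ (1# ≈ t ^ n)
    1≉tⁿ n 1≈tⁿ = IsDomain.1≉0 K-isDomain
      (K.trans (K.sym (_⟶_.1#-homo (ev K.0#))) (K.trans (_⟶_.⟦⟧-cong (ev K.0#) 1≈tⁿ) (ev₀-tⁿ n)))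

    t^-injective : ∀ m n → t ^ m ≈ t ^ n → m ≡ n
    t^-injective zero    zero    e = ≡.refl
    t^-injective zero    (suc n) e = contradiction e (1≉tⁿ (suc n))
    t^-injective (suc m) zero    e = contradiction (sym e) (1≉tⁿ (suc m))
    t^-injective (suc m) (suc n) e = ≡.cong suc (t^-injective m n (*-cancelˡ-≈ t≉0 e))

    R₂-nonconstantCurve : ∀ {R₂} → IsPresentation K Rel₂ R₂ → NonconstantCurve R₂
    R₂-nonconstantCurve pres = R₂.evalʰ scalarʰ bs rel , R₂.gen 0F , λ e →
      Dt≉0 (trans (D-cong (sym (R₂.evalʰ-gen scalarʰ bs rel 0F))) e)
      where
      module R₂ = IsPresentation pres
      bs : Vector (Carrier T) 3
      bs = λ _ → t
      rel : Rel₂ T bs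
      rel = trans (*-congʳ (-‿inverseʳ t)) (zeroˡ _)

    module _ {m n} .{{_ : ℕ.NonZero m}} .{{_ : ℕ.NonZero n}} {R₃ : CRing} (pres₃ : IsPresentation K (Rel₃ m n) R₃) where

      private
        module P₃ = IsPresentation pres₃
        x₃ = P₃.gen 0F

      module Branch (v : Carrier T) (v-branch : (v - t ^ m) * (v - t ^ n) ≈ 0#) where

        bs : Vector (Carrier T) 3
        bs = t ^ m Vector.∷ t ^ n Vector.∷ v Vector.∷ Vector.[]

        rel : Rel₃ m n T bs
        rel = v-branch , (begin
          (t ^ n) ^ m     ≈⟨ ^-assocʳ t n m ⟩
          t ^ (n ℕ.* m)   ≡⟨ ≡.cong (t ^_) (ℕ.*-comm n m) ⟩
          t ^ (m ℕ.* n)   ≈⟨ ^-assocʳ t m n ⟨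
          (t ^ m) ^ n     ∎)

        π : R₃ ⟶ T
        π = P₃.evalʰ scalarʰ bs rel

        π-gen : ∀ i → ⟦ π ⟧ (P₃.gen i) ≈ bs i
        π-gen = P₃.evalʰ-gen scalarʰ bs rel

      module FirstBranch = Branch (t ^ m) (trans (*-congʳ (-‿inverseʳ _)) (zeroˡ _))
      module SecondBranch = Branch (t ^ n) (trans (*-congˡ (-‿inverseʳ _)) (zeroʳ _))

      R₃-nonconstantCurve : NonconstantCurve R₃
      R₃-nonconstantCurve = FirstBranch.π , x₃ , λ e →
        Dt≉0 (D-^≈0⇒D≈0 ∂-killsUnits isDomain char0 t m (trans (D-cong (sym (FirstBranch.π-gen 0F))) e))

      -- The two branches differ only in the value of `z`, which is `t ^ m` on one and `t ^ n` on
      -- the other, and these agree at `c`.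
      branches-meet : ∀ c → ⟦ ev c ⟧ (t ^ m) K.≈ ⟦ ev c ⟧ (t ^ n) →
        ∀ r → ⟦ ev c ⟧ (⟦ FirstBranch.π ⟧ r) K.≈ ⟦ ev c ⟧ (⟦ SecondBranch.π ⟧ r)
      branches-meet c e = P₃.⟶-ext (ev c ⊚ FirstBranch.π) (ev c ⊚ SecondBranch.π)
        (λ a → ev.⟦⟧-cong (trans (P₃.evalʰ-scalar scalarʰ _ FirstBranch.rel a) (sym (P₃.evalʰ-scalar scalarʰ _ SecondBranch.rel a))))
        λ { 0F → ev.⟦⟧-cong (trans (FirstBranch.π-gen 0F) (sym (SecondBranch.π-gen 0F)))
          ; 1F → ev.⟦⟧-cong (trans (FirstBranch.π-gen 1F) (sym (SecondBranch.π-gen 1F)))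
          ; 2F → K.trans (ev.⟦⟧-cong (FirstBranch.π-gen 2F)) (K.trans e (ev.⟦⟧-cong (sym (SecondBranch.π-gen 2F)))) }
        where module ev = _⟶_ (ev c)

    -- The two lines of R₁, and R₁ against R₃

    module _ {R₁ : CRing} (pres₁ : IsPresentation K Rel₁ R₁) where

      private
        module R₁ = CommutativeRing R₁
        module P₁ = IsPresentation pres₁
        x₁ = P₁.gen 0F
        y₁ = P₁.gen 1F

      -- The component y = v of R₁, for v = 1 or v = t.
      module Component (v : Carrier T) (v-branch : (v - 1#) * (v - t) ≈ 0#) where

        bs : Vector (Carrier T) 2
        bs = t Vector.∷ v Vector.∷ Vector.[]

        ρ : R₁ ⟶ T
        ρ = P₁.evalʰ scalarʰ bs v-branch

        ι : T ⟶ R₁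
        ι = evalʰ P₁.scalarʰ (x₁ Vector.∷ Vector.[]) tt

        ι-t : ⟦ ι ⟧ t R₁.≈ x₁
        ι-t = evalʰ-gen P₁.scalarʰ (x₁ Vector.∷ Vector.[]) tt 0F

        ρ-x : ⟦ ρ ⟧ x₁ ≈ t
        ρ-x = P₁.evalʰ-gen scalarʰ bs v-branch 0F

        ρ-y : ⟦ ρ ⟧ y₁ ≈ v
        ρ-y = P₁.evalʰ-gen scalarʰ bs v-branch 1F

        -- The composite of `ρ` and `ι` fixes scalars and `x` and replaces `y` by `v`, so a
        -- homomorphism that identifies `y` with `v` does not notice it.
        factors : ∀ {B : CRing} (let module B = CommutativeRing B) (f : R₁ ⟶ B) →
          ⟦ f ⟧ y₁ B.≈ ⟦ f ⟧ (⟦ ι ⟧ v) → ∀ r → ⟦ f ⟧ r B.≈ ⟦ f ⟧ (⟦ ι ⟧ (⟦ ρ ⟧ r))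
        factors {B} f fy≈fιv = P₁.⟶-ext f (f ⊚ ι ⊚ ρ)
          (λ a → f.⟦⟧-cong (R₁.sym (R₁.trans (ι.⟦⟧-cong (P₁.evalʰ-scalar scalarʰ bs v-branch a))
            (evalʰ-scalar P₁.scalarʰ (x₁ Vector.∷ Vector.[]) tt a))))
          (λ { 0F → f.⟦⟧-cong (R₁.sym (R₁.trans (ι.⟦⟧-cong ρ-x) ι-t))
             ; 1F → B.trans fy≈fιv (f.⟦⟧-cong (ι.⟦⟧-cong (sym ρ-y))) })
          where
          module B = CommutativeRing B
          module f = _⟶_ f
          module ι = _⟶_ ι

        kernel-vanishes : ∀ {B : CRing} (let module B = CommutativeRing B) (f : R₁ ⟶ B) →
          ⟦ f ⟧ y₁ B.≈ ⟦ f ⟧ (⟦ ι ⟧ v) → ∀ r → ⟦ ρ ⟧ r ≈ 0# → ⟦ f ⟧ r B.≈ B.0#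
        kernel-vanishes {B} f fy≈fιv r ρr≈0 = B.trans (factors f fy≈fιv r)
          (B.trans (_⟶_.⟦⟧-cong (f ⊚ ι) ρr≈0) (_⟶_.0#-homo (f ⊚ ι)))
          where module B = CommutativeRing B

        -- Take the projection modulo `y − v` as the map in `kernel-vanishes`: elements of the
        -- kernel become zero there.
        kernel-principal : ∀ r → ⟦ ρ ⟧ r ≈ 0# → ∃ λ a → r R₁.≈ a R₁.* (y₁ R₁.- ⟦ ι ⟧ v)
        kernel-principal r ρr≈0 = ∈principal {R₁} (kernel-vanishes π y≈ιv r ρr≈0)
          where
          g : Carrier R₁
          g = y₁ R₁.- ⟦ ι ⟧ v
          π : R₁ ⟶ R₁ / principal {R₁} g
          π = projʰ
          y≈ιv : CommutativeRing._≈_ (R₁ / principal {R₁} g) y₁ (⟦ ι ⟧ v)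
          y≈ιv = RingProperties.x∙y⁻¹≈ε⇒x≈y (CommutativeRing.ring (R₁ / principal {R₁} g)) y₁ (⟦ ι ⟧ v) (principal≈0 {R₁} g)

      1-branch : (1# - 1#) * (1# - t) ≈ 0#
      1-branch = trans (*-congʳ (-‿inverseʳ 1#)) (zeroˡ _)

      t-branch : (t - 1#) * (t - t) ≈ 0#
      t-branch = trans (*-congˡ (-‿inverseʳ t)) (zeroʳ _)

      module Horizontal = Component 1# 1-branch
      module Diagonal = Component t t-branch

      R₁-nonconstantCurve : NonconstantCurve R₁
      R₁-nonconstantCurve = Diagonal.ρ , x₁ , λ e → Dt≉0 (trans (D-cong (sym Diagonal.ρ-x)) e)

      t≉1 : ¬ (t - 1# ≈ 0#)
      t≉1 t-1≈0 = 1≉tⁿ 1 (trans (sym (x∙y⁻¹≈ε⇒x≈y t 1# t-1≈0)) (sym (*-identityʳ t)))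

      square≈0⇒≈0 : (ρ : R₁ ⟶ T) → ∀ r → r R₁.* r R₁.≈ R₁.0# → ⟦ ρ ⟧ r ≈ 0#
      square≈0⇒≈0 ρ r r²≈0 = stable-cases (⟦ ρ ⟧ r) id
        (cancel (trans (sym (ρ.*-homo r r)) (trans (ρ.⟦⟧-cong r²≈0) ρ.0#-homo)))
        where module ρ = _⟶_ ρ

      -- r vanishes on y = 1, so r = a (y − 1); as t − 1 is not a zero divisor, a vanishes on y = x.
      R₁-reduced : ∀ r → r R₁.* r R₁.≈ R₁.0# → r R₁.≈ R₁.0#
      R₁-reduced r r²≈0 = vanishes (Horizontal.kernel-principal r (square≈0⇒≈0 Horizontal.ρ r r²≈0))
        where
        module ρ = _⟶_ Diagonal.ρ
        y-ι1≈y-1 : y₁ R₁.- ⟦ Horizontal.ι ⟧ 1# R₁.≈ y₁ R₁.- R₁.1#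
        y-ι1≈y-1 = R₁.+-congˡ (R₁.-‿cong (_⟶_.1#-homo Horizontal.ι))
        y-ιt≈y-x : y₁ R₁.- ⟦ Diagonal.ι ⟧ t R₁.≈ y₁ R₁.- x₁
        y-ιt≈y-x = R₁.+-congˡ (R₁.-‿cong Diagonal.ι-t)

        ρa≈0 : ∀ a → r R₁.≈ a R₁.* (y₁ R₁.- R₁.1#) → ⟦ Diagonal.ρ ⟧ a ≈ 0#
        ρa≈0 a r≈a[y-1] = cancel (begin
          (t - 1#) * ⟦ Diagonal.ρ ⟧ a                      ≈⟨ *-comm _ _ ⟩
          ⟦ Diagonal.ρ ⟧ a * (t - 1#)                      ≈⟨ *-congˡ (⟦⟧-difference Diagonal.ρ y₁ R₁.1# Diagonal.ρ-y ρ.1#-homo) ⟨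
          ⟦ Diagonal.ρ ⟧ a * ⟦ Diagonal.ρ ⟧ (y₁ R₁.- R₁.1#)  ≈⟨ ρ.*-homo a (y₁ R₁.- R₁.1#) ⟨
          ⟦ Diagonal.ρ ⟧ (a R₁.* (y₁ R₁.- R₁.1#))          ≈⟨ ρ.⟦⟧-cong r≈a[y-1] ⟨
          ⟦ Diagonal.ρ ⟧ r                                 ≈⟨ square≈0⇒≈0 Diagonal.ρ r r²≈0 ⟩
          0#                                               ∎) t≉1

        -- Now `r = b (y − x) (y − 1)`, a multiple of the relation of R₁.
        multiple≈0 : ∀ a b → r R₁.≈ a R₁.* (y₁ R₁.- R₁.1#) → a R₁.≈ b R₁.* (y₁ R₁.- x₁) → r R₁.≈ R₁.0#
        multiple≈0 a b r≈a[y-1] a≈b[y-x] = R₁.trans r≈a[y-1] (R₁.trans (R₁.*-congʳ a≈b[y-x])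
          (R₁.trans (R₁.*-assoc b (y₁ R₁.- x₁) (y₁ R₁.- R₁.1#))
            (R₁.trans (R₁.*-congˡ (R₁.trans (R₁.*-comm (y₁ R₁.- x₁) (y₁ R₁.- R₁.1#)) P₁.relations)) (R₁.zeroʳ b))))

        vanishes : (∃ λ a → r R₁.≈ a R₁.* (y₁ R₁.- ⟦ Horizontal.ι ⟧ 1#)) → r R₁.≈ R₁.0#
        vanishes (a , r≈a[y-ι1]) = vanishes′ (Diagonal.kernel-principal a (ρa≈0 a r≈a[y-1]))
          where
          r≈a[y-1] : r R₁.≈ a R₁.* (y₁ R₁.- R₁.1#)
          r≈a[y-1] = R₁.trans r≈a[y-ι1] (R₁.*-congˡ y-ι1≈y-1)
          vanishes′ : (∃ λ b → a R₁.≈ b R₁.* (y₁ R₁.- ⟦ Diagonal.ι ⟧ t)) → r R₁.≈ R₁.0#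
          vanishes′ (b , a≈b[y-ιt]) = multiple≈0 a b r≈a[y-1] (R₁.trans a≈b[y-ιt] (R₁.*-congˡ y-ιt≈y-x))

      -- The point `(1, 1)`, where the lines `y = 1` and `y = x` cross.
      node : R₁ ⟶ K
      node = P₁.evalʰ idʰ (λ _ → K.1#) (K.trans (K.*-congʳ (K.-‿inverseʳ K.1#)) (K.zeroˡ _))

      -- E is not assumed to be K-linear, so it still acts on the value at the node.
      through-node : (E : R₁ ⟶ K) → ⟦ E ⟧ x₁ K.≈ K.1# → ⟦ E ⟧ y₁ K.≈ K.1# →
        ∀ r → ⟦ E ⟧ r K.≈ ⟦ E ⟧ (⟦ P₁.scalarʰ ⟧ (⟦ node ⟧ r))
      through-node E Ex≈1 Ey≈1 = P₁.⟶-ext E (E ⊚ P₁.scalarʰ ⊚ node)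
        (λ a → ES.⟦⟧-cong (K.sym (P₁.evalʰ-scalar idʰ _ _ a)))
        λ { 0F → K.trans Ex≈1 (1≈node 0F) ; 1F → K.trans Ey≈1 (1≈node 1F) }
        where
        module ES = _⟶_ (E ⊚ P₁.scalarʰ)
        1≈node : ∀ i → K.1# K.≈ ES.⟦ ⟦ node ⟧ (P₁.gen i) ⟧
        1≈node i = K.sym (K.trans (ES.⟦⟧-cong (P₁.evalʰ-gen idʰ _ _ i)) ES.1#-homo)

      -- Both maps apply an endomorphism of `K` to the value of `r` at the node. Such an
      -- endomorphism preserves units, so `E₀ r = 0` forces that value to be zero, and then
      -- `E₁ r = 0`.
      components-cross-once : (E₀ E₁ : R₁ ⟶ K) →
        ⟦ E₀ ⟧ x₁ K.≈ K.1# → ⟦ E₀ ⟧ y₁ K.≈ K.1# → ⟦ E₁ ⟧ x₁ K.≈ K.1# → ⟦ E₁ ⟧ y₁ K.≈ K.1# →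
        ∀ r → ⟦ E₀ ⟧ r K.≈ K.0# → ¬ (⟦ E₁ ⟧ r K.≈ K.1#)
      components-cross-once E₀ E₁ E₀x E₀y E₁x E₁y r E₀r≈0 E₁r≈1 = IsDomain.1≉0 K-isDomain (K.trans (K.sym E₁r≈1)
        (K.trans (through-node E₁ E₁x E₁y r) (K.trans (ES₁.⟦⟧-cong node-r≈0) ES₁.0#-homo)))
        where
        module ES₁ = _⟶_ (E₁ ⊚ P₁.scalarʰ)
        node-r≈0 : ⟦ node ⟧ r K.≈ K.0#
        node-r≈0 = isField (⟦ node ⟧ r) λ inv →
          unit≉0 K-isDomain (⟦⟧-invertible (E₀ ⊚ P₁.scalarʰ) inv) (K.trans (K.sym (through-node E₀ E₀x E₀y r)) E₀r≈0)

      module _ {m n} .{{_ : ℕ.NonZero m}} .{{_ : ℕ.NonZero n}} {R₃ : CRing} (pres₃ : IsPresentation K (Rel₃ m n) R₃)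
        (R₁≅R₃ : R₁ ≅ R₃)
        where

        private
          module R₃ = CommutativeRing R₃
          module P₃ = IsPresentation pres₃
          x₃ = P₃.gen 0F
          y₃ = P₃.gen 1F
          z₃ = P₃.gen 2F
          module Branch₁ = FirstBranch pres₃
          module Branch₂ = SecondBranch pres₃

        φ : R₁ ⟶ R₃
        φ = ≅⇒⟶ R₁≅R₃

        ψ : R₃ ⟶ R₁
        ψ = ≅⇒⟵ R₁≅R₃

        φψ : ∀ r → ⟦ φ ⟧ (⟦ ψ ⟧ r) R₃.≈ r
        φψ = ≅-rightInverse {R₁} {R₃} R₁≅R₃

        -- The two common points t = 0 and t = 1 of f and g both lie over the node of R₁, but ψ x₃ tells them apart.
        distinct-components : (f g : R₁ ⟶ T) → (∀ c → ⟦ ev c ⟧ (t ^ m) K.≈ ⟦ ev c ⟧ (t ^ n) →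
            ∀ r → ⟦ ev c ⟧ (⟦ f ⟧ r) K.≈ ⟦ ev c ⟧ (⟦ g ⟧ r)) →
          (∀ c → ⟦ ev c ⟧ (⟦ f ⟧ (⟦ ψ ⟧ x₃)) K.≈ ⟦ ev c ⟧ (t ^ m)) →
          ⟦ f ⟧ y₁ ≈ 1# → ¬ (⟦ g ⟧ y₁ ≈ ⟦ g ⟧ x₁)
        distinct-components f g meet fx fy≈1 gy≈gx = components-cross-once (ev K.0# ⊚ f) (ev K.1# ⊚ f)
          (Ex≈1 K.0# meet₀) (Ey≈1 K.0#) (Ex≈1 K.1# meet₁) (Ey≈1 K.1#) (⟦ ψ ⟧ x₃)
          (K.trans (fx K.0#) (ev₀-tⁿ m)) (K.trans (fx K.1#) (ev₁-tⁿ m))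
          where
          Ey≈1 : ∀ c → ⟦ ev c ⟧ (⟦ f ⟧ y₁) K.≈ K.1#
          Ey≈1 c = K.trans (_⟶_.⟦⟧-cong (ev c) fy≈1) (_⟶_.1#-homo (ev c))
          -- At a common point the values satisfy `f x = g x = g y = f y = 1`.
          Ex≈1 : ∀ c → ⟦ ev c ⟧ (t ^ m) K.≈ ⟦ ev c ⟧ (t ^ n) → ⟦ ev c ⟧ (⟦ f ⟧ x₁) K.≈ K.1#
          Ex≈1 c e = K.trans (meet c e x₁) (K.trans (_⟶_.⟦⟧-cong (ev c) (sym gy≈gx)) (K.trans (K.sym (meet c e y₁)) (Ey≈1 c)))
          meet₀ = K.trans (ev₀-tⁿ m) (K.sym (ev₀-tⁿ n))
          meet₁ = K.trans (ev₁-tⁿ m) (K.sym (ev₁-tⁿ n))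

        -- Both branches factor through the line y = v; its coordinate ring is a domain, so z − x or z − y vanishes on both.
        same-component : ¬ (m ≡ n) → (v : Carrier T) (v-branch : (v - 1#) * (v - t) ≈ 0#)
          (let open Component v v-branch) →
          ⟦ Branch₁.π ⟧ (⟦ φ ⟧ y₁) ≈ ⟦ Branch₁.π ⟧ (⟦ φ ⟧ (⟦ ι ⟧ v)) →
          ¬ (⟦ Branch₂.π ⟧ (⟦ φ ⟧ y₁) ≈ ⟦ Branch₂.π ⟧ (⟦ φ ⟧ (⟦ ι ⟧ v)))
        -- Refutes both cases for `z − x` vanishing on the line. If it does, `z = x` on the second
        -- branch, so `t ^ n = t ^ m`. If not, `z − y` does, so `z = y` on the first branch and
        -- `t ^ m = t ^ n`.
        same-component m≢n v v-branch e₁ e₂ = contradiction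
          (λ e → m≢n (t^-injective m n (sym (trans (sym (Branch₂.π-gen 2F))
            (trans (vanish Branch₂.π e₂ z₃ x₃ e) (Branch₂.π-gen 0F))))))
          (λ ne → m≢n (t^-injective m n (trans (sym (Branch₁.π-gen 2F))
            (trans (vanish Branch₁.π e₁ z₃ y₃ (cancel [z-x][z-y]≈0 ne)) (Branch₁.π-gen 1F)))))
          where
          open Component v v-branch
          ρψ = ρ ⊚ ψ
          module ρψ = _⟶_ ρψ
          [z-x][z-y]≈0 : ⟦ ρψ ⟧ (z₃ R₃.- x₃) * ⟦ ρψ ⟧ (z₃ R₃.- y₃) ≈ 0#
          [z-x][z-y]≈0 = trans (sym (ρψ.*-homo _ _)) (trans (ρψ.⟦⟧-cong (proj₁ P₃.relations)) ρψ.0#-homo)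
          vanish : (π : R₃ ⟶ T) → ⟦ π ⟧ (⟦ φ ⟧ y₁) ≈ ⟦ π ⟧ (⟦ φ ⟧ (⟦ ι ⟧ v)) →
            ∀ a b → ⟦ ρψ ⟧ (a R₃.- b) ≈ 0# → ⟦ π ⟧ a ≈ ⟦ π ⟧ b
          vanish π e a b ρψ[a-b]≈0 = x∙y⁻¹≈ε⇒x≈y _ _ (trans (sym (⟦⟧-minus π a b))
            (trans (_⟶_.⟦⟧-cong π (R₃.sym (φψ (a R₃.- b)))) (kernel-vanishes (π ⊚ φ) e (⟦ ψ ⟧ (a R₃.- b)) ρψ[a-b]≈0)))

        -- Splits on whether `y₁ − 1` vanishes on each branch; where it does not, the relation of R₁
        -- gives `y = x`, since `T` is a domain. The splits are legitimate because the goal is a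
        -- contradiction.
        R₁≅R₃⇒m≡n : ¬ ¬ (m ≡ n)
        R₁≅R₃⇒m≡n m≢n = contradiction
            (λ f₁y≈1 → contradiction
              (λ f₂y≈1 → same-component m≢n 1# 1-branch (horizontal Branch₁.π f₁y≈1) (horizontal Branch₂.π f₂y≈1))
              (λ f₂y≉1 → distinct-components (Branch₁.π ⊚ φ) (Branch₂.π ⊚ φ)
                (λ c e r → branches-meet pres₃ c e (⟦ φ ⟧ r)) (λ c → _⟶_.⟦⟧-cong (ev c) (at-x Branch₁.π (Branch₁.π-gen 0F)))
                (x∙y⁻¹≈ε⇒x≈y _ _ f₁y≈1) (diagonal Branch₂.π f₂y≉1)))
            (λ f₁y≉1 → contradiction
              (λ f₂y≈1 → distinct-components (Branch₂.π ⊚ φ) (Branch₁.π ⊚ φ)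
                (λ c e r → K.sym (branches-meet pres₃ c e (⟦ φ ⟧ r))) (λ c → _⟶_.⟦⟧-cong (ev c) (at-x Branch₂.π (Branch₂.π-gen 0F)))
                (x∙y⁻¹≈ε⇒x≈y _ _ f₂y≈1) (diagonal Branch₁.π f₁y≉1))
              (λ f₂y≉1 → same-component m≢n t t-branch
                (trans (diagonal Branch₁.π f₁y≉1) (_⟶_.⟦⟧-cong (Branch₁.π ⊚ φ) (R₁.sym Diagonal.ι-t)))
                (trans (diagonal Branch₂.π f₂y≉1) (_⟶_.⟦⟧-cong (Branch₂.π ⊚ φ) (R₁.sym Diagonal.ι-t)))))
          where
          at-x : (π : R₃ ⟶ T) → ⟦ π ⟧ x₃ ≈ t ^ m → ⟦ π ⟧ (⟦ φ ⟧ (⟦ ψ ⟧ x₃)) ≈ t ^ m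
          at-x π πx≈tᵐ = trans (_⟶_.⟦⟧-cong π (φψ x₃)) πx≈tᵐ
          horizontal : (π : R₃ ⟶ T) → ⟦ π ⟧ (⟦ φ ⟧ y₁) - 1# ≈ 0# →
            ⟦ π ⟧ (⟦ φ ⟧ y₁) ≈ ⟦ π ⟧ (⟦ φ ⟧ (⟦ Horizontal.ι ⟧ 1#))
          horizontal π e = trans (x∙y⁻¹≈ε⇒x≈y _ _ e) (sym (_⟶_.1#-homo (π ⊚ φ ⊚ Horizontal.ι)))
          diagonal : (π : R₃ ⟶ T) → ¬ (⟦ π ⟧ (⟦ φ ⟧ y₁) - 1# ≈ 0#) → ⟦ π ⟧ (⟦ φ ⟧ y₁) ≈ ⟦ π ⟧ (⟦ φ ⟧ x₁)
          diagonal π ne = x∙y⁻¹≈ε⇒x≈y _ _ (cancel (⟦⟧-Rel₁ (π ⊚ φ) P₁.gen P₁.relations) ne)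

    -- The exponents m = n = 1: a nonzero nilpotent

    module _ {R₃ : CRing} (pres₃ : IsPresentation K (Rel₃ 1 1) R₃) where

      private
        module R₃ = CommutativeRing R₃
        module P₃ = IsPresentation pres₃
        x₃ = P₃.gen 0F
        y₃ = P₃.gen 1F
        z₃ = P₃.gen 2F

      [z-x]²≈0 : (z₃ R₃.- x₃) R₃.* (z₃ R₃.- x₃) R₃.≈ R₃.0#
      [z-x]²≈0 = R₃.trans (R₃.*-congˡ (R₃.+-congˡ (R₃.-‿cong x≈y))) (proj₁ P₃.relations)
        where
        x≈y : x₃ R₃.≈ y₃
        x≈y = R₃.trans (R₃.sym (R₃.*-identityʳ x₃)) (R₃.trans (R₃.sym (proj₂ P₃.relations)) (R₃.*-identityʳ y₃))

      private
        module Q = CommutativeRing (T / principal {T} (t * t))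
        bs : Vector (Carrier T) 3
        bs = 0# Vector.∷ 0# Vector.∷ t Vector.∷ Vector.[]
        t-0≈t : t - 0# ≈ t
        t-0≈t = trans (+-congˡ (RingProperties.-0#≈0# ring)) (+-identityʳ t)
        rel : Rel₃ 1 1 (T / principal {T} (t * t)) bs
        rel = Q.trans (≈⇒≈/ (*-cong t-0≈t t-0≈t)) (principal≈0 {T} (t * t)) , Q.refl

      -- At the point `(0, 0, t)` over the dual numbers `K[t]/(t²)` the element takes the value `t`.
      -- If `t` were a multiple of `t * t`, cancelling `t` and evaluating at 0 would give `1 = 0`.
      z-x≉0 : ¬ (z₃ R₃.- x₃ R₃.≈ R₃.0#)
      z-x≉0 z-x≈0 = t∉t² (∈principal {T} (Q.trans (Q.sym (h-gen 2F))
        (Q.trans (_⟶_.⟦⟧-cong h (RingProperties.x∙y⁻¹≈ε⇒x≈y R₃.ring z₃ x₃ z-x≈0)) (h-gen 0F))))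
        where
        π : T ⟶ T / principal {T} (t * t)
        π = projʰ
        h : R₃ ⟶ T / principal {T} (t * t)
        h = P₃.evalʰ (π ⊚ scalarʰ) bs rel
        h-gen : ∀ i → ⟦ h ⟧ (P₃.gen i) Q.≈ bs i
        h-gen = P₃.evalʰ-gen (π ⊚ scalarʰ) bs rel
        open CommutativeSemigroupProperties *-commutativeSemigroup using (x∙yz≈y∙zx)
        1≉tc : ∀ c → ¬ (1# ≈ t * c)
        1≉tc c 1≈tc = IsDomain.1≉0 K-isDomain (K.trans (K.sym ev₀.1#-homo) (K.trans (ev₀.⟦⟧-cong 1≈tc)
          (K.trans (ev₀.*-homo t c) (K.trans (K.*-congʳ (ev-t K.0#)) (K.zeroˡ _)))))
          where module ev₀ = _⟶_ (ev K.0#)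
        t∉t² : ¬ (∃ λ c → t ≈ c * (t * t))
        t∉t² (c , t≈ct²) = 1≉tc c (*-cancelˡ-≈ t≉0 (begin
          t * 1#           ≈⟨ *-identityʳ t ⟩
          t                ≈⟨ t≈ct² ⟩
          c * (t * t)      ≈⟨ x∙yz≈y∙zx c t t ⟩
          t * (t * c)      ∎))

      R₁≇R₃-1-1 : ∀ {R₁} → IsPresentation K Rel₁ R₁ → ¬ (R₁ ≅ R₃)
      R₁≇R₃-1-1 {R₁} pres₁ R₁≅R₃ = z-x≉0 (R₃.trans (R₃.sym (≅-rightInverse {R₁} {R₃} R₁≅R₃ (z₃ R₃.- x₃)))
        (R₃.trans (_⟶_.⟦⟧-cong to (R₁-reduced pres₁ (⟦ from ⟧ (z₃ R₃.- x₃))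
          (R₁.trans (R₁.sym (from.*-homo _ _)) (R₁.trans (from.⟦⟧-cong [z-x]²≈0) from.0#-homo)))) (_⟶_.0#-homo to)))
        where
        module R₁ = CommutativeRing R₁
        to : R₁ ⟶ R₃
        to = ≅⇒⟶ R₁≅R₃
        from : R₃ ⟶ R₁
        from = ≅⇒⟵ R₁≅R₃
        module from = _⟶_ from

    R₁≇R₃ : ∀ m n .{{_ : ℕ.NonZero m}} .{{_ : ℕ.NonZero n}} → Coprime m n → ∀ {R₁ R₃} →
      IsPresentation K Rel₁ R₁ → IsPresentation K (Rel₃ m n) R₃ → ¬ (R₁ ≅ R₃)
    -- Once `m` equals `n`, it is a common divisor of both, so coprimality makes it 1.
    R₁≇R₃ m n coprime pres₁ pres₃ R₁≅R₃ = R₁≅R₃⇒m≡n pres₁ pres₃ R₁≅R₃ λ { ≡.refl →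
      case-1-1 (coprime (∣-refl , ∣-refl)) pres₃ }
      where
      case-1-1 : ∀ {m} → m ≡ 1 → ¬ (IsPresentation K (Rel₃ m m) _)
      case-1-1 ≡.refl pres₃ = R₁≇R₃-1-1 pres₃ pres₁ R₁≅R₃

-- The fields ℝ and ℂ

open RealArithmetic

-- Constructive apartness from zero: an eventual positive rational lower bound on the absolute
-- value.
Apart₀ : ℝ → Set
Apart₀ x = ∃ λ ε → 0ℚ ℚ.< ε × ∃ λ N → ∀ n → N ℕ.≤ n → ε ℚ.≤ ℚ.∣ seq x n ∣

∣p∣≤∣p-q∣+∣q∣ : ∀ p q → ℚ.∣ p ∣ ℚ.≤ ℚ.∣ p ℚ.- q ∣ ℚ.+ ℚ.∣ q ∣
∣p∣≤∣p-q∣+∣q∣ p q = ≡.subst (λ r → ℚ.∣ r ∣ ℚ.≤ ℚ.∣ p ℚ.- q ∣ ℚ.+ ℚ.∣ q ∣)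
  (solve 2 (λ a b → (a :- b) :+ b := a) ≡.refl p q) (ℚ.∣p+q∣≤∣p∣+∣q∣ (p ℚ.- q) q)
  where open +-*-Solver using (solve; _:+_; _:-_; _:=_)

-- Let `N` be the Cauchy modulus for a quarter of `ε`. A term past `N` of size at least `ε` would
-- keep all terms past `N` above that quarter, so `x` would be apart from zero. Comparison of
-- rationals is decidable, so each such term is below `ε`.
¬apart⇒≈0 : ∀ x → ¬ Apart₀ x → x ≈ᴿ fromℚ 0ℚ
¬apart⇒≈0 x ¬apart = mk≈ λ ε ε>0 → let
    δ = ½ ℚ.* ε
    δ>0 = half>0 ε>0
    η = ½ ℚ.* δ
    η>0 = half>0 δ>0
    N , near = cauchy x η η>0
  in N , λ n N≤n → small ε N η>0 near n N≤n
  where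
  open ℚ.≤-Reasoning
  small : ∀ ε N → 0ℚ ℚ.< ½ ℚ.* (½ ℚ.* ε) →
    (∀ m n → N ℕ.≤ m → N ℕ.≤ n → ℚ.∣ seq x m ℚ.- seq x n ∣ ℚ.< ½ ℚ.* (½ ℚ.* ε)) →
    ∀ n → N ℕ.≤ n → ℚ.∣ seq x n ℚ.- 0ℚ ∣ ℚ.< ε
  small ε N η>0 near n N≤n with ℚ.∣ seq x n ∣ ℚ.<? ε
  ... | yes xn<ε = ≡.subst (λ a → ℚ.∣ a ∣ ℚ.< ε) (≡.sym (ℚ.+-identityʳ (seq x n))) xn<ε
  ... | no xn≮ε = contradiction (η , η>0 , N , λ k N≤k → ℚ.≮⇒≥ λ xk<η → xn≮ε (begin-strict
      ℚ.∣ seq x n ∣                                 ≤⟨ ∣p∣≤∣p-q∣+∣q∣ (seq x n) (seq x k) ⟩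
      ℚ.∣ seq x n ℚ.- seq x k ∣ ℚ.+ ℚ.∣ seq x k ∣   <⟨ ℚ.+-mono-< (near n k N≤n N≤k) xk<η ⟩
      η ℚ.+ η                                       ≡⟨ half+half δ ⟩
      δ                                             ≡⟨ ℚ.+-identityˡ δ ⟨
      0ℚ ℚ.+ δ                                      ≤⟨ ℚ.+-monoˡ-≤ δ (ℚ.<⇒≤ δ>0) ⟩
      δ ℚ.+ δ                                       ≡⟨ half+half ε ⟩
      ε                                             ∎)) ¬apart
    where
    δ = ½ ℚ.* ε
    η = ½ ℚ.* δ
    δ>0 : 0ℚ ℚ.< δ
    δ>0 = ≡.subst (0ℚ ℚ.<_) (half+half δ) (ℚ.+-mono-< η>0 η>0)

-- Total, with default value 0 at 0, since a sequence bounded away from zero eventually may still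
-- have zeros among its first terms.
recip : ℚ → ℚ
recip q with q ℚ.≟ 0ℚ
... | yes _  = 0ℚ
... | no q≢0 = (ℚ.1/ q) {{ℚ.≢-nonZero q≢0}}

*-recip : ∀ q → 0ℚ ℚ.< ℚ.∣ q ∣ → q ℚ.* recip q ≡ 1ℚ
*-recip q ∣q∣>0 with q ℚ.≟ 0ℚ
... | yes ≡.refl = contradiction ∣q∣>0 (ℚ.<-irrefl ≡.refl)
... | no q≢0     = ℚ.*-inverseʳ q {{ℚ.≢-nonZero q≢0}}

-- Past `N` the reciprocals are bounded by `B = 1/ε`, and their difference is the difference of the
-- terms times a product of two reciprocals, hence times at most `B * B`.
apart⇒invertible : ∀ x → Apart₀ x → ∃ λ y → x *ᴿ y ≈ᴿ fromℚ 1ℚ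
apart⇒invertible x (ε , ε>0 , N , ε≤) =
  mkℝ v v-cauchy , mk≈ λ η η>0 → N , λ n N≤n →
    ≡.subst (λ a → ℚ.∣ a ∣ ℚ.< η) (≡.sym (≡.cong (ℚ._- 1ℚ) (*-recip (u n) (u-nonzero n N≤n)))) η>0
  where
  u v : ℕ → ℚ
  u = seq x
  v n = recip (u n)

  u-nonzero : ∀ n → N ℕ.≤ n → 0ℚ ℚ.< ℚ.∣ u n ∣
  u-nonzero n N≤n = ℚ.<-≤-trans ε>0 (ε≤ n N≤n)

  instance
    ε-positive = ℚ.positive ε>0
    ε-nonZero  = ℚ.pos⇒nonZero ε
  B = ℚ.1/ ε
  instance
    B-positive = ℚ.1/pos⇒pos ε
    B-nonNeg = ℚ.pos⇒nonNeg B

  v≤B : ∀ n → N ℕ.≤ n → ℚ.∣ v n ∣ ℚ.≤ B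
  v≤B n N≤n = begin
    ℚ.∣ v n ∣                             ≡⟨ ℚ.*-identityˡ _ ⟨
    1ℚ ℚ.* ℚ.∣ v n ∣                      ≡⟨ ≡.cong (ℚ._* ℚ.∣ v n ∣) (ℚ.*-inverseˡ ε) ⟨
    B ℚ.* ε ℚ.* ℚ.∣ v n ∣                 ≡⟨ ℚ.*-assoc B ε _ ⟩
    B ℚ.* (ε ℚ.* ℚ.∣ v n ∣)               ≤⟨ ℚ.*-monoˡ-≤-nonNeg B (ℚ.*-monoʳ-≤-nonNeg ℚ.∣ v n ∣ {{ℚ.∣-∣-nonNeg (v n)}} (ε≤ n N≤n)) ⟩
    B ℚ.* (ℚ.∣ u n ∣ ℚ.* ℚ.∣ v n ∣)       ≡⟨ ≡.cong (B ℚ.*_) (ℚ.∣p*q∣≡∣p∣*∣q∣ (u n) (v n)) ⟨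
    B ℚ.* ℚ.∣ u n ℚ.* v n ∣               ≡⟨ ≡.cong (λ a → B ℚ.* ℚ.∣ a ∣) (*-recip (u n) (u-nonzero n N≤n)) ⟩
    B ℚ.* 1ℚ                              ≡⟨ ℚ.*-identityʳ B ⟩
    B                                     ∎
    where open ℚ.≤-Reasoning

  vv≤BB : ∀ m n → N ℕ.≤ m → N ℕ.≤ n → ℚ.∣ v m ℚ.* v n ∣ ℚ.≤ B ℚ.* B
  vv≤BB m n N≤m N≤n = begin
    ℚ.∣ v m ℚ.* v n ∣           ≡⟨ ℚ.∣p*q∣≡∣p∣*∣q∣ (v m) (v n) ⟩
    ℚ.∣ v m ∣ ℚ.* ℚ.∣ v n ∣     ≤⟨ ℚ.*-monoʳ-≤-nonNeg ℚ.∣ v n ∣ {{ℚ.∣-∣-nonNeg (v n)}} (v≤B m N≤m) ⟩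
    B ℚ.* ℚ.∣ v n ∣             ≤⟨ ℚ.*-monoˡ-≤-nonNeg B (v≤B n N≤n) ⟩
    B ℚ.* B                     ∎
    where open ℚ.≤-Reasoning

  BB>0 : 0ℚ ℚ.< B ℚ.* B
  BB>0 = ≡.subst (ℚ._< B ℚ.* B) (ℚ.*-zeroʳ B) (ℚ.*-monoʳ-<-pos B (ℚ.positive⁻¹ B))

  v-difference : ∀ m n → N ℕ.≤ m → N ℕ.≤ n → v m ℚ.* v n ℚ.* (u n ℚ.- u m) ≡ v m ℚ.- v n
  v-difference m n N≤m N≤n = begin
    v m ℚ.* v n ℚ.* (u n ℚ.- u m)                       ≡⟨ solve 4 (λ a b c d → a :* b :* (c :- d) := a :* (c :* b) :- d :* a :* b) ≡.refl (v m) (v n) (u n) (u m) ⟩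
    v m ℚ.* (u n ℚ.* v n) ℚ.- u m ℚ.* v m ℚ.* v n       ≡⟨ ≡.cong₂ (λ a b → v m ℚ.* a ℚ.- b ℚ.* v n) (*-recip (u n) (u-nonzero n N≤n)) (*-recip (u m) (u-nonzero m N≤m)) ⟩
    v m ℚ.* 1ℚ ℚ.- 1ℚ ℚ.* v n                           ≡⟨ ≡.cong₂ ℚ._-_ (ℚ.*-identityʳ (v m)) (ℚ.*-identityˡ (v n)) ⟩
    v m ℚ.- v n                                         ∎
    where
    open ≡.≡-Reasoning
    open +-*-Solver using (solve; _:*_; _:-_; _:=_)

  v-cauchy : Cauchy v
  v-cauchy η η>0 with shrink (B ℚ.* B) BB>0 η>0
  ... | δ , δ>0 , BBδ≡η with cauchy x δ δ>0
  ... | M , near = M ℕ.⊔ N , λ m n ≤m ≤n → let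
      M≤m = ℕ.m⊔n≤o⇒m≤o M N ≤m
      N≤m = ℕ.m⊔n≤o⇒n≤o M N ≤m
      M≤n = ℕ.m⊔n≤o⇒m≤o M N ≤n
      N≤n = ℕ.m⊔n≤o⇒n≤o M N ≤n
    in ≡.subst (λ a → ℚ.∣ a ∣ ℚ.< η) (v-difference m n N≤m N≤n)
      (scaled-< {p = v m ℚ.* v n} {u n ℚ.- u m} BB>0 BBδ≡η (vv≤BB m n N≤m N≤n) (near n m M≤n M≤m))

∣p∣*∣p∣≡p*p : ∀ p → ℚ.∣ p ∣ ℚ.* ℚ.∣ p ∣ ≡ p ℚ.* p
∣p∣*∣p∣≡p*p p with ℚ.∣p∣≡p∨∣p∣≡-p p
... | inj₁ e = ≡.cong₂ ℚ._*_ e e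
... | inj₂ e = ≡.trans (≡.cong₂ ℚ._*_ e e) (solve 1 (λ a → (:- a) :* (:- a) := a :* a) ≡.refl p)
  where open +-*-Solver using (solve; _:*_; :-_; _:=_)

0≤p*p : ∀ p → 0ℚ ℚ.≤ p ℚ.* p
0≤p*p p = ≡.subst (0ℚ ℚ.≤_) (≡.trans (ℚ.∣p*q∣≡∣p∣*∣q∣ p p) (∣p∣*∣p∣≡p*p p)) (ℚ.0≤∣p∣ (p ℚ.* p))

-- Termwise `x² ≤ x² + y²`, so tolerance `ε * ε` for the sum yields tolerance `ε` for `x`.
ℝ-sumOfSquares : SumOfSquares ℝ-commutativeRing
ℝ-sumOfSquares x y (mk≈ null-x²+y²) = mk≈ λ ε ε>0 → let
    N , small = null-x²+y² (ε ℚ.* ε) (square>0 ε>0)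
  in N , λ n N≤n → bound ε ε>0 n (small n N≤n)
  where
  square>0 : ∀ {ε} → 0ℚ ℚ.< ε → 0ℚ ℚ.< ε ℚ.* ε
  square>0 {ε} ε>0 = ≡.subst (ℚ._< ε ℚ.* ε) (ℚ.*-zeroʳ ε) (ℚ.*-monoʳ-<-pos ε {{ℚ.positive ε>0}} ε>0)

  bound : ∀ ε → 0ℚ ℚ.< ε → ∀ n →
    ℚ.∣ seq x n ℚ.* seq x n ℚ.+ seq y n ℚ.* seq y n ℚ.- 0ℚ ∣ ℚ.< ε ℚ.* ε → ℚ.∣ seq x n ℚ.- 0ℚ ∣ ℚ.< ε
  bound ε ε>0 n small = ≡.subst (λ a → ℚ.∣ a ∣ ℚ.< ε) (≡.sym (ℚ.+-identityʳ p)) (ℚ.≰⇒> λ ε≤∣p∣ →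
    ℚ.<-irrefl ≡.refl (begin-strict
      ε ℚ.* ε                                    ≤⟨ ℚ.*-monoˡ-≤-nonNeg ε ε≤∣p∣ ⟩
      ε ℚ.* ℚ.∣ p ∣                              ≤⟨ ℚ.*-monoʳ-≤-nonNeg ℚ.∣ p ∣ {{ℚ.∣-∣-nonNeg p}} ε≤∣p∣ ⟩
      ℚ.∣ p ∣ ℚ.* ℚ.∣ p ∣                        ≡⟨ ∣p∣*∣p∣≡p*p p ⟩
      p ℚ.* p                                    ≡⟨ ℚ.+-identityʳ _ ⟨
      p ℚ.* p ℚ.+ 0ℚ                             ≤⟨ ℚ.+-monoʳ-≤ (p ℚ.* p) (0≤p*p q) ⟩
      p ℚ.* p ℚ.+ q ℚ.* q                        ≡⟨ ℚ.0≤p⇒∣p∣≡p (ℚ.+-mono-≤ (0≤p*p p) (0≤p*p q)) ⟨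
      ℚ.∣ p ℚ.* p ℚ.+ q ℚ.* q ∣                  ≡⟨ ≡.cong ℚ.∣_∣ (ℚ.+-identityʳ _) ⟨
      ℚ.∣ p ℚ.* p ℚ.+ q ℚ.* q ℚ.- 0ℚ ∣           <⟨ small ⟩
      ε ℚ.* ε                                    ∎))
    where
    open ℚ.≤-Reasoning
    p = seq x n
    q = seq y n
    instance
      ε-nonNeg = ℚ.nonNegative (ℚ.<⇒≤ ε>0)

ℝ-isField : IsField ℝ-commutativeRing
ℝ-isField x ¬invertible = ¬apart⇒≈0 x λ apart → ¬invertible (apart⇒invertible x apart)

1≤1+p : ∀ p → 0ℚ ℚ.≤ p → 1ℚ ℚ.≤ 1ℚ ℚ.+ p
1≤1+p p 0≤p = ℚ.≤-trans (ℚ.≤-reflexive (≡.sym (ℚ.+-identityʳ 1ℚ))) (ℚ.+-monoʳ-≤ 1ℚ 0≤p)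

open RawMonoidDefs (CommutativeRing.+-rawMonoid ℝ-commutativeRing) using () renaming (_×_ to _·ᴿ_)

0≤seq-· : ∀ n k → 0ℚ ℚ.≤ seq (n ·ᴿ fromℚ 1ℚ) k
0≤seq-· zero    k = ℚ.≤-refl
0≤seq-· (suc n) k = ℚ.≤-trans (ℚ.<⇒≤ (ℚ.positive⁻¹ 1ℚ)) (1≤1+p (seq (n ·ᴿ fromℚ 1ℚ) k) (0≤seq-· n k))

-- Every term of the sequence representing a positive multiple of 1 is at least 1, so the sequence
-- is not null.
ℝ-characteristicZero : CharacteristicZero ℝ-commutativeRing
ℝ-characteristicZero = mkCharacteristicZero λ n (mk≈ null-n) → not-small n (null-n 1ℚ (ℚ.positive⁻¹ 1ℚ))
  where
  large : ∀ p → 1ℚ ℚ.≤ p → ¬ (ℚ.∣ p ℚ.- 0ℚ ∣ ℚ.< 1ℚ)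
  large p 1≤p small = ℚ.<-irrefl ≡.refl (ℚ.<-≤-trans small (≡.subst (1ℚ ℚ.≤_) (≡.sym (≡.trans (≡.cong ℚ.∣_∣ (ℚ.+-identityʳ p))
    (ℚ.0≤p⇒∣p∣≡p (ℚ.≤-trans (ℚ.<⇒≤ (ℚ.positive⁻¹ 1ℚ)) 1≤p)))) 1≤p))

  not-small : ∀ n → ¬ (∃ λ N → ∀ k → N ℕ.≤ k → ℚ.∣ seq (suc n ·ᴿ fromℚ 1ℚ) k ℚ.- 0ℚ ∣ ℚ.< 1ℚ)
  not-small n (N , small) = large (seq (suc n ·ᴿ fromℚ 1ℚ) N) (1≤1+p (seq (n ·ᴿ fromℚ 1ℚ) N) (0≤seq-· n N)) (small N ℕ.≤-refl)

ℂ-isField : IsField ℂ-commutativeRing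
ℂ-isField = A[i]-isField ℝ-commutativeRing ℝ-isField ℝ-sumOfSquares

ℂ-characteristicZero : CharacteristicZero ℂ-commutativeRing
ℂ-characteristicZero = A[i]-characteristicZero ℝ-commutativeRing ℝ-characteristicZero

-- Presentations of the four rings

module _ where

  open AdjoinI ℝ-commutativeRing using (re; im; _,_)
  open CommutativeRing ℂ-commutativeRing using (_≈_) renaming (Carrier to ℂ)

  -- Only the sequences are compared: unlike the Cauchy moduli, those of closed terms are cheap to evaluate.
  _≐_ : ℂ → ℂ → Set
  z ≐ w = _≡_ {A = (ℕ → ℚ) × (ℕ → ℚ)} (seq (re z) , seq (im z)) (seq (re w) , seq (im w))

  ≡⇒≈ᴿ : ∀ x y → seq x ≡ seq y → x ≈ᴿ y
  ≡⇒≈ᴿ x y x≡y = mk≈ λ ε ε>0 → 0 , λ n _ → ≡.subst (λ q → ℚ.∣ q ∣ ℚ.< ε)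
    (≡.sym (≡.trans (≡.cong (λ s → s n ℚ.- seq y n) x≡y) (ℚ.+-inverseʳ (seq y n)))) ε>0

  ≐⇒≈ : ∀ {z w} → z ≐ w → z ≈ w
  ≐⇒≈ {z} {w} e = ≡⇒≈ᴿ (re z) (re w) (≡.cong proj₁ e) , ≡⇒≈ᴿ (im z) (im w) (≡.cong proj₂ e)

module _ (A : CRing) where
  open CommutativeRing A using (_≈_; refl) renaming (Carrier to C)
  open Polynomial A

  -- Lets coefficients be compared by a finer relation that is cheaper to check; it is iterated once
  -- per variable.
  pointwise⇒≈ᵖ : ∀ {_∼_ : C → C → Set} → (∀ {a b} → a ∼ b → a ≈ b) → ∀ {p q} → Pointwise _∼_ p q → p ≈ᵖ q
  pointwise⇒≈ᵖ ∼⇒≈ []           = mk≈ λ _ → refl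
  pointwise⇒≈ᵖ ∼⇒≈ (a∼b ∷ p∼q) = mk≈ λ
    { zero → ∼⇒≈ a∼b ; (suc k) → coeff-≈ (pointwise⇒≈ᵖ ∼⇒≈ p∼q) k }

module _ (A : CRing) where
  open Quotient A

  -- The generators of R₁ and R₂ in Defs are written with private names, so they are recovered by unification.
  generatorsOf : ∀ {k} {gs : Vector (Carrier A) k} {a b} → Congruent gs a b → Vector (Carrier A) k
  generatorsOf {gs = gs} _ = gs

module _ where

  private
    module P = CommutativeRing (ℂ-commutativeRing [X 2 ])
    free = [X]-isPresentation ℂ-commutativeRing 2
    module R = CommutativeRing R₁
    module R′ = CommutativeRing (ℂ-commutativeRing [X 2 ] / gs₁ free)

    generator : gs₁ free 0F P.≈ generatorsOf (ℂ-commutativeRing [X 2 ]) (R.refl {[]}) 0F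
    generator = pointwise⇒≈ᵖ (ℂ-commutativeRing [X 1 ]) (pointwise⇒≈ᵖ ℂ-commutativeRing ≐⇒≈)
      -- The outer variable is `x`: the coefficient of `x⁰` is `y² − y` and that of `x¹` is `1 − y`.
      ((≡.refl ∷ ≡.refl ∷ ≡.refl ∷ []) ∷ (≡.refl ∷ ≡.refl ∷ []) ∷ [])

  R₁-presentation : IsPresentation ℂ-commutativeRing Rel₁ R₁
  R₁-presentation = transport {Rel = Rel₁} ⟦⟧-Rel₁
    (mkHom id (Congruent-resp λ { 0F → generator }) (λ _ _ → R.refl) (λ _ _ → R.refl) R.refl)
    (mkHom id (Congruent-resp λ { 0F → P.sym generator }) (λ _ _ → R′.refl) (λ _ _ → R′.refl) R′.refl)
    (λ _ → R.refl) (λ _ → R′.refl) (R₁-isPresentation free)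

module _ where

  private
    module P = CommutativeRing (ℂ-commutativeRing [X 3 ])
    free = [X]-isPresentation ℂ-commutativeRing 3
    module R = CommutativeRing R₂
    module R′ = CommutativeRing (ℂ-commutativeRing [X 3 ] / gs₂ free)

    generator : gs₂ free 0F P.≈ generatorsOf (ℂ-commutativeRing [X 3 ]) (R.refl {[]}) 0F
    generator = pointwise⇒≈ᵖ (ℂ-commutativeRing [X 2 ])
      (pointwise⇒≈ᵖ (ℂ-commutativeRing [X 1 ]) (pointwise⇒≈ᵖ ℂ-commutativeRing ≐⇒≈))
      -- By powers of `x`, then of `y`: `z²` and `−z` for `x⁰`, then `−z` and `1` for `x¹`.
      (((≡.refl ∷ ≡.refl ∷ ≡.refl ∷ []) ∷ (≡.refl ∷ ≡.refl ∷ []) ∷ []) ∷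
       ((≡.refl ∷ ≡.refl ∷ []) ∷ (≡.refl ∷ []) ∷ []) ∷ [])

  R₂-presentation : IsPresentation ℂ-commutativeRing Rel₂ R₂
  R₂-presentation = transport {Rel = Rel₂} ⟦⟧-Rel₂
    (mkHom id (Congruent-resp λ { 0F → generator }) (λ _ _ → R.refl) (λ _ _ → R.refl) R.refl)
    (mkHom id (Congruent-resp λ { 0F → P.sym generator }) (λ _ _ → R′.refl) (λ _ _ → R′.refl) R′.refl)
    (λ _ → R.refl) (λ _ → R′.refl) (R₂-isPresentation free)

  module _ (m n : ℕ) where

    private
      module R₃ = CommutativeRing (R₃ m n)
      module R₃′ = CommutativeRing (ℂ-commutativeRing [X 3 ] / gs₃ free m n)
      module R₄ = CommutativeRing (R₄ m n)
      module R₄′ = CommutativeRing (ℂ-commutativeRing [X 3 ] / gs₄ free m n)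

    R₃-presentation : IsPresentation ℂ-commutativeRing (Rel₃ m n) (R₃ m n)
    R₃-presentation = transport {Rel = Rel₃ m n} (λ h → ⟦⟧-Rel₃ h m n)
      (mkHom id (Congruent-resp λ { 0F → generator ; 1F → P.refl {gs₃ free m n 1F} })
        (λ _ _ → R₃.refl) (λ _ _ → R₃.refl) R₃.refl)
      (mkHom id (Congruent-resp λ { 0F → P.sym generator ; 1F → P.refl {gs₃ free m n 1F} })
        (λ _ _ → R₃′.refl) (λ _ _ → R₃′.refl) R₃′.refl)
      (λ _ → R₃.refl) (λ _ → R₃′.refl) (R₃-isPresentation free m n)

    R₄-presentation : IsPresentation ℂ-commutativeRing (Rel₄ m n) (R₄ m n)
    R₄-presentation = transport {Rel = Rel₄ m n} (λ h → ⟦⟧-Rel₄ h m n)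
      (mkHom id (Congruent-resp λ { 0F → generator ; 1F → P.refl {gs₄ free m n 1F} })
        (λ _ _ → R₄.refl) (λ _ _ → R₄.refl) R₄.refl)
      (mkHom id (Congruent-resp λ { 0F → P.sym generator ; 1F → P.refl {gs₄ free m n 1F} })
        (λ _ _ → R₄′.refl) (λ _ _ → R₄′.refl) R₄′.refl)
      (λ _ → R₄.refl) (λ _ → R₄′.refl) (R₄-isPresentation free m n)

-- The six pairs of rings over ℂ

theorem3p11 : ∀ (m n m′ n′ : ℕ) .{{_ : NonZero m}} .{{_ : NonZero n}} .{{_ : NonZero m′}} .{{_ : NonZero n′}} →
    Coprime m n → Coprime m′ n′ →
    AllPairs (λ A B → ¬ (A ≅ B)) (R₁ ∷ R₂ ∷ R₃ m n ∷ R₄ m′ n′ ∷ [])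
theorem3p11 m n m′ n′ coprime _ =
  (R₁≇R₂ ∷ R₁≇R₃′ ∷ R₁≇R₄ ∷ []) ∷ (R₂≇R₃ ∷ R₂≇R₄ ∷ []) ∷ (R₃≇R₄ ∷ []) ∷ [] ∷ []
  where
  line = [X]-isAffineLine ℂ-characteristicZero ℂ-isField
  plane = [X]-isAffinePlane ℂ-characteristicZero ℂ-isField
  open IsAffinePlane plane using (isDomain; char0)

  R₁≇R₂ : ¬ (R₁ ≅ R₂)
  R₁≇R₂ = curve≇R₂ ℂ-characteristicZero ℂ-isField plane _
    (R₁-curve ℂ-characteristicZero ℂ-isField isDomain R₁-presentation) R₂-presentation

  R₁≇R₃′ : ¬ (R₁ ≅ R₃ m n)
  R₁≇R₃′ = R₁≇R₃ ℂ-characteristicZero ℂ-isField line m n coprime R₁-presentation (R₃-presentation m n)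

  R₁≇R₄ : ¬ (R₁ ≅ R₄ m′ n′)
  R₁≇R₄ = R≇R₄ ℂ-characteristicZero ℂ-isField line {m′} {n′} (R₄-presentation m′ n′)
    (R₁-nonconstantCurve ℂ-characteristicZero ℂ-isField line R₁-presentation)

  R₂≇R₃ : ¬ (R₂ ≅ R₃ m n)
  -- The isomorphism is reversed because `curve≇R₂` expects R₂ as its target.
  R₂≇R₃ R₂≅R₃ = curve≇R₂ ℂ-characteristicZero ℂ-isField plane _
    (R₃-curve ℂ-characteristicZero ℂ-isField isDomain char0 {m} {n} (R₃-presentation m n)) R₂-presentation
    (≅-sym {R₂} {R₃ m n} R₂≅R₃)

  R₂≇R₄ : ¬ (R₂ ≅ R₄ m′ n′)
  R₂≇R₄ = R≇R₄ ℂ-characteristicZero ℂ-isField line {m′} {n′} (R₄-presentation m′ n′)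
    (R₂-nonconstantCurve ℂ-characteristicZero ℂ-isField line R₂-presentation)

  R₃≇R₄ : ¬ (R₃ m n ≅ R₄ m′ n′)
  R₃≇R₄ = R≇R₄ ℂ-characteristicZero ℂ-isField line {m′} {n′} (R₄-presentation m′ n′)
    (R₃-nonconstantCurve ℂ-characteristicZero ℂ-isField line (R₃-presentation m n))
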